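{- Let $k\ge4$ be an even integer such that every plane graph $H$ with $\Delta^*(H)\le k$ has a cyclic colouring using at most $\frac32 k$ colours. Then, if $G$ is a planar graph with maximum degree $\Delta(G)$ satisfying $\chi_k(G)\le\bigl\lfloor\frac{\Delta(G)-1}{k}\bigr\rfloor+3$, we also have $\chi(G^2)=\chi_1(G)\le\bigl\lfloor\frac32\,\Delta(G)\bigr\rfloor+\frac92 k-1$.
   Context: All graphs are finite and simple. A plane graph is a planar graph with a prescribed planar embedding; $\Delta^*(H)$ denotes the size (number of vertices on its boundary) of a largest face of the plane graph $H$. A cyclic colouring of a plane graph is a vertex colouring in which any two vertices incident to a common face receive distinct colours. $G^2$ is the graph on $V(G)$ with an edge between any two distinct vertices at distance at most two in $G$, and $\chi$ denotes the chromatic number. For an integer $k\ge1$, a $k$-frugal colouring of $G$ is a proper vertex colouring such that no colour appears more than $k$ times in the neighbourhood of any vertex; $\chi_k(G)$ is the least number of colours in a $k$-frugal colouring of $G$. -}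

module Defs where

open import Data.Nat using (ℕ; zero; suc; _+_; _*_; _∸_; _≤_; _<_; _⊔_; _≤ᵇ_)
open import Data.Nat.DivMod using (_/_)
open import Data.Nat.Divisibility using (_∣_)
open import Data.Bool using (Bool; true; false; if_then_else_; _∧_; _∨_; not)
open import Data.Fin using (Fin; toℕ; _≟_)
open import Data.List using (List; length; filter; map; foldr; upTo)
open import Data.Bool.ListAction using (any; all)
open import Data.List.Base using (allFin)
open import Data.Product using (_×_; _,_; proj₁; proj₂; Σ; ∃; ∃-syntax)
open import Data.Sum using (_⊎_)
open import Relation.Nullary using (¬_)
open import Relation.Nullary.Decidable using (⌊_⌋)
open import Relation.Binary.PropositionalEquality using (_≡_; _≢_)
open import Function using (_∘_)

record Graph (n : ℕ) : Set where
  field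
    adj    : Fin n → Fin n → Bool
    sym    : ∀ u v → adj u v ≡ adj v u
    irrefl : ∀ u → adj u u ≡ false
open Graph public

_==_ : ∀ {n} → Fin n → Fin n → Bool
u == v = ⌊ u ≟ v ⌋

countV : ∀ {n} → (Fin n → Bool) → ℕ
countV {n} p = length (filter (λ v → p v ≟ᵇ true) (allFin n))
  where
  open import Data.Bool.Properties using () renaming (_≟_ to _≟ᵇ_)

degree : ∀ {n} → Graph n → Fin n → ℕ
degree G u = countV (adj G u)

maxDegree : ∀ {n} → Graph n → ℕ
maxDegree {n} G = foldr _⊔_ 0 (map (degree G) (allFin n))

square : ∀ {n} → Graph n → Graph n
square {n} G = record
  { adj    = a2
  ; sym    = sym2
  ; irrefl = irr2
  }
  where
  a2 : Fin n → Fin n → Bool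
  a2 u v = not (u == v) ∧ (adj G u v ∨ any (λ w → adj G u w ∧ adj G w v) (allFin n))
  open import Relation.Binary.PropositionalEquality using (refl; cong; cong₂; trans)
  open import Data.Bool.Properties using (∧-comm)
  open import Data.List.Properties using (map-cong)
  ==-sym : ∀ u v → (u == v) ≡ (v == u)
  ==-sym u v with u ≟ v | v ≟ u
  ... | Relation.Nullary.yes _ | Relation.Nullary.yes _ = refl
  ... | Relation.Nullary.no _  | Relation.Nullary.no _  = refl
  ... | Relation.Nullary.yes p | Relation.Nullary.no q  = Data.Empty.⊥-elim (q (Relation.Binary.PropositionalEquality.sym p))
    where import Data.Empty
  ... | Relation.Nullary.no p  | Relation.Nullary.yes q = Data.Empty.⊥-elim (p (Relation.Binary.PropositionalEquality.sym q))
    where import Data.Empty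
  anyEq : ∀ u v → any (λ w → adj G u w ∧ adj G w v) (allFin n) ≡ any (λ w → adj G v w ∧ adj G w u) (allFin n)
  anyEq u v = cong (foldr _∨_ false) (map-cong (λ w → trans (cong₂ _∧_ (sym G u w) (sym G w v)) (∧-comm (adj G w u) (adj G v w))) (allFin n))
  sym2 : ∀ u v → a2 u v ≡ a2 v u
  sym2 u v = cong₂ _∧_ (cong not (==-sym u v)) (cong₂ _∨_ (sym G u v) (anyEq u v))
  irr2 : ∀ u → a2 u u ≡ false
  irr2 u with u ≟ u
  ... | Relation.Nullary.yes _ = refl
  ... | Relation.Nullary.no ¬p = Data.Empty.⊥-elim (¬p refl)
    where import Data.Empty

Proper : ∀ {n m} → Graph n → (Fin n → Fin m) → Set
Proper G c = ∀ u v → adj G u v ≡ true → c u ≢ c v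

Colourable : ∀ {n} → Graph n → ℕ → Set
Colourable G m = Σ (_ → Fin m) λ c → Proper G c

IsChromaticNumber : ∀ {n} → Graph n → ℕ → Set
IsChromaticNumber G χ = Colourable G χ × (∀ m → m < χ → ¬ Colourable G m)

Frugal : ∀ {n m} → ℕ → Graph n → (Fin n → Fin m) → Set
Frugal k G c = Proper G c ×
  (∀ u a → countV (λ v → adj G u v ∧ (c v == a)) ≤ k)

FrugalColourable : ∀ {n} → ℕ → Graph n → ℕ → Set
FrugalColourable k G m = Σ (_ → Fin m) λ c → Frugal k G c

IsFrugalChromaticNumber : ∀ {n} → ℕ → Graph n → ℕ → Set
IsFrugalChromaticNumber k G χ =
  FrugalColourable k G χ × (∀ m → m < χ → ¬ FrugalColourable k G m)

-- Plane graphs, as connected combinatorial maps (rotation systems)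
-- of genus 0.

iter : ∀ {A : Set} → (A → A) → ℕ → A → A
iter f zero    x = x
iter f (suc i) x = f (iter f i x)

data Reach {n} (G : Graph n) : Fin n → Fin n → Set where
  here : ∀ {u} → Reach G u u
  step : ∀ {u w v} → adj G u w ≡ true → Reach G w v → Reach G u v

Connected : ∀ {n} → Graph n → Set
Connected G = ∀ u v → Reach G u v

Dart : ℕ → Set
Dart n = Fin n × Fin n

module _ {n : ℕ} (G : Graph n) (rot : Fin n → Fin n → Fin n) where

  faceStep : Dart n → Dart n
  faceStep (u , v) = (v , rot v u)

  walk : ℕ → Dart n → Dart n
  walk = iter faceStep

  isDart : Dart n → Bool
  isDart (u , v) = adj G u v

  code : Dart n → ℕ
  code (u , v) = toℕ u * n + toℕ v

  -- d is the code-minimal dart of its face (orbits have length ≤ n*n)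
  isFaceRep : Dart n → Bool
  isFaceRep d = all (λ i → code d ≤ᵇ code (walk i d)) (upTo (n * n))

  dartCount : ℕ
  dartCount = length (filter (λ d → isDart d Data.Bool.Properties.≟ true)
                        (Data.List.cartesianProduct (allFin n) (allFin n)))
    where import Data.Bool.Properties

  faceCount' : ℕ
  faceCount' = length (filter (λ d → (isDart d ∧ isFaceRep d) Data.Bool.Properties.≟ true)
                        (Data.List.cartesianProduct (allFin n) (allFin n)))
    where import Data.Bool.Properties

  -- number of faces; an edgeless (one-vertex) map has one face
  faceCount : ℕ
  faceCount = faceCount' + (if dartCount Data.Nat.≡ᵇ 0 then 1 else 0)
    where import Data.Nat

  onFace : Dart n → Fin n → Bool
  onFace d w = any (λ i → proj₁ (walk i d) == w) (upTo (n * n))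

  faceSize : Dart n → ℕ
  faceSize d = countV (onFace d)

record PlaneGraph (n : ℕ) : Set where
  field
    graph     : Graph n
    -- rotation at u: rot u v is the neighbour of u following v in the
    -- clockwise order around u
    rot       : Fin n → Fin n → Fin n
    rot-adj   : ∀ u v → adj graph u v ≡ true → adj graph u (rot u v) ≡ true
    rot-cycle : ∀ u v w → adj graph u v ≡ true → adj graph u w ≡ true →
                ∃[ i ] iter (rot u) i v ≡ w
    connected : Connected graph
    -- Euler's formula V - E + F = 2 (genus 0), with 2E = #darts
    euler     : 2 * n + 2 * faceCount graph rot ≡ dartCount graph rot + 4
open PlaneGraph public

MaxFaceSizeAtMost : ∀ {n} → PlaneGraph n → ℕ → Set
MaxFaceSizeAtMost H k =
  ∀ u v → adj (graph H) u v ≡ true → faceSize (graph H) (rot H) (u , v) ≤ k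

Cyclic : ∀ {n m} → PlaneGraph n → (Fin n → Fin m) → Set
Cyclic H c = ∀ u v → adj (graph H) u v ≡ true → ∀ x y →
  onFace (graph H) (rot H) (u , v) x ≡ true →
  onFace (graph H) (rot H) (u , v) y ≡ true → x ≢ y → c x ≢ c y

CyclicColourable : ∀ {n} → PlaneGraph n → ℕ → Set
CyclicColourable H m = Σ (_ → Fin m) λ c → Cyclic H c

Planar : ∀ {n} → Graph n → Set
Planar {n} G = n ≡ 0 ⊎
  Σ (PlaneGraph n) λ H → ∀ u v → adj G u v ≡ true → adj (graph H) u v ≡ true

{-# OPTIONS --safe #-}

-- Let C be a colour class of a k-frugal colouring of G.  A vertex outside C has at most k neighbours
-- in C, and these have to receive distinct colours; a plane graph on C in which they lie on a common
-- face of size at most k is cyclically coloured with 3k/2 colours.  Doing this for each of the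
-- ⌊(Δ−1)/k⌋ + 3 classes gives the bound.
--
-- The neighbourhoods in C are the hyperedges of a planar hypermap.  Embeddings are pairs of
-- permutations p, q of a finite set, and genus 0 is the equality in
--   z p + z q + z (p ∙ q) ≤ N + 2c,
-- where z counts cycles and c components.  Splitting a cycle of q never increases the difference of
-- the two sides, which vanishes for q = id; so the inequality holds, and equality survives every
-- deletion of edges or darts.
-- Replacing hyperedges by polygons and adding a vertex in each remaining face gives a plane multigraph
-- with faces of size at most k.  Since the hypothesis concerns simple graphs, two parallel edges
-- e, e′ must be removed: separating the ends of e from those of e′ adds two vertices and conjugates
-- the face permutation, so equality forces a new component; the two parts are coloured by induction
-- and their colours are matched at the ends of e.
module Submission where

open import Defs renaming (sym to adj-sym; irrefl to adj-irrefl)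
open import Data.Bool using (Bool; true; false; _∧_; T)
import Data.Bool.Properties as Bool
open import Data.Bool.ListAction using (any; all)
open import Data.Empty using (⊥)
open import Data.Fin using (Fin; zero; suc; toℕ; fromℕ<; combine; finToFun; funToFin)
import Data.Fin.Properties as Fin
open import Data.List using (List; []; _∷_; _++_; map; filter; foldr; length; lookup; upTo; allFin;
  cartesianProduct)
import Data.List.Properties as List
open import Data.List.Membership.Propositional using (_∈_; _∉_; find; lose)
open import Data.List.Membership.Propositional.Properties
  using (∈-map⁺; ∈-map⁻; ∈-++⁺ˡ; ∈-++⁺ʳ; ∈-++⁻; ∈-filter⁺; ∈-filter⁻;
          ∈-allFin; ∈-upTo⁺; ∈-cartesianProduct⁺; ∈-lookup)
open import Data.List.Relation.Unary.All as All using (All; []; _∷_)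
import Data.List.Relation.Unary.All.Properties as All
open import Data.List.Relation.Unary.Any as Any using (Any; here; there; any?; index)
import Data.List.Relation.Unary.Any.Properties as Any
open import Data.List.Relation.Unary.AllPairs as AllPairs using (AllPairs; []; _∷_)
open import Data.List.Relation.Unary.Unique.Propositional using (Unique)
import Data.List.Relation.Unary.Unique.Propositional.Properties as Unique
open import Data.Nat using (ℕ; zero; suc; _+_; _*_; _∸_; _^_; _⊔_; _≤_; _<_; z≤n; s≤s; NonZero; _≤ᵇ_)
open import Data.Nat.DivMod using (_/_; _%_; m%n<n; m≡m%n+[m/n]*n; m*n/n≡m; /-monoˡ-≤; m/n*n≤m)
open import Data.Nat.Divisibility using (_∣_; divides)
import Data.Nat.Properties as ℕ
open import Data.Nat.Tactic.RingSolver using (solve-∀)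
open import Data.Product using (Σ; ∃; _×_; _,_; proj₁; proj₂; Σ-syntax; ∃-syntax)
import Data.Product.Properties as Product
open import Data.Sum using (_⊎_; inj₁; inj₂; [_,_]′)
import Data.Sum.Properties as Sum
open import Data.Unit using (⊤; tt)
open import Function using (_∘_; id; _on_; case_of_)
open import Relation.Binary using (DecidableEquality; IsEquivalence; Decidable; tri<; tri≈; tri>)
import Relation.Binary.Construct.On as On
open import Relation.Binary.PropositionalEquality
  using (_≡_; _≢_; refl; sym; trans; cong; cong₂; subst; subst₂; isEquivalence; module ≡-Reasoning)
open import Relation.Nullary using (¬_; Dec; yes; no; contradiction)
open import Relation.Nullary.Decidable using (¬?; _×-dec_; _⊎-dec_; _→-dec_; map′; isYes)

-- Counting the classes of an equivalence relation on a finite set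

-- Deleting one of two parallel edges would fuse its two faces into one that may exceed `k`; this is
-- why parallel edges are cut apart. They arise in any case: a hyperedge with two points becomes a
-- digon, and two corners of one face at the same vertex give parallel spokes. The new vertices turn
-- everything between the hyperedges into triangles, so the faces of the hypermap may be arbitrarily
-- long and only 3 ≤ `k` matters there. Deletions never change the underlying set: a deleted dart
-- becomes a fixed point. Every step is then a product with transpositions, each of which changes a
-- number of cycles by one, and counting components admits disconnected maps. Plane graphs in the
-- sense of the hypothesis, connected and simple, occur only at the two ends: the embedding of G is
-- translated into permutations, and the simple connected maps left at the end are translated back.
-- In the bound, 9k/2 is the contribution of the three extra classes, 3k/2 colours each.

record Eqv (A : Set) : Set₁ where
  field
    rel   : A → A → Set
    equiv : IsEquivalence rel
    rel?  : Decidable rel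
  open IsEquivalence equiv public
    renaming (refl to ~refl; sym to ~sym; trans to ~trans)

infix 4 _∋_~_
_∋_~_ : {A : Set} → Eqv A → A → A → Set
R ∋ x ~ y = Eqv.rel R x y

≡-eqv : {A : Set} → DecidableEquality A → Eqv A
≡-eqv _≟_ = record { rel = _≡_ ; equiv = isEquivalence ; rel? = _≟_ }

module _ {A : Set} (R : Eqv A) where
  open Eqv R

  reps : List A → List A
  reps []       = []
  reps (x ∷ xs) with any? (rel? x) xs
  ... | yes _ = reps xs
  ... | no  _ = x ∷ reps xs

  # : List A → ℕ
  # xs = length (reps xs)

  reps-⊆ : ∀ xs {y} → y ∈ reps xs → y ∈ xs
  reps-⊆ (x ∷ xs) y∈ with any? (rel? x) xs
  reps-⊆ (x ∷ xs) y∈         | yes _ = there (reps-⊆ xs y∈)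
  reps-⊆ (x ∷ xs) (here y≡x) | no  _ = here y≡x
  reps-⊆ (x ∷ xs) (there y∈) | no  _ = there (reps-⊆ xs y∈)

  reps-independent : ∀ xs → AllPairs (λ x y → ¬ rel x y) (reps xs)
  reps-independent []       = []
  reps-independent (x ∷ xs) with any? (rel? x) xs
  ... | yes _ = reps-independent xs
  ... | no ¬a = All.tabulate (λ y∈ x~y → ¬a (lose (reps-⊆ xs y∈) x~y)) ∷ reps-independent xs

  reps-complete : ∀ xs {x} → x ∈ xs → Any (rel x) (reps xs)
  reps-complete (y ∷ ys) x∈ with any? (rel? y) ys
  reps-complete (y ∷ ys) (here refl) | yes a with find a
  ... | z , z∈ , y~z = Any.map (~trans y~z) (reps-complete ys z∈)
  reps-complete (y ∷ ys) (there x∈)  | yes _ = reps-complete ys x∈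
  reps-complete (y ∷ ys) (here refl) | no _ = here ~refl
  reps-complete (y ∷ ys) (there x∈)  | no _ = there (reps-complete ys x∈)

AllPairs-lookup : ∀ {A : Set} {R : A → A → Set} {xs} → AllPairs R xs →
                  ∀ {i j} → toℕ i < toℕ j → R (lookup xs i) (lookup xs j)
AllPairs-lookup {xs = _ ∷ xs} (rs ∷ _) {zero} {suc j} _ = All.lookup rs (∈-lookup {xs = xs} j)
AllPairs-lookup (_ ∷ ps) {suc i} {suc j} (s≤s i<j) = AllPairs-lookup ps i<j

reps-distinct : ∀ {A : Set} (R : Eqv A) xs {i j} →
                R ∋ lookup (reps R xs) i ~ lookup (reps R xs) j → i ≡ j
reps-distinct R xs {i} {j} r with ℕ.<-cmp (toℕ i) (toℕ j)
... | tri≈ _ i≡j _ = Fin.toℕ-injective i≡j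
... | tri< i<j _ _ = contradiction r (AllPairs-lookup (reps-independent R xs) i<j)
... | tri> _ _ j<i =
  contradiction (Eqv.~sym R r) (AllPairs-lookup (reps-independent R xs) j<i)

#-inj : ∀ {A B : Set} (R : Eqv A) (S : Eqv B) {xs ys} (f : A → B) →
        (∀ {x} → x ∈ xs → Any (Eqv.rel S (f x)) ys) →
        (∀ {x y} → x ∈ xs → y ∈ xs → S ∋ f x ~ f y → R ∋ x ~ y) →
        # R xs ≤ # S ys
#-inj R S {xs} {ys} f into reflect = Fin.injective⇒≤ {f = g} g-injective
  where
  r : Fin (# R xs) → _
  r = lookup (reps R xs)
  r∈ : ∀ i → r i ∈ xs
  r∈ i = reps-⊆ R xs (∈-lookup {xs = reps R xs} i)
  hit : ∀ i → Any (Eqv.rel S (f (r i))) (reps S ys)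
  hit i with find (into (r∈ i))
  ... | y , y∈ , p = Any.map (Eqv.~trans S p) (reps-complete S ys y∈)
  -- Only the chosen representatives are mapped, so `f` need not respect `R`; reflecting `S` is
  -- enough for injectivity.
  g : Fin (# R xs) → Fin (# S ys)
  g i = index (hit i)
  related : ∀ {i j} → g i ≡ g j → R ∋ r i ~ r j
  related {i} {j} eq = reflect (r∈ i) (r∈ j)
    (Eqv.~trans S (Any.lookup-index (hit i))
      (subst (λ k → S ∋ lookup (reps S ys) k ~ f (r j)) (sym eq)
        (Eqv.~sym S (Any.lookup-index (hit j)))))
  g-injective : ∀ {i j} → g i ≡ g j → i ≡ j
  g-injective eq = reps-distinct R xs (related eq)

#-antitone : ∀ {A : Set} (R S : Eqv A) xs →
             (∀ {x y} → x ∈ xs → y ∈ xs → R ∋ x ~ y → S ∋ x ~ y) → # S xs ≤ # R xs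
#-antitone R S xs R⊆S = #-inj S R id (λ x∈ → lose x∈ (Eqv.~refl R)) R⊆S

#-unique : ∀ {A : Set} (_≟_ : DecidableEquality A) {xs} → Unique xs → # (≡-eqv _≟_) xs ≡ length xs
#-unique _≟_ []         = refl
#-unique _≟_ {x ∷ xs} (x∉ ∷ u) with any? (x ≟_) xs
... | yes x∈ = contradiction x∈ (All.All¬⇒¬Any x∉)
... | no  _  = cong suc (#-unique _≟_ u)

#≤length : ∀ {A : Set} (R : Eqv A) xs → # R xs ≤ length xs
#≤length R []       = z≤n
#≤length R (x ∷ xs) with any? (Eqv.rel? R x) xs
... | yes _ = ℕ.m≤n⇒m≤1+n (#≤length R xs)
... | no  _ = s≤s (#≤length R xs)

module _ {A B : Set} (R : Eqv A) (S : Eqv B) where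

  ⊎-rel : A ⊎ B → A ⊎ B → Set
  ⊎-rel (inj₁ x) (inj₁ y) = R ∋ x ~ y
  ⊎-rel (inj₂ x) (inj₂ y) = S ∋ x ~ y
  ⊎-rel _        _        = ⊥

  infixr 1 _⊎-eqv_
  _⊎-eqv_ : Eqv (A ⊎ B)
  _⊎-eqv_ = record
    { rel   = ⊎-rel
    ; equiv = record
      { refl  = λ { {inj₁ _} → Eqv.~refl R ; {inj₂ _} → Eqv.~refl S }
      ; sym   = λ { {inj₁ _} {inj₁ _} → Eqv.~sym R ; {inj₂ _} {inj₂ _} → Eqv.~sym S }
      ; trans = λ { {inj₁ _} {inj₁ _} {inj₁ _} → Eqv.~trans R
                  ; {inj₂ _} {inj₂ _} {inj₂ _} → Eqv.~trans S } }
    ; rel?  = λ { (inj₁ x) (inj₁ y) → Eqv.rel? R x y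
                ; (inj₂ x) (inj₂ y) → Eqv.rel? S x y
                ; (inj₁ _) (inj₂ _) → no λ ()
                ; (inj₂ _) (inj₁ _) → no λ () } }

  private
    embed : List A → List B → List (A ⊎ B)
    embed xs ys = map inj₁ xs ++ map inj₂ ys

    #-inj₂ : ∀ ys → # _⊎-eqv_ (map inj₂ ys) ≡ # S ys
    #-inj₂ []       = refl
    #-inj₂ (y ∷ ys) with any? (⊎-rel? (inj₂ y)) (map inj₂ ys) | any? (Eqv.rel? S y) ys
      where ⊎-rel? = Eqv.rel? _⊎-eqv_
    ... | yes _ | yes _ = #-inj₂ ys
    ... | no  _ | no  _ = cong suc (#-inj₂ ys)
    ... | yes a | no ¬a = contradiction (Any.map⁻ a) ¬a
    ... | no ¬a | yes a = contradiction (Any.map⁺ a) ¬a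

  #-⊎ : ∀ xs ys → # _⊎-eqv_ (embed xs ys) ≡ # R xs + # S ys
  #-⊎ []       ys = #-inj₂ ys
  #-⊎ (x ∷ xs) ys with any? (Eqv.rel? _⊎-eqv_ (inj₁ x)) (embed xs ys) | any? (Eqv.rel? R x) xs
  ... | yes _ | yes _ = #-⊎ xs ys
  ... | no  _ | no  _ = cong suc (#-⊎ xs ys)
  ... | no ¬a | yes a = contradiction (Any.++⁺ˡ (Any.map⁺ a)) ¬a
  ... | yes a | no ¬a with Any.++⁻ (map inj₁ xs) a
  ...   | inj₁ b = contradiction (Any.map⁻ b) ¬a
  ...   | inj₂ b = contradiction (proj₂ (proj₂ (find (Any.map⁻ b)))) λ ()

module _ {A : Set} (R : Eqv A) (a b : A) where
  open Eqv R

  -- A chain using the new pair twice can be shortened to one using it at most once. So these three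
  -- cases are already transitive, and the relation stays decidable.
  merge-rel : A → A → Set
  merge-rel x y = rel x y ⊎ (rel x a × rel b y ⊎ rel x b × rel a y)

  merge : Eqv A
  merge = record
    { rel   = merge-rel
    ; equiv = record { refl = inj₁ ~refl ; sym = msym ; trans = mtrans }
    ; rel?  = λ x y → rel? x y ⊎-dec ((rel? x a ×-dec rel? b y) ⊎-dec (rel? x b ×-dec rel? a y)) }
    where
    msym : ∀ {x y} → merge-rel x y → merge-rel y x
    msym (inj₁ p)              = inj₁ (~sym p)
    msym (inj₂ (inj₁ (p , q))) = inj₂ (inj₂ (~sym q , ~sym p))
    msym (inj₂ (inj₂ (p , q))) = inj₂ (inj₁ (~sym q , ~sym p))
    mtrans : ∀ {x y z} → merge-rel x y → merge-rel y z → merge-rel x z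
    mtrans (inj₁ p) (inj₁ q)                          = inj₁ (~trans p q)
    mtrans (inj₁ p) (inj₂ (inj₁ (q , r)))             = inj₂ (inj₁ (~trans p q , r))
    mtrans (inj₁ p) (inj₂ (inj₂ (q , r)))             = inj₂ (inj₂ (~trans p q , r))
    mtrans (inj₂ (inj₁ (p , q))) (inj₁ r)             = inj₂ (inj₁ (p , ~trans q r))
    mtrans (inj₂ (inj₂ (p , q))) (inj₁ r)             = inj₂ (inj₂ (p , ~trans q r))
    mtrans (inj₂ (inj₁ (p , q))) (inj₂ (inj₁ (r , s))) = inj₂ (inj₁ (p , s))
    mtrans (inj₂ (inj₁ (p , q))) (inj₂ (inj₂ (r , s))) = inj₁ (~trans p s)
    mtrans (inj₂ (inj₂ (p , q))) (inj₂ (inj₁ (r , s))) = inj₁ (~trans p s)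
    mtrans (inj₂ (inj₂ (p , q))) (inj₂ (inj₂ (r , s))) = inj₂ (inj₂ (p , s))

  merge-least : ∀ {S : A → A → Set} → IsEquivalence S → (∀ {x y} → rel x y → S x y) → S a b →
                ∀ {x y} → merge-rel x y → S x y
  merge-least eq R⊆S ab = λ
    { (inj₁ p)              → R⊆S p
    ; (inj₂ (inj₁ (p , q))) → S.trans (R⊆S p) (S.trans ab (R⊆S q))
    ; (inj₂ (inj₂ (p , q))) → S.trans (R⊆S p) (S.trans (S.sym ab) (R⊆S q)) }
    where module S = IsEquivalence eq

  merge-ab : merge-rel a b
  merge-ab = inj₂ (inj₁ (~refl , ~refl))

⊤-eqv : Eqv ⊤
⊤-eqv = record { rel = λ _ _ → ⊤ ; equiv = record { refl = tt ; sym = id ; trans = λ _ _ → tt } ; rel? = λ _ _ → yes tt }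

-- The class of b is split off as an extra point.
#-merge : ∀ {A : Set} (R : Eqv A) {a b xs} → a ∈ xs → b ∈ xs → ¬ R ∋ a ~ b →
          # R xs ≡ suc (# (merge R a b) xs)
#-merge {A} R {a} {b} {xs} a∈ b∈ a≁b = ℕ.≤-antisym
  (subst (# R xs ≤_) split (#-inj R S to to-into to-reflect))
  (subst (_≤ # R xs) split (#-inj S R from from-into from-reflect))
  where
  open Eqv R
  M = merge R a b
  S = ⊤-eqv ⊎-eqv M
  split : # S (map inj₁ (tt ∷ []) ++ map inj₂ xs) ≡ suc (# M xs)
  split = #-⊎ ⊤-eqv M (tt ∷ []) xs
  to : A → ⊤ ⊎ A
  to x with rel? x b
  ... | yes _ = inj₁ tt
  ... | no  _ = inj₂ x
  to-into : ∀ {x} → x ∈ xs → Any (Eqv.rel S (to x)) (inj₁ tt ∷ map inj₂ xs)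
  to-into {x} x∈ with rel? x b
  ... | yes _ = here tt
  ... | no  _ = there (lose (∈-map⁺ inj₂ x∈) (Eqv.~refl M))
  to-reflect : ∀ {x y} → x ∈ xs → y ∈ xs → S ∋ to x ~ to y → R ∋ x ~ y
  to-reflect {x} {y} _ _ p with rel? x b | rel? y b
  ... | yes xb | yes yb = ~trans xb (~sym yb)
  ... | no ¬xb | no ¬yb with p
  ...   | inj₁ q             = q
  ...   | inj₂ (inj₁ (_ , by)) = contradiction (~sym by) ¬yb
  ...   | inj₂ (inj₂ (xb , _)) = contradiction xb ¬xb
  from : ⊤ ⊎ A → A
  from (inj₁ _) = b
  from (inj₂ x) with rel? x b
  ... | yes _ = a
  ... | no  _ = x
  from-into : ∀ {x} → x ∈ inj₁ tt ∷ map inj₂ xs → Any (rel (from x)) xs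
  from-into (here refl) = lose b∈ ~refl
  from-into (there x∈) with ∈-map⁻ inj₂ x∈
  ... | x , x∈′ , refl with rel? x b
  ...   | yes _ = lose a∈ ~refl
  ...   | no  _ = lose x∈′ ~refl
  from-reflect : ∀ {x y} → x ∈ inj₁ tt ∷ map inj₂ xs → y ∈ inj₁ tt ∷ map inj₂ xs →
                 R ∋ from x ~ from y → S ∋ x ~ y
  from-reflect {inj₁ _} {inj₁ _} _ _ _ = tt
  from-reflect {inj₁ _} {inj₂ y} _ _ p with rel? y b
  ... | yes _  = a≁b (~sym p)
  ... | no ¬yb = ¬yb (~sym p)
  from-reflect {inj₂ x} {inj₁ _} _ _ p with rel? x b
  ... | yes _  = a≁b p
  ... | no ¬xb = ¬xb p
  from-reflect {inj₂ x} {inj₂ y} _ _ p with rel? x b | rel? y b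
  ... | yes xb | yes yb = inj₁ (~trans xb (~sym yb))
  ... | yes xb | no  _  = inj₂ (inj₂ (xb , p))
  ... | no  _  | yes yb = inj₂ (inj₁ (p , ~sym yb))
  ... | no  _  | no  _  = inj₁ p

-- Permutations and the genus inequality

record Perm (A : Set) : Set where
  field
    to from : A → A
    to-from : ∀ x → to (from x) ≡ x
    from-to : ∀ x → from (to x) ≡ x

  injective : ∀ {x y} → to x ≡ to y → x ≡ y
  injective {x} {y} eq = trans (sym (from-to x)) (trans (cong from eq) (from-to y))
open Perm

infixl 7 _∙_
_∙_ : ∀ {A} → Perm A → Perm A → Perm A
p ∙ q = record
  { to = to p ∘ to q ; from = from q ∘ from p
  ; to-from = λ x → trans (cong (to p) (to-from q (from p x))) (to-from p x)
  ; from-to = λ x → trans (cong (from q) (from-to p (to q x))) (from-to q x) }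

_⁻¹ : ∀ {A} → Perm A → Perm A
p ⁻¹ = record { to = from p ; from = to p ; to-from = from-to p ; from-to = to-from p }

module Transposition {A : Set} (_≟_ : DecidableEquality A) where

  transpose : A → A → A → A
  transpose a b x with x ≟ a
  ... | yes _ = b
  ... | no  _ with x ≟ b
  ...   | yes _ = a
  ...   | no  _ = x

  transpose-a : ∀ a b → transpose a b a ≡ b
  transpose-a a b with a ≟ a
  ... | yes _ = refl
  ... | no ¬p = contradiction refl ¬p

  transpose-b : ∀ a b → transpose a b b ≡ a
  transpose-b a b with b ≟ a
  ... | yes b≡a = b≡a
  ... | no  _ with b ≟ b
  ...   | yes _ = refl
  ...   | no ¬p = contradiction refl ¬p

  transpose-other : ∀ {a b x} → x ≢ a → x ≢ b → transpose a b x ≡ x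
  transpose-other {a} {b} {x} x≢a x≢b with x ≟ a
  ... | yes p = contradiction p x≢a
  ... | no  _ with x ≟ b
  ...   | yes p = contradiction p x≢b
  ...   | no  _ = refl

  transpose-elim : ∀ {a b} (P : A → A → Set) → P a b → P b a → (∀ x → x ≢ a → x ≢ b → P x x) →
                   ∀ x → P x (transpose a b x)
  transpose-elim {a} {b} P Pab Pba Pxx x with x ≟ a
  ... | yes refl = Pab
  ... | no x≢a with x ≟ b
  ...   | yes refl = Pba
  ...   | no x≢b = Pxx x x≢a x≢b

  transpose-involutive : ∀ a b x → transpose a b (transpose a b x) ≡ x
  transpose-involutive a b = transpose-elim (λ x y → transpose a b y ≡ x)
    (transpose-b a b) (transpose-a a b) (λ _ → transpose-other)

  τ : A → A → Perm A
  τ a b = record { to = transpose a b ; from = transpose a b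
                 ; to-from = transpose-involutive a b ; from-to = transpose-involutive a b }

-- Iterates and periods

iter-+ : ∀ {A : Set} (f : A → A) i j x → iter f (i + j) x ≡ iter f i (iter f j x)
iter-+ f zero    j x = refl
iter-+ f (suc i) j x = cong f (iter-+ f i j x)

iter-injective : ∀ {A : Set} {f : A → A} → (∀ {x y} → f x ≡ f y → x ≡ y) →
                 ∀ i {x y} → iter f i x ≡ iter f i y → x ≡ y
iter-injective inj zero    eq = eq
iter-injective inj (suc i) eq = iter-injective inj i (inj eq)

iter-closed : ∀ {A : Set} {f : A → A} (P : A → Set) → (∀ {x} → P x → P (f x)) →
              ∀ i {x} → P x → P (iter f i x)
iter-closed P closed zero    px = px
iter-closed P closed (suc i) px = closed (iter-closed P closed i px)

iter-multiple : ∀ {A : Set} (f : A → A) {j x} → iter f j x ≡ x → ∀ i → iter f (i * j) x ≡ x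
iter-multiple f {j} {x} eq zero    = refl
iter-multiple f {j} {x} eq (suc i) =
  trans (iter-+ f j (i * j) x) (trans (cong (iter f j) (iter-multiple f eq i)) eq)

iter-mod : ∀ {A : Set} (f : A → A) {j x} .{{_ : NonZero j}} → iter f j x ≡ x →
           ∀ i → iter f i x ≡ iter f (i % j) x
iter-mod f {j} {x} eq i = begin
  iter f i x                            ≡⟨ cong (λ m → iter f m x) (m≡m%n+[m/n]*n i j) ⟩
  iter f (i % j + i / j * j) x          ≡⟨ iter-+ f (i % j) (i / j * j) x ⟩
  iter f (i % j) (iter f (i / j * j) x) ≡⟨ cong (iter f (i % j)) (iter-multiple f eq (i / j)) ⟩
  iter f (i % j) x                      ∎
  where open ≡-Reasoning

-- Pigeonhole among the first `M + 1` iterates. The encoding `e` concerns the iterates of `x` only,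
-- so `M` bounds the points this orbit can visit, not the size of `A`. Frugality enters through such
-- an `M`.
iter-period : ∀ {A : Set} {f : A → A} → (∀ {x y} → f x ≡ f y → x ≡ y) →
              ∀ {M} x (e : ℕ → Fin M) → (∀ i j → e i ≡ e j → iter f i x ≡ iter f j x) →
              ∃[ j ] suc j ≤ M × iter f (suc j) x ≡ x
iter-period {f = f} inj {M} x e e-inj with Fin.pigeonhole (ℕ.n<1+n M) (e ∘ toℕ)
... | i , j , i<j , eq with ℕ.m≤n⇒∃[o]m+o≡n i<j
...   | d , i+d≡j = d ,
        ℕ.≤-trans (subst (suc d ≤_) (trans (ℕ.+-suc (toℕ i) d) i+d≡j) (ℕ.m≤n+m (suc d) (toℕ i)))
                  (ℕ.≤-pred (Fin.toℕ<n j)) ,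
        sym (iter-injective inj (toℕ i) (trans (e-inj _ _ eq) (trans
          (cong (λ m → iter f m x) (trans (sym i+d≡j) (sym (ℕ.+-suc (toℕ i) d))))
          (iter-+ f (toℕ i) (suc d) x))))

least : ∀ {P : ℕ → Set} → (∀ i → Dec (P i)) → ∀ {i} → P i → ∃[ m ] P m × (∀ {j} → j < m → ¬ P j)
least P? {i} pi with P? 0
... | yes p0 = 0 , p0 , λ ()
least P? {zero}  pi | no ¬p0 = contradiction pi ¬p0
least P? {suc i} pi | no ¬p0 with least (P? ∘ suc) pi
... | m , pm , below = suc m , pm , λ { {zero} _ → ¬p0 ; {suc j} (s≤s j<m) → below j<m }

record Finite (A : Set) : Set where
  field
    _≟_   : DecidableEquality A
    enum  : List A
    ∈enum : ∀ x → x ∈ enum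

-- Cycles of a permutation and the effect of a transposition on them

module Orbits {A : Set} (F : Finite A) where
  open Finite F
  open Transposition _≟_ public

  -- Folding `merge` over a finite list gives the generated equivalence together with its decision
  -- procedure, so orbits and components are decidable without a search for paths.
  gen : List (A × A) → Eqv A
  gen []            = ≡-eqv _≟_
  gen ((a , b) ∷ l) = merge (gen l) a b

  gen-least : ∀ {S : A → A → Set} → IsEquivalence S → ∀ l → (∀ {x y} → (x , y) ∈ l → S x y) →
              ∀ {x y} → gen l ∋ x ~ y → S x y
  gen-least eq []       _ refl = IsEquivalence.refl eq
  gen-least eq (_ ∷ l) l⊆S =
    merge-least (gen l) _ _ eq (gen-least eq l (l⊆S ∘ there)) (l⊆S (here refl))

  gen-∈ : ∀ {l x y} → (x , y) ∈ l → gen l ∋ x ~ y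
  gen-∈ {(a , b) ∷ l} (here refl) = merge-ab (gen l) a b
  gen-∈ {_ ∷ l}       (there xy∈) = inj₁ (gen-∈ xy∈)

  graphOf : (A → A) → List (A × A)
  graphOf f = map (λ x → x , f x) enum

  ∈graphOf : ∀ f x → (x , f x) ∈ graphOf f
  ∈graphOf f x = ∈-map⁺ _ (∈enum x)

  Orb : Perm A → Eqv A
  Orb p = gen (graphOf (to p))

  Conn : Perm A → Perm A → Eqv A
  Conn p q = gen (graphOf (to p) ++ graphOf (to q))

  orb-step : ∀ p x → Orb p ∋ x ~ to p x
  orb-step p x = gen-∈ (∈graphOf (to p) x)

  conn-stepˡ : ∀ p q x → Conn p q ∋ x ~ to p x
  conn-stepˡ p q x = gen-∈ (∈-++⁺ˡ (∈graphOf (to p) x))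

  conn-stepʳ : ∀ p q x → Conn p q ∋ x ~ to q x
  conn-stepʳ p q x = gen-∈ (∈-++⁺ʳ (graphOf (to p)) (∈graphOf (to q) x))

  private
    graphOf⊆ : ∀ {S : A → A → Set} f → (∀ x → S x (f x)) → ∀ {x y} → (x , y) ∈ graphOf f → S x y
    graphOf⊆ f h xy∈ with ∈-map⁻ _ xy∈
    ... | x , _ , refl = h x

  orb-least : ∀ {S : A → A → Set} → IsEquivalence S → ∀ p → (∀ x → S x (to p x)) →
              ∀ {x y} → Orb p ∋ x ~ y → S x y
  orb-least eq p h = gen-least eq _ (graphOf⊆ (to p) h)

  conn-least : ∀ {S : A → A → Set} → IsEquivalence S → ∀ p q →
               (∀ x → S x (to p x)) → (∀ x → S x (to q x)) →
               ∀ {x y} → Conn p q ∋ x ~ y → S x y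
  conn-least eq p q hp hq = gen-least eq _
    (λ xy∈ → [ graphOf⊆ (to p) hp , graphOf⊆ (to q) hq ]′ (∈-++⁻ (graphOf (to p)) xy∈))

  orb⊆connˡ : ∀ p q {x y} → Orb p ∋ x ~ y → Conn p q ∋ x ~ y
  orb⊆connˡ p q = orb-least (Eqv.equiv (Conn p q)) p (conn-stepˡ p q)

  orb∙⊆conn : ∀ p q {x y} → Orb (p ∙ q) ∋ x ~ y → Conn p q ∋ x ~ y
  orb∙⊆conn p q = orb-least (Eqv.equiv (Conn p q)) (p ∙ q)
    (λ x → Eqv.~trans (Conn p q) (conn-stepʳ p q x) (conn-stepˡ p q (to q x)))

  private
    idx : A → Fin (length enum)
    idx x = index (∈enum x)

    idx-injective : ∀ {x y} → idx x ≡ idx y → x ≡ y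
    idx-injective {x} {y} eq = trans (Any.lookup-index (∈enum x))
      (trans (cong (lookup enum) eq) (sym (Any.lookup-index (∈enum y))))

  periodic : ∀ {f : A → A} → (∀ {x y} → f x ≡ f y → x ≡ y) → ∀ x → ∃[ j ] iter f (suc j) x ≡ x
  periodic {f} inj x with iter-period inj x (λ i → idx (iter f i x)) (λ _ _ → idx-injective)
  ... | j , _ , eq = j , eq

  period : ∀ p x → ∃[ j ] iter (to p) (suc j) x ≡ x
  period p = periodic (injective p)

  -- On a finite set the preimage of `x` is the last point met before the cycle of `x` closes.
  fromInjective : (f : A → A) → (∀ {x y} → f x ≡ f y → x ≡ y) → Perm A
  fromInjective f inj = record
    { to      = f
    ; from    = λ x → iter f (proj₁ (periodic inj x)) x
    ; to-from = λ x → proj₂ (periodic inj x)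
    ; from-to = λ x → inj (proj₂ (periodic inj (f x))) }

  orb⇒iter : ∀ p {x y} → Orb p ∋ x ~ y → ∃[ i ] iter (to p) i x ≡ y
  orb⇒iter p = orb-least equiv p (λ _ → 1 , refl)
    where
    equiv : IsEquivalence (λ x y → ∃[ i ] iter (to p) i x ≡ y)
    equiv = record
      { refl  = 0 , refl
      ; sym   = isym
      ; trans = λ { {x} (i , refl) (j , refl) → j + i , iter-+ (to p) j i x } }
      where
      isym : ∀ {x y} → ∃[ i ] iter (to p) i x ≡ y → ∃[ i ] iter (to p) i y ≡ x
      isym {x} (i , refl) with period p x
      -- After `i` steps, `i * j` more complete `i` full turns of length `suc j`.
      ... | j , eq = i * j , (begin
        iter (to p) (i * j) (iter (to p) i x) ≡⟨ iter-+ (to p) (i * j) i x ⟨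
        iter (to p) (i * j + i) x ≡⟨ cong (λ m → iter (to p) m x) (trans (ℕ.+-comm (i * j) i) (sym (ℕ.*-suc i j))) ⟩
        iter (to p) (i * suc j) x ≡⟨ iter-multiple (to p) eq i ⟩
        x ∎)
        where open ≡-Reasoning

  iter⇒orb : ∀ p i {x} → Orb p ∋ x ~ iter (to p) i x
  iter⇒orb p zero    = Eqv.~refl (Orb p)
  iter⇒orb p (suc i) = Eqv.~trans (Orb p) (iter⇒orb p i) (orb-step p _)

  z : Perm A → ℕ
  z p = # (Orb p) enum

  N : ℕ
  N = # (≡-eqv _≟_) enum

  c : Perm A → Perm A → ℕ
  c p q = # (Conn p q) enum

  -- The product sends `b` to `p a` and then follows the `p`-cycle of `a`, which avoids `b`, until
  -- it comes back to `a`.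
  ≁⇒merged : ∀ p {a b} → ¬ Orb p ∋ a ~ b → Orb (p ∙ τ a b) ∋ a ~ b
  ≁⇒merged p {a} {b} a≁b with period p a
  ... | j , eq = ~sym ([ id , subst (rel b) eq ]′ (follow j))
    where
    q = p ∙ τ a b
    open Eqv (Orb q)
    follow : ∀ i → rel b a ⊎ rel b (iter (to p) (suc i) a)
    follow zero = inj₂ (subst (rel b) (cong (to p) (transpose-b a b)) (orb-step q b))
    follow (suc i) with follow i
    ... | inj₁ ba = inj₁ ba
    ... | inj₂ r with iter (to p) (suc i) a ≟ a
    ...   | yes e = inj₁ (subst (rel b) e r)
    ...   | no ≢a = inj₂ (~trans r (subst (rel y) (cong (to p) (transpose-other ≢a ≢b)) (orb-step q y)))
      where
      y = iter (to p) (suc i) a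
      ≢b : y ≢ b
      ≢b e = a≁b (subst (Orb p ∋ a ~_) e (iter⇒orb p (suc i)))

  -- A return to `a` before the first visit to `b` could be cut out, which would make that visit
  -- earlier.
  no-return : ∀ (p : Perm A) {a b i m} → iter (to p) (suc i) a ≡ b → (∀ {j} → j < suc i → iter (to p) j a ≢ b) →
              m ≤ i → iter (to p) (suc m) a ≢ a
  no-return p {a} {b} {i} {m} eq below m≤i e = below {i ∸ m} (s≤s (ℕ.m∸n≤m i m)) (begin
    iter (to p) (i ∸ m) a                        ≡⟨ cong (iter (to p) (i ∸ m)) e ⟨
    iter (to p) (i ∸ m) (iter (to p) (suc m) a)  ≡⟨ iter-+ (to p) (i ∸ m) (suc m) a ⟨
    iter (to p) (i ∸ m + suc m) a                ≡⟨ cong (λ n → iter (to p) n a) (ℕ.+-suc (i ∸ m) m) ⟩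
    iter (to p) (suc (i ∸ m + m)) a              ≡⟨ cong (λ n → iter (to p) (suc n) a) (ℕ.m∸n+n≡m m≤i) ⟩
    iter (to p) (suc i) a                        ≡⟨ eq ⟩
    b                                            ∎)
    where open ≡-Reasoning

  -- After the split, the orbit of b consists of the points strictly after a, up to b.
  ~⇒split : ∀ p {a b} → a ≢ b → Orb p ∋ a ~ b → ¬ Orb (p ∙ τ a b) ∋ a ~ b
  ~⇒split p {a} {b} a≢b a~b ab with orb⇒iter p a~b
  ... | i₀ , eq₀ with least (λ i → iter (to p) i a ≟ b) {i₀} eq₀
  ... | zero  , eq , _ = a≢b eq
  ... | suc i , eq , below with orb⇒iter (p ∙ τ a b) (Eqv.~sym (Orb (p ∙ τ a b)) ab)
  ... | k , qk = a∉arc (subst Arc qk (iter-closed Arc closed k (i , ℕ.≤-refl , eq)))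
    where
    Arc : A → Set
    Arc x = ∃[ m ] m ≤ i × iter (to p) (suc m) a ≡ x
    a∉arc : ¬ Arc a
    a∉arc (m , m≤i , e) = no-return p eq below m≤i e
    closed : ∀ {x} → Arc x → Arc (to (p ∙ τ a b) x)
    closed {x} (m , m≤i , refl) with x ≟ b
    ... | yes e = 0 , z≤n , cong (to p) (sym (trans (cong (transpose a b) e) (transpose-b a b)))
    ... | no ≢b with ℕ.m≤n⇒m<n∨m≡n m≤i
    ...   | inj₁ m<i = suc m , m<i , cong (to p) (sym (transpose-other (no-return p eq below m≤i) ≢b))
    ...   | inj₂ refl = contradiction eq ≢b

module Genus {A : Set} (F : Finite A) where
  open Finite F
  open Orbits F

  -- Euler's formula for the hypermap with vertices p, hyperedges q and faces p ∙ q: genus 0 in every component.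
  Tight : Perm A → Perm A → Set
  Tight p q = z p + z q + z (p ∙ q) ≡ N + 2 * c p q

  orb-map : ∀ {p q : Perm A} (f : A → A) → (∀ x → f (to p x) ≡ to q (f x)) →
            ∀ {x y} → Orb p ∋ x ~ y → Orb q ∋ f x ~ f y
  orb-map {p} {q} f h = orb-least (On.isEquivalence f (Eqv.equiv (Orb q))) p
    (λ x → subst (Orb q ∋ f x ~_) (sym (h x)) (orb-step q (f x)))

  z-≤ : ∀ (p q : Perm A) → (∀ x → Orb q ∋ x ~ to p x) → z q ≤ z p
  z-≤ p q h = #-antitone (Orb p) (Orb q) enum (λ _ _ → orb-least (Eqv.equiv (Orb q)) p h)

  z-cong : ∀ (p q : Perm A) → (∀ x → to p x ≡ to q x) → z p ≡ z q
  z-cong p q h = ℕ.≤-antisym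
    (z-≤ q p (λ x → subst (Orb p ∋ x ~_) (h x) (orb-step p x)))
    (z-≤ p q (λ x → subst (Orb q ∋ x ~_) (sym (h x)) (orb-step q x)))

  orb-inverse : ∀ (p : Perm A) {x y} → Orb p ∋ x ~ y → Orb (p ⁻¹) ∋ x ~ y
  orb-inverse p = orb-least (Eqv.equiv (Orb (p ⁻¹))) p (λ x → Eqv.~sym (Orb (p ⁻¹))
    (subst (Orb (p ⁻¹) ∋ to p x ~_) (from-to p x) (orb-step (p ⁻¹) (to p x))))

  z-inverse : ∀ (p : Perm A) → z (p ⁻¹) ≡ z p
  z-inverse p = ℕ.≤-antisym
    (z-≤ p (p ⁻¹) (orb-inverse p ∘ orb-step p))
    (z-≤ (p ⁻¹) p (orb-inverse (p ⁻¹) ∘ orb-step (p ⁻¹)))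

  private
    z-conj-≤ : ∀ (t p q : Perm A) → (∀ x → to t (to p x) ≡ to q (to t x)) → z p ≤ z q
    z-conj-≤ t p q h = #-inj (Orb p) (Orb q) {enum} {enum} (to t) (λ _ → lose (∈enum _) (Eqv.~refl (Orb q)))
      (λ {x} {y} _ _ r → subst₂ (Eqv.rel (Orb p)) (from-to t x) (from-to t y) (orb-map {q} {p} (from t) back r))
      where
      back : ∀ x → from t (to q x) ≡ to p (from t x)
      back x = injective t (trans (to-from t _)
        (trans (cong (to q) (sym (to-from t x))) (sym (h (from t x)))))

  z-conj : ∀ (t p q : Perm A) → (∀ x → to t (to p x) ≡ to q (to t x)) → z p ≡ z q
  z-conj t p q h = ℕ.≤-antisym (z-conj-≤ t p q h) (z-conj-≤ (t ⁻¹) q p λ x →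
    injective t (trans (to-from t _) (sym (trans (h _) (cong (to q) (to-from t x))))))

  c-≤ : ∀ (p q p′ q′ : Perm A) → (∀ x → Conn p′ q′ ∋ x ~ to p x) → (∀ x → Conn p′ q′ ∋ x ~ to q x) →
        c p′ q′ ≤ c p q
  c-≤ p q p′ q′ hp hq = #-antitone (Conn p q) (Conn p′ q′) enum
    (λ _ _ → conn-least (Eqv.equiv (Conn p′ q′)) p q hp hq)

  c-cong : ∀ (p q p′ q′ : Perm A) → (∀ x → to p x ≡ to p′ x) → (∀ x → to q x ≡ to q′ x) → c p q ≡ c p′ q′
  c-cong p q p′ q′ hp hq = ℕ.≤-antisym
    (c-≤ p′ q′ p q (λ x → subst (Conn p q ∋ x ~_) (hp x) (conn-stepˡ p q x))
                   (λ x → subst (Conn p q ∋ x ~_) (hq x) (conn-stepʳ p q x)))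
    (c-≤ p q p′ q′ (λ x → subst (Conn p′ q′ ∋ x ~_) (sym (hp x)) (conn-stepˡ p′ q′ x))
                   (λ x → subst (Conn p′ q′ ∋ x ~_) (sym (hq x)) (conn-stepʳ p′ q′ x)))

  tight-cong : ∀ (p q p′ q′ : Perm A) → (∀ x → to p x ≡ to p′ x) → (∀ x → to q x ≡ to q′ x) →
               Tight p q → Tight p′ q′
  tight-cong p q p′ q′ hp hq t = subst₂ _≡_
    (cong₂ _+_ (cong₂ _+_ (z-cong p p′ hp) (z-cong q q′ hq))
      (z-cong (p ∙ q) (p′ ∙ q′) (λ x → trans (hp _) (cong (to p′) (hq x)))))
    (cong (λ n → N + 2 * n) (c-cong p q p′ q′ hp hq)) t

  -- `q ∙ p` and `p ∙ q` are conjugate by `p`; the remaining terms are symmetric.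
  tight-swap : ∀ (p q : Perm A) → Tight p q → Tight q p
  tight-swap p q t = trans
    (cong₂ _+_ (ℕ.+-comm (z q) (z p)) (z-conj p (q ∙ p) (p ∙ q) (λ _ → refl)))
    (trans t (cong (λ n → N + 2 * n) (ℕ.≤-antisym
      (c-≤ q p p q (conn-stepʳ p q) (conn-stepˡ p q))
      (c-≤ p q q p (conn-stepʳ q p) (conn-stepˡ q p)))))

  -- As `p ⁻¹ ∙ (p ∙ q)` is `q`, hyperedges and faces exchange roles while the components stay the
  -- same. This allows cycles of one factor to be split with the product held fixed.
  tight-rotate : ∀ (p q : Perm A) → Tight p q → Tight (p ⁻¹) (p ∙ q)
  tight-rotate p q t = trans
    (cong₂ _+_ (cong (_+ z (p ∙ q)) (z-inverse p)) (z-cong (p ⁻¹ ∙ (p ∙ q)) q (λ x → from-to p _)))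
    (trans (+-swap (z p) (z (p ∙ q)) (z q))
    (trans t (cong (λ n → N + 2 * n) (ℕ.≤-antisym
      (c-≤ (p ⁻¹) (p ∙ q) p q
        (λ x → Eqv.~sym (Conn p q) (subst (Conn p q ∋ from p x ~_) (to-from p x) (conn-stepˡ p q _)))
        (λ x → Eqv.~trans (Conn p q) (conn-stepʳ p q x) (conn-stepˡ p q _)))
      (c-≤ p q (p ⁻¹) (p ∙ q)
        (λ x → Eqv.~sym C (subst (C ∋ to p x ~_) (from-to p x) (conn-stepˡ (p ⁻¹) (p ∙ q) _)))
        (λ x → Eqv.~trans C (conn-stepʳ (p ⁻¹) (p ∙ q) x)
                 (subst (C ∋ _ ~_) (from-to p _) (conn-stepˡ (p ⁻¹) (p ∙ q) _))))))))
    where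
    C = Conn (p ⁻¹) (p ∙ q)
    +-swap : ∀ x y w → x + y + w ≡ x + w + y
    +-swap = solve-∀

  ~transpose : ∀ {S : A → A → Set} → IsEquivalence S → ∀ {a b} → S a b → ∀ x → S x (transpose a b x)
  ~transpose {S} eq ab = transpose-elim S ab (IsEquivalence.sym eq ab) (λ _ _ _ → IsEquivalence.refl eq)

  ~∙τ : ∀ {S : A → A → Set} → IsEquivalence S → ∀ (p : Perm A) {a b} → S a b →
        (∀ x → S x (to p x)) → ∀ x → S x (to (p ∙ τ a b) x)
  ~∙τ eq p ab h x = IsEquivalence.trans eq (~transpose eq ab x) (h _)

  ~∙τ⁻ : ∀ {S : A → A → Set} → IsEquivalence S → ∀ (p : Perm A) {a b} → S a b →
         (∀ x → S x (to (p ∙ τ a b) x)) → ∀ x → S x (to p x)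
  ~∙τ⁻ {S} eq p {a} {b} ab h x = IsEquivalence.trans eq (~transpose eq ab x)
    (subst (λ y → S (transpose a b x) (to p y)) (transpose-involutive a b x) (h (transpose a b x)))

  -- The two halves are inequivalent by `~⇒split`, and merging them recovers the orbits of `q`;
  -- exactly one class is gained.
  z-split : ∀ (q : Perm A) {a b} → a ≢ b → Orb q ∋ a ~ b → z (q ∙ τ a b) ≡ suc (z q)
  z-split q {a} {b} a≢b a~b = trans (#-merge O (∈enum a) (∈enum b) (~⇒split q a≢b a~b))
    (cong suc (ℕ.≤-antisym
      (#-antitone (Orb q) (merge O a b) enum (λ _ _ →
        orb-least (Eqv.equiv (merge O a b)) q
          (~∙τ⁻ (Eqv.equiv (merge O a b)) q (merge-ab O a b) (λ x → inj₁ (orb-step (q ∙ τ a b) x)))))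
      (#-antitone (merge O a b) (Orb q) enum (λ _ _ →
        merge-least O a b (Eqv.equiv (Orb q))
          (orb-least (Eqv.equiv (Orb q)) (q ∙ τ a b) (~∙τ (Eqv.equiv (Orb q)) q a~b (orb-step q))) a~b))))
    where O = Orb (q ∙ τ a b)

  -- If `a` and `b` share a cycle of `r`, the product only refines the orbits; otherwise its orbits
  -- lie in those of `r` with two of them merged.
  z-∙τ-≥ : ∀ (r : Perm A) a b → z r ≤ suc (z (r ∙ τ a b))
  z-∙τ-≥ r a b with Eqv.rel? (Orb r) a b
  ... | yes ab = ℕ.m≤n⇒m≤1+n (z-≤ (r ∙ τ a b) r (~∙τ (Eqv.equiv (Orb r)) r ab (orb-step r)))
  ... | no ¬ab = subst (_≤ suc (z (r ∙ τ a b))) (sym (#-merge (Orb r) (∈enum a) (∈enum b) ¬ab))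
    (s≤s (#-antitone (Orb (r ∙ τ a b)) M enum (λ _ _ → orb-least (Eqv.equiv M) (r ∙ τ a b)
      (~∙τ (Eqv.equiv M) r (merge-ab (Orb r) a b) (λ x → inj₁ (orb-step r x))))))
    where M = merge (Orb r) a b

  -- Read backwards: `r` is `r ∙ τ a b` times the same transposition, which joins two distinct
  -- cycles of `r ∙ τ a b`.
  z-∙τ-merge : ∀ (r : Perm A) {a b} → ¬ Orb (r ∙ τ a b) ∋ a ~ b → suc (z r) ≤ z (r ∙ τ a b)
  z-∙τ-merge r {a} {b} ¬ab = subst (suc (z r) ≤_) (sym (#-merge O (∈enum a) (∈enum b) ¬ab))
    (s≤s (#-antitone M (Orb r) enum (λ _ _ →
      merge-least O a b (Eqv.equiv (Orb r))
        (orb-least (Eqv.equiv (Orb r)) (r ∙ τ a b) (~∙τ (Eqv.equiv (Orb r)) r a~b (orb-step r))) a~b)))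
    where
    O = Orb (r ∙ τ a b)
    M = merge O a b
    a~b : Orb r ∋ a ~ b
    a~b = orb-map {r ∙ τ a b ∙ τ a b} {r} id (λ x → cong (to r) (transpose-involutive a b x))
      (≁⇒merged (r ∙ τ a b) ¬ab)

  -- The defect N + 2c − (z p + z q + z (p ∙ q)) does not increase; both sides are moved to avoid subtraction.
  defect-mono : ∀ (p q : Perm A) {a b} → a ≢ b → Orb q ∋ a ~ b → let q′ = q ∙ τ a b in
    (N + 2 * c p q′) + (z p + z q + z (p ∙ q)) ≤ (N + 2 * c p q) + (z p + z q′ + z (p ∙ q′))
  defect-mono p q {a} {b} a≢b a~b with Eqv.rel? (Conn p (q ∙ τ a b)) a b
  -- `a` and `b` stay connected: the number of components does not grow, `q` gains a cycle and the
  -- product loses at most one.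
  ... | yes ab = begin
    (N + 2 * c p q′) + (z p + z q + z (p ∙ q))
      ≤⟨ ℕ.+-mono-≤ (ℕ.+-monoʳ-≤ N (ℕ.*-monoʳ-≤ 2 c′≤c)) (ℕ.+-monoʳ-≤ (z p + z q) (z-∙τ-≥ (p ∙ q) a b)) ⟩
    (N + 2 * c p q) + (z p + z q + suc (z (p ∙ q′)))
      ≡⟨ arith (N + 2 * c p q) (z p) (z q) (z (p ∙ q′)) ⟩
    (N + 2 * c p q) + (z p + suc (z q) + z (p ∙ q′))
      ≡⟨ cong (λ w → (N + 2 * c p q) + (z p + w + z (p ∙ q′))) (z-split q a≢b a~b) ⟨
    (N + 2 * c p q) + (z p + z q′ + z (p ∙ q′)) ∎
    where
    open ℕ.≤-Reasoning
    q′ = q ∙ τ a b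
    C = Conn p q′
    c′≤c : c p q′ ≤ c p q
    c′≤c = c-≤ p q p q′ (conn-stepˡ p q′) (~∙τ⁻ (Eqv.equiv C) q ab (conn-stepʳ p q′))
    arith : ∀ k x y w → k + (x + y + suc w) ≡ k + (x + suc y + w)
    arith = solve-∀
  -- The split disconnects `a` from `b`: 2c grows by at most 2, but now `a` and `b` also lie on
  -- different cycles of `p ∙ q′`, so `q` and the product both gain a cycle.
  ... | no ¬ab = begin
    (N + 2 * c p q′) + (z p + z q + z (p ∙ q))
      ≤⟨ ℕ.+-monoˡ-≤ _ (ℕ.+-monoʳ-≤ N (ℕ.*-monoʳ-≤ 2 c′≤)) ⟩
    (N + 2 * suc (c p q)) + (z p + z q + z (p ∙ q))
      ≡⟨ arith N (c p q) (z p) (z q) (z (p ∙ q)) ⟩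
    (N + 2 * c p q) + (z p + suc (z q) + suc (z (p ∙ q)))
      ≤⟨ ℕ.+-monoʳ-≤ (N + 2 * c p q) (ℕ.+-mono-≤ (ℕ.≤-reflexive (cong (z p +_) (sym (z-split q a≢b a~b))))
           (z-∙τ-merge (p ∙ q) (¬ab ∘ orb∙⊆conn p q′))) ⟩
    (N + 2 * c p q) + (z p + z q′ + z (p ∙ q′)) ∎
    where
    open ℕ.≤-Reasoning
    q′ = q ∙ τ a b
    C = Conn p q′
    M = merge C a b
    c′≤ : c p q′ ≤ suc (c p q)
    c′≤ = subst (_≤ suc (c p q)) (sym (#-merge C (∈enum a) (∈enum b) ¬ab))
      (s≤s (#-antitone (Conn p q) M enum (λ _ _ → conn-least (Eqv.equiv M) p q
        (λ x → inj₁ (conn-stepˡ p q′ x))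
        (~∙τ⁻ (Eqv.equiv M) q (merge-ab C a b) (λ x → inj₁ (conn-stepʳ p q′ x))))))
    arith : ∀ n k x y w → (n + 2 * suc k) + (x + y + w) ≡ (n + 2 * k) + (x + suc y + suc w)
    arith = solve-∀

  -- Deletion of `x` from its cycle: the predecessor of `x` is sent to its successor and `x` remains
  -- as a fixed point. Written as a product with a transposition, it falls under `defect-mono`.
  isolate : A → Perm A → Perm A
  isolate x q with to q x ≟ x
  ... | yes _ = q
  ... | no  _ = q ∙ τ x (from q x)

  isolateAll : List A → Perm A → Perm A
  isolateAll []       q = q
  isolateAll (x ∷ xs) q = isolateAll xs (isolate x q)

  module _ (x : A) (q : Perm A) where

    isolate-fixes : to (isolate x q) x ≡ x
    isolate-fixes with to q x ≟ x
    ... | yes e = e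
    ... | no  _ = trans (cong (to q) (transpose-a x (from q x))) (to-from q x)

    isolate-keeps : ∀ {y} → to q y ≢ x → y ≢ x → to (isolate x q) y ≡ to q y
    isolate-keeps {y} qy≢x y≢x with to q x ≟ x
    ... | yes _ = refl
    ... | no  _ = cong (to q) (transpose-other y≢x
      (λ e → qy≢x (trans (cong (to q) e) (to-from q x))))

    isolate-fixed : ∀ {y} → to q y ≡ y → to (isolate x q) y ≡ y
    isolate-fixed {y} qy≡y with y ≟ x
    ... | yes refl = isolate-fixes
    ... | no y≢x   = trans (isolate-keeps (λ e → y≢x (trans (sym qy≡y) e)) y≢x) qy≡y

    isolate-⊆ : ∀ {y w} → Orb (isolate x q) ∋ y ~ w → Orb q ∋ y ~ w
    isolate-⊆ with to q x ≟ x
    ... | yes _ = id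
    ... | no  _ = orb-least (Eqv.equiv (Orb q)) (q ∙ τ x (from q x))
      (~∙τ (Eqv.equiv (Orb q)) q (Eqv.~sym (Orb q) (subst (Orb q ∋ from q x ~_) (to-from q x) (orb-step q _))) (orb-step q))

    -- Retract x to its predecessor.
    isolate-⊇ : ∀ {y w} → y ≢ x → w ≢ x → Orb q ∋ y ~ w → Orb (isolate x q) ∋ y ~ w
    isolate-⊇ {y} {w} y≢x w≢x with to q x ≟ x
    ... | yes _ = id
    ... | no qx≢x = λ yw → subst₂ (Eqv.rel O) (ρ-other y≢x) (ρ-other w≢x)
      (orb-least {S = Eqv.rel O on ρ} (On.isEquivalence ρ (Eqv.equiv O)) q ρ-step yw)
      where
      q′ = q ∙ τ x (from q x)
      O = Orb q′
      ρ : A → A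
      ρ v with v ≟ x
      ... | yes _ = from q x
      ... | no  _ = v
      ρ-other : ∀ {v} → v ≢ x → ρ v ≡ v
      ρ-other {v} v≢x with v ≟ x
      ... | yes e = contradiction e v≢x
      ... | no  _ = refl
      ρ-step : ∀ v → O ∋ ρ v ~ ρ (to q v)
      ρ-step v with v ≟ x
      ... | yes refl = subst (O ∋ from q x ~_)
              (trans (cong (to q) (transpose-b x (from q x))) (sym (ρ-other qx≢x)))
              (orb-step q′ (from q x))
      ... | no v≢x with to q v ≟ x
      ...   | yes qv≡x = subst (O ∋ v ~_) (trans (sym (from-to q v)) (cong (from q) qv≡x)) (Eqv.~refl O)
      ...   | no qv≢x  = subst (O ∋ v ~_)
              (cong (to q) (transpose-other v≢x (λ e → qv≢x (trans (cong (to q) e) (to-from q x)))))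
              (orb-step q′ v)

    isolate-defect : ∀ (p : Perm A) →
      (N + 2 * c p (isolate x q)) + (z p + z q + z (p ∙ q)) ≤
      (N + 2 * c p q) + (z p + z (isolate x q) + z (p ∙ isolate x q))
    isolate-defect p with to q x ≟ x
    ... | yes _ = ℕ.≤-refl
    ... | no qx≢x = defect-mono p q (λ e → qx≢x (trans (cong (to q) e) (to-from q x)))
      (Eqv.~sym (Orb q) (subst (Orb q ∋ from q x ~_) (to-from q x) (orb-step q _)))

  isolateAll-fixed : ∀ xs (q : Perm A) {y} → to q y ≡ y → to (isolateAll xs q) y ≡ y
  isolateAll-fixed []       q = id
  isolateAll-fixed (x ∷ xs) q = isolateAll-fixed xs _ ∘ isolate-fixed x q

  isolateAll-fixes : ∀ {xs} (q : Perm A) {y} → y ∈ xs → to (isolateAll xs q) y ≡ y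
  isolateAll-fixes {x ∷ xs} q (here refl) = isolateAll-fixed xs _ (isolate-fixes x q)
  isolateAll-fixes {x ∷ xs} q (there y∈)  = isolateAll-fixes (isolate x q) y∈

  isolateAll-keeps : ∀ xs (q : Perm A) {y} → y ∉ xs → to q y ∉ xs → to (isolateAll xs q) y ≡ to q y
  isolateAll-keeps []       q _  _   = refl
  isolateAll-keeps (x ∷ xs) q y∉ qy∉ =
    trans (isolateAll-keeps xs _ (y∉ ∘ there) (subst (_∉ xs) (sym keep) (qy∉ ∘ there))) keep
    where keep = isolate-keeps x q (qy∉ ∘ here) (y∉ ∘ here)

  isolateAll-⊆ : ∀ xs (q : Perm A) {y w} → Orb (isolateAll xs q) ∋ y ~ w → Orb q ∋ y ~ w
  isolateAll-⊆ []       q = id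
  isolateAll-⊆ (x ∷ xs) q = isolate-⊆ x q ∘ isolateAll-⊆ xs _

  isolateAll-⊇ : ∀ xs (q : Perm A) {y w} → y ∉ xs → w ∉ xs → Orb q ∋ y ~ w → Orb (isolateAll xs q) ∋ y ~ w
  isolateAll-⊇ []       q _  _  = id
  isolateAll-⊇ (x ∷ xs) q y∉ w∉ =
    isolateAll-⊇ xs _ (y∉ ∘ there) (w∉ ∘ there) ∘ isolate-⊇ x q (y∉ ∘ here) (w∉ ∘ here)

  private
    +-cancel-chain : ∀ {k s k′ s′} → k′ + s ≤ k + s′ → s′ ≤ k′ → s ≤ k
    +-cancel-chain {k} {s} {k′} {s′} h s′≤k′ = ℕ.+-cancelˡ-≤ k′ s k
      (ℕ.≤-trans h (ℕ.≤-trans (ℕ.+-monoʳ-≤ k s′≤k′) (ℕ.≤-reflexive (ℕ.+-comm k k′))))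

  euler-≤ : ∀ (p q : Perm A) → z p + z q + z (p ∙ q) ≤ N + 2 * c p q
  euler-≤ p q = go enum q (λ x x∉ → contradiction (∈enum x) x∉)
    where
    base : ∀ (r : Perm A) → (∀ x → to r x ≡ x) → z p + z r + z (p ∙ r) ≤ N + 2 * c p r
    base r fix = ℕ.≤-reflexive (begin
      z p + z r + z (p ∙ r) ≡⟨ cong₂ _+_ (cong (z p +_) zr) (z-cong (p ∙ r) p (cong (to p) ∘ fix)) ⟩
      z p + N + z p         ≡⟨ arith (z p) N ⟩
      N + 2 * z p           ≡⟨ cong (λ n → N + 2 * n) c≡z ⟨
      N + 2 * c p r         ∎)
      where
      open ≡-Reasoning
      arith : ∀ a b → a + b + a ≡ b + 2 * a
      arith = solve-∀
      ≡-equiv = Eqv.equiv (≡-eqv _≟_)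
      zr : z r ≡ N
      zr = ℕ.≤-antisym
        (#-antitone (≡-eqv _≟_) (Orb r) enum (λ { _ _ refl → Eqv.~refl (Orb r) }))
        (#-antitone (Orb r) (≡-eqv _≟_) enum (λ _ _ → orb-least ≡-equiv r (λ x → sym (fix x))))
      c≡z : c p r ≡ z p
      c≡z = ℕ.≤-antisym
        (#-antitone (Orb p) (Conn p r) enum (λ _ _ → orb⊆connˡ p r))
        (#-antitone (Conn p r) (Orb p) enum (λ _ _ → conn-least (Eqv.equiv (Orb p)) p r (orb-step p)
          (λ x → subst (Orb p ∋ x ~_) (sym (fix x)) (Eqv.~refl (Orb p)))))
    go : ∀ xs (r : Perm A) → (∀ x → x ∉ xs → to r x ≡ x) → z p + z r + z (p ∙ r) ≤ N + 2 * c p r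
    go []       r fix = base r (λ x → fix x λ ())
    go (x ∷ xs) r fix = +-cancel-chain {k′ = N + 2 * c p r′} {s′ = z p + z r′ + z (p ∙ r′)}
      (isolate-defect x r p) (go xs r′ fix′)
      where
      r′ = isolate x r
      fix′ : ∀ y → y ∉ xs → to r′ y ≡ y
      fix′ y y∉ with y ≟ x
      ... | yes refl = isolate-fixes x r
      ... | no y≢x   = isolate-fixed x r (fix y (λ { (here e) → y≢x e ; (there y∈) → y∉ y∈ }))

  private
    -- The new defect k′ - s′ is squeezed between 0 and the old defect k - s = 0.
    tighten : ∀ {k s k′ s′} → k′ + s ≤ k + s′ → s′ ≤ k′ → s ≡ k → s′ ≡ k′
    tighten {k} {s} {k′} {s′} h s′≤k′ refl = ℕ.≤-antisym s′≤k′
      (ℕ.+-cancelʳ-≤ s k′ s′ (ℕ.≤-trans h (ℕ.≤-reflexive (ℕ.+-comm s s′))))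

  tight-split : ∀ (p q : Perm A) {a b} → a ≢ b → Orb q ∋ a ~ b → Tight p q → Tight p (q ∙ τ a b)
  tight-split p q a≢b a~b = tighten {s = z p + z q + z (p ∙ q)} (defect-mono p q a≢b a~b) (euler-≤ p (q ∙ τ _ _))

  tight-isolateAll : ∀ xs (p q : Perm A) → Tight p q → Tight p (isolateAll xs q)
  tight-isolateAll []       p q t = t
  tight-isolateAll (x ∷ xs) p q t = tight-isolateAll xs p (isolate x q)
    (tighten {s = z p + z q + z (p ∙ q)} (isolate-defect x q p) (euler-≤ p (isolate x q)) t)

filter-< : ∀ {A : Set} {P Q : A → Set} (P? : ∀ x → Dec (P x)) (Q? : ∀ x → Dec (Q x)) →
           (∀ {x} → P x → Q x) → ∀ {xs x} → x ∈ xs → Q x → ¬ P x →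
           length (filter P? xs) < length (filter Q? xs)
filter-< {P = P} {Q} P? Q? P⊆Q = go
  where
  ≤-all : ∀ xs → length (filter P? xs) ≤ length (filter Q? xs)
  ≤-all []       = z≤n
  ≤-all (x ∷ xs) with P? x | Q? x
  ... | yes _ | yes _ = s≤s (≤-all xs)
  ... | yes p | no ¬q = contradiction (P⊆Q p) ¬q
  ... | no  _ | yes _ = ℕ.m≤n⇒m≤1+n (≤-all xs)
  ... | no  _ | no  _ = ≤-all xs
  go : ∀ {xs x} → x ∈ xs → Q x → ¬ P x → length (filter P? xs) < length (filter Q? xs)
  go {x ∷ xs} (here refl) q ¬p with P? x | Q? x
  ... | yes p | _     = contradiction p ¬p
  ... | no  _ | yes _ = s≤s (≤-all xs)
  ... | no  _ | no ¬q = contradiction q ¬q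
  go {y ∷ xs} (there x∈) q ¬p with P? y | Q? y
  ... | yes _ | yes _ = s≤s (go x∈ q ¬p)
  ... | yes p | no ¬q = contradiction (P⊆Q p) ¬q
  ... | no  _ | yes _ = ℕ.m≤n⇒m≤1+n (go x∈ q ¬p)
  ... | no  _ | no  _ = go x∈ q ¬p

-- The first transposition settles `a`; the second settles the image of `b` and leaves `a′` alone,
-- because neither that image nor `b′` equals `a′`.
recolour : ∀ {m} {a b a′ b′ : Fin m} → a ≢ b → a′ ≢ b′ →
           Σ[ π ∈ Perm (Fin m) ] to π a ≡ a′ × to π b ≡ b′
recolour {m} {a} {b} {a′} {b′} a≢b a′≢b′ = τ (transpose a a′ b) b′ ∙ τ a a′ ,
  trans (cong (transpose _ b′) (transpose-a a a′))
        (transpose-other (λ e → a≢b (injective (τ a a′) (trans (transpose-a a a′) e))) a′≢b′) ,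
  transpose-a (transpose a a′ b) b′
  where open Transposition (Fin._≟_ {m})

-- Planar maps with parallel edges

module Maps {A : Set} (F : Finite A) (k : ℕ) where
  open Finite F
  open Orbits F
  open Genus F

  Live : Perm A → A → Set
  Live α d = to α d ≢ d

  live? : ∀ α d → Dec (Live α d)
  live? α d = ¬? (to α d ≟ d)

  -- A planar map with rotation σ and edge involution α; fixed points of both are unused darts.
  record Good (σ α : Perm A) : Set where
    field
      tight      : Tight σ α
      involutive : ∀ d → to α (to α d) ≡ d
      isolated   : ∀ d → to α d ≡ d → to σ d ≡ d
      loopless   : ∀ d → Live α d → ¬ Orb σ ∋ d ~ to α d
      short      : ∀ d → ∃[ j ] suc j ≤ k × iter (to (σ ∙ α)) (suc j) d ≡ d

  -- Colours sit on darts and are constant on the cycles of `σ`, so cutting and regluing vertices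
  -- alters the constraints but not the domain.
  record Colouring (m : ℕ) (σ α : Perm A) : Set where
    field
      col      : A → Fin m
      onVertex : ∀ d → col (to σ d) ≡ col d
      faces    : ∀ {d d′} → Orb (σ ∙ α) ∋ d ~ d′ → ¬ Orb σ ∋ d ~ d′ → col d ≢ col d′
  open Colouring

  onOrbit : ∀ {m σ α} (C : Colouring m σ α) → ∀ {d d′} → Orb σ ∋ d ~ d′ → col C d ≡ col C d′
  onOrbit {σ = σ} C = orb-least (On.isEquivalence (col C) isEquivalence) σ (λ d → sym (onVertex C d))

  -- The face permutation sends `α d` to `σ (α (α d))`, that is to `σ d`; so both ends of an edge
  -- lie on a common face.
  proper : ∀ {m σ α} → Good σ α → (C : Colouring m σ α) → ∀ {d} → Live α d → col C d ≢ col C (to α d)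
  proper {σ = σ} {α} g C {d} live eq = faces C {to α d} {to σ d}
    (subst (λ e → Orb (σ ∙ α) ∋ to α d ~ to σ e) (involutive d) (orb-step (σ ∙ α) (to α d)))
    (λ r → loopless d live (Eqv.~trans (Orb σ) (orb-step σ d) (Eqv.~sym (Orb σ) r)))
    (trans (sym eq) (sym (onVertex C d)))
    where open Good g

  rename : ∀ {m σ α} → Perm (Fin m) → Colouring m σ α → Colouring m σ α
  rename π C = record
    { col      = to π ∘ col C
    ; onVertex = λ d → cong (to π) (onVertex C d)
    ; faces    = λ φdd′ ≁ e → faces C φdd′ ≁ (injective π e) }

  module Restriction (σ α : Perm A) {K : A → Set} (K? : ∀ d → Dec (K d))
                     (K-σ : ∀ {d} → K d → K (to σ d)) (K-α : ∀ {d} → K d → K (to α d)) where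

    off : List A
    off = filter (λ d → ¬? (K? d)) enum

    σᴷ αᴷ : Perm A
    σᴷ = isolateAll off σ
    αᴷ = isolateAll off α

    in⇒∉off : ∀ {d} → K d → d ∉ off
    in⇒∉off kd d∈ = proj₂ (∈-filter⁻ (λ d → ¬? (K? d)) {xs = enum} d∈) kd

    out⇒∈off : ∀ {d} → ¬ K d → d ∈ off
    out⇒∈off ¬kd = ∈-filter⁺ (λ d → ¬? (K? d)) (∈enum _) ¬kd

    σ-in : ∀ {d} → K d → to σᴷ d ≡ to σ d
    σ-in kd = isolateAll-keeps off σ (in⇒∉off kd) (in⇒∉off (K-σ kd))

    α-in : ∀ {d} → K d → to αᴷ d ≡ to α d
    α-in kd = isolateAll-keeps off α (in⇒∉off kd) (in⇒∉off (K-α kd))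

    σ-out : ∀ {d} → ¬ K d → to σᴷ d ≡ d
    σ-out ¬kd = isolateAll-fixes σ (out⇒∈off ¬kd)

    α-out : ∀ {d} → ¬ K d → to αᴷ d ≡ d
    α-out ¬kd = isolateAll-fixes α (out⇒∈off ¬kd)

    φ-in : ∀ {d} → K d → to (σᴷ ∙ αᴷ) d ≡ to (σ ∙ α) d
    φ-in kd = trans (cong (to σᴷ) (α-in kd)) (σ-in (K-α kd))

    iter-in : ∀ {d} → K d → ∀ i → iter (to (σᴷ ∙ αᴷ)) i d ≡ iter (to (σ ∙ α)) i d
    iter-in kd zero    = refl
    iter-in kd (suc i) = trans (cong (to (σᴷ ∙ αᴷ)) (iter-in kd i))
      (φ-in (iter-closed K (K-σ ∘ K-α) i kd))

    orb-in : ∀ {d d′} → K d → Orb (σ ∙ α) ∋ d ~ d′ → Orb (σᴷ ∙ αᴷ) ∋ d ~ d′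
    orb-in {d} kd r with orb⇒iter (σ ∙ α) r
    ... | i , eq = subst (Orb (σᴷ ∙ αᴷ) ∋ d ~_) (trans (iter-in kd i) eq) (iter⇒orb (σᴷ ∙ αᴷ) i)

    K-φ : ∀ {d d′} → K d → Orb (σ ∙ α) ∋ d ~ d′ → K d′
    K-φ kd r with orb⇒iter (σ ∙ α) r
    ... | i , refl = iter-closed K (K-σ ∘ K-α) i kd

    live-restrict⇒ : ∀ {d} → Live αᴷ d → K d × Live α d
    live-restrict⇒ {d} live with K? d
    ... | yes kd = kd , live ∘ trans (α-in kd)
    ... | no ¬kd = contradiction (α-out ¬kd) live

    restrict-tight : Tight σ α → Tight σᴷ αᴷ
    restrict-tight t = tight-swap αᴷ σᴷ (tight-isolateAll off αᴷ σ
      (tight-swap σ αᴷ (tight-isolateAll off σ α t)))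

    -- Looplessness is asked for on `K` alone, so that a restriction can also serve to discard
    -- loops: inflating a hyperedge with a single point produces one.
    restrict-good : 1 ≤ k → Tight σ α → (∀ d → to α (to α d) ≡ d) →
                    (∀ d → to α d ≡ d → to σ d ≡ d) →
                    (∀ d → K d → Live α d → ¬ Orb σ ∋ d ~ to α d) →
                    (∀ d → ∃[ j ] suc j ≤ k × iter (to (σ ∙ α)) (suc j) d ≡ d) →
                    Good σᴷ αᴷ
    restrict-good 1≤k t inv iso ll sh = record
      { tight      = restrict-tight t
      ; involutive = inv′
      ; isolated   = iso′
      ; loopless   = λ d live r → case live-restrict⇒ live of λ { (kd , l) →
          ll d kd l (subst (Orb σ ∋ d ~_) (α-in kd) (isolateAll-⊆ off σ r)) }
      ; short      = sh′ }
      where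
      inv′ : ∀ d → to αᴷ (to αᴷ d) ≡ d
      inv′ d with K? d
      ... | yes kd = trans (cong (to αᴷ) (α-in kd)) (trans (α-in (K-α kd)) (inv d))
      ... | no ¬kd = trans (cong (to αᴷ) (α-out ¬kd)) (α-out ¬kd)
      iso′ : ∀ d → to αᴷ d ≡ d → to σᴷ d ≡ d
      iso′ d eq with K? d
      ... | yes kd = trans (σ-in kd) (iso d (trans (sym (α-in kd)) eq))
      ... | no ¬kd = σ-out ¬kd
      sh′ : ∀ d → ∃[ j ] suc j ≤ k × iter (to (σᴷ ∙ αᴷ)) (suc j) d ≡ d
      sh′ d with K? d
      -- A deleted dart is a face of its own, of period 1, whence the assumption 1 ≤ `k`.
      ... | no ¬kd = 0 , 1≤k , trans (cong (to σᴷ) (α-out ¬kd)) (σ-out ¬kd)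
      ... | yes kd with sh d
      ...   | j , j≤k , eq = j , j≤k , trans (iter-in kd (suc j)) eq

  module Gluing {σ α : Perm A} (g : Good σ α) {K : A → Set} (K? : ∀ d → Dec (K d))
                (K-σ : ∀ {d} → K d → K (to σ d)) (K-α : ∀ {d} → K d → K (to α d)) where
    open Good g

    private
      -- A set closed under a permutation of a finite set is a union of cycles, and so is its
      -- complement.
      back : ∀ p → (∀ {d} → K d → K (to p d)) → ∀ {d} → ¬ K d → ¬ K (to p d)
      back p K-p {d} ¬kd kpd with orb⇒iter p (Eqv.~sym (Orb p) (orb-step p d))
      ... | i , eq = ¬kd (subst K eq (iter-closed K K-p i kpd))

    module I = Restriction σ α K? K-σ K-α
    module O = Restriction σ α (λ d → ¬? (K? d)) (back σ K-σ) (back α K-α)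

    private
      1≤k : ∀ d → 1 ≤ k
      1≤k d with short d
      ... | _ , j≤k , _ = ℕ.≤-trans (s≤s z≤n) j≤k

    good-in : A → Good I.σᴷ I.αᴷ
    good-in d₀ = I.restrict-good (1≤k d₀) tight involutive isolated (λ d _ → loopless d) short

    good-out : A → Good O.σᴷ O.αᴷ
    good-out d₀ = O.restrict-good (1≤k d₀) tight involutive isolated (λ d _ → loopless d) short

    module _ {m} (C : Colouring m I.σᴷ I.αᴷ) (D : Colouring m O.σᴷ O.αᴷ) where

      glueCol : A → Fin m
      glueCol d with K? d
      ... | yes _ = col C d
      ... | no  _ = col D d

      glue-in : ∀ {d} → K d → glueCol d ≡ col C d
      glue-in {d} kd with K? d
      ... | yes _  = refl
      ... | no ¬kd = contradiction kd ¬kd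

      glue-out : ∀ {d} → ¬ K d → glueCol d ≡ col D d
      glue-out {d} ¬kd with K? d
      ... | yes kd = contradiction kd ¬kd
      ... | no  _  = refl

      glue : Colouring m σ α
      glue = record { col = glueCol ; onVertex = vertex ; faces = face }
        where
        vertex : ∀ d → glueCol (to σ d) ≡ glueCol d
        vertex d = case K? d of λ
          { (yes kd) → trans (glue-in (K-σ kd)) (trans (cong (col C) (sym (I.σ-in kd)))
                         (trans (onVertex C d) (sym (glue-in kd))))
          ; (no ¬kd) → trans (glue-out (back σ K-σ ¬kd)) (trans (cong (col D) (sym (O.σ-in ¬kd)))
                         (trans (onVertex D d) (sym (glue-out ¬kd)))) }
        face : ∀ {d d′} → Orb (σ ∙ α) ∋ d ~ d′ → ¬ Orb σ ∋ d ~ d′ → glueCol d ≢ glueCol d′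
        face {d} {d′} r ≁ e = case K? d of λ
          { (yes kd) → faces C (I.orb-in kd r) (≁ ∘ isolateAll-⊆ I.off σ)
              (trans (sym (glue-in kd)) (trans e (glue-in (I.K-φ kd r))))
          ; (no ¬kd) → faces D (O.orb-in ¬kd r) (≁ ∘ isolateAll-⊆ O.off σ)
              (trans (sym (glue-out ¬kd)) (trans e (glue-out (O.K-φ ¬kd r)))) }

-- Cutting along a pair of parallel edges

module Cutting {A : Set} (F : Finite A) (k : ℕ) where
  open Finite F
  open Orbits F
  open Genus F
  open Maps F k
  open Colouring

  transpose-conj : ∀ (q : Perm A) a b x → to q (transpose a b x) ≡ transpose (to q a) (to q b) (to q x)
  transpose-conj q a b = transpose-elim (λ x y → to q y ≡ transpose (to q a) (to q b) (to q x))
    (sym (transpose-a _ _)) (sym (transpose-b _ _))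
    (λ x x≢a x≢b → sym (transpose-other (x≢a ∘ injective q) (x≢b ∘ injective q)))

  -- The transposition acts on the cycle of `a` only. It follows that after the split at one end of
  -- the edge, the vertex at the other end is still whole.
  orb-unaffected : ∀ (q : Perm A) {a b x y} → Orb q ∋ a ~ b → ¬ Orb q ∋ x ~ a →
                   Orb q ∋ x ~ y → Orb (q ∙ τ a b) ∋ x ~ y
  orb-unaffected q {a} {b} ab ¬xa xy with orb-least S-equiv q closed xy
    where
    open Eqv (Orb q)
    O′ = Orb (q ∙ τ a b)
    S : A → A → Set
    -- Inside the cycle of `a` nothing beyond `rel` is claimed; this makes `S` an equivalence that
    -- every step of `q` respects.
    S x y = rel x y × (rel x a ⊎ O′ ∋ x ~ y)
    S-equiv : IsEquivalence S
    S-equiv = record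
      { refl  = ~refl , inj₂ (Eqv.~refl O′)
      ; sym   = λ { (p , inj₁ xa) → ~sym p , inj₁ (~trans (~sym p) xa)
                  ; (p , inj₂ o)  → ~sym p , inj₂ (Eqv.~sym O′ o) }
      ; trans = λ { (p , inj₁ xa) (q , _)      → ~trans p q , inj₁ xa
                  ; (p , inj₂ _)  (q , inj₁ r) → ~trans p q , inj₁ (~trans p r)
                  ; (p , inj₂ o)  (q , inj₂ r) → ~trans p q , inj₂ (Eqv.~trans O′ o r) } }
    closed : ∀ x → S x (to q x)
    closed x with rel? x a
    ... | yes xa = orb-step q x , inj₁ xa
    ... | no ¬xa = orb-step q x , inj₂ (subst (O′ ∋ x ~_)
          (cong (to q) (transpose-other (λ { refl → ¬xa ~refl }) (λ { refl → ¬xa (~sym ab) })))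
          (orb-step (q ∙ τ a b) x))
  ... | _ , inj₁ xa = contradiction xa ¬xa
  ... | _ , inj₂ o  = o

  -- Cut the sphere along the closed curve formed by the parallel edges of e and e′.
  module Cut {σ α : Perm A} (g : Good σ α) {e e′ : A} (e≢e′ : e ≢ e′)
             (live : Live α e) (ee′ : Orb σ ∋ e ~ e′) (ff′ : Orb σ ∋ to α e ~ to α e′) where
    open Good g

    f f′ : A
    f  = to α e
    f′ = to α e′

    σ₁ : Perm A
    σ₁ = σ ∙ τ f f′

    -- One end is split by multiplying on the right, the other on the left. Since `τ f f′ ∙ α`
    -- equals `α ∙ τ e e′`, the new face permutation is the old one conjugated by `τ e e′`, and
    -- every face keeps its length.
    σ′ : Perm A
    σ′ = τ e e′ ∙ σ₁

    private
      f≢f′ : f ≢ f′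
      f≢f′ eq = e≢e′ (injective α eq)

      a = from σ₁ e
      b = from σ₁ e′

      a≢b : a ≢ b
      a≢b eq = e≢e′ (injective (σ₁ ⁻¹) eq)

      σ₂ : Perm A
      σ₂ = σ₁ ∙ τ a b

      -- Multiplication on the left by `τ e e′` is multiplication on the right by the transposition
      -- of the preimages; in this form the splitting lemmas apply.
      σ₂≗σ′ : ∀ x → to σ₂ x ≡ to σ′ x
      σ₂≗σ′ x = trans (transpose-conj σ₁ a b x)
        (cong₂ (λ u v → transpose u v (to σ₁ x)) (to-from σ₁ e) (to-from σ₁ e′))

      e~e′ : Orb σ₁ ∋ e ~ e′
      e~e′ = orb-unaffected σ ff′ (loopless e live) ee′

      a~b : Orb σ₁ ∋ a ~ b
      a~b = ~trans (subst (rel a) (to-from σ₁ e) (orb-step σ₁ a))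
            (~trans e~e′ (~sym (subst (rel b) (to-from σ₁ e′) (orb-step σ₁ b))))
        where open Eqv (Orb σ₁)

      z-σ′ : z σ′ ≡ suc (suc (z σ))
      z-σ′ = trans (sym (z-cong σ₂ σ′ σ₂≗σ′))
        (trans (z-split σ₁ a≢b a~b) (cong suc (z-split σ f≢f′ ff′)))

    tight′ : Tight σ′ α
    tight′ = tight-cong σ₂ α σ′ α σ₂≗σ′ (λ _ → refl)
      (tight-swap α σ₂ (tight-split α σ₁ a≢b a~b (tight-split α σ f≢f′ ff′ (tight-swap σ α tight))))

    φ-conj : ∀ x → transpose e e′ (to (σ ∙ α) x) ≡ to (σ′ ∙ α) (transpose e e′ x)
    φ-conj x = cong (λ y → transpose e e′ (to σ y)) (sym (trans
      (cong (transpose f f′) (transpose-conj α e e′ x)) (transpose-involutive f f′ (to α x))))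

    private
      iter-conj : ∀ i x → iter (to (σ′ ∙ α)) i (transpose e e′ x) ≡ transpose e e′ (iter (to (σ ∙ α)) i x)
      iter-conj zero    x = refl
      iter-conj (suc i) x = trans (cong (to (σ′ ∙ α)) (iter-conj i x)) (sym (φ-conj _))

      c-σ′ : c σ′ α ≡ suc (c σ α)
      c-σ′ = ℕ.*-cancelˡ-≡ (c σ′ α) (suc (c σ α)) 2 (ℕ.+-cancelˡ-≡ N (2 * c σ′ α) (2 * suc (c σ α)) (begin
        N + 2 * c σ′ α                                ≡⟨ tight′ ⟨
        z σ′ + z α + z (σ′ ∙ α)                       ≡⟨ cong₂ (λ u v → u + z α + v) z-σ′
                                                           (sym (z-conj (τ e e′) (σ ∙ α) (σ′ ∙ α) φ-conj)) ⟩
        suc (suc (z σ + z α + z (σ ∙ α)))             ≡⟨ cong (2 +_) tight ⟩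
        suc (suc (N + 2 * c σ α))                     ≡⟨ arith N (c σ α) ⟩
        N + 2 * suc (c σ α)                           ∎))
        where
        open ≡-Reasoning
        arith : ∀ n m → suc (suc (n + 2 * m)) ≡ n + 2 * suc m
        arith = solve-∀

      swap-σ : ∀ x → to σ x ≡ transpose e e′ (to σ′ (transpose f f′ x))
      swap-σ x = trans (cong (to σ) (sym (transpose-involutive f f′ x))) (sym (transpose-involutive e e′ _))

    σ′⊆σ : ∀ {x y} → Orb σ′ ∋ x ~ y → Orb σ ∋ x ~ y
    σ′⊆σ = orb-least equiv σ′ (λ x → ~trans (~∙τ equiv σ ff′ (orb-step σ) x) (~transpose equiv ee′ _))
      where open Eqv (Orb σ)

    -- If `e` and `e′` were still connected, so would be `f` and `f′`. Every step of `σ`, being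
    -- `τ e e′ ∙ σ′ ∙ τ f f′`, would then stay in a component, and the cut could not have created a
    -- new one.
    separated : ¬ Conn σ′ α ∋ e ~ e′
    separated r = ℕ.<-irrefl refl (subst (_≤ c σ α) c-σ′ (c-≤ σ α σ′ α steps (conn-stepʳ σ′ α)))
      where
      open Eqv (Conn σ′ α)
      ff : rel f f′
      ff = ~trans (~sym (conn-stepʳ σ′ α e)) (~trans r (conn-stepʳ σ′ α e′))
      steps : ∀ x → rel x (to σ x)
      steps x = subst (rel x) (sym (swap-σ x))
        (~trans (~transpose equiv ff x) (~trans (conn-stepˡ σ′ α _) (~transpose equiv r _)))

    good′ : Good σ′ α
    good′ = record
      { tight      = tight′
      ; involutive = involutive
      ; isolated   = iso
      ; loopless   = λ d l r → loopless d l (σ′⊆σ r)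
      ; short      = sh }
      where
      live′ : Live α e′
      live′ eq with orb⇒iter σ (Eqv.~sym (Orb σ) ee′)
      ... | i , p = e≢e′ (trans (sym p) (iter-closed (_≡ e′) (λ { refl → isolated e′ eq }) i refl))
      fixed≢ : ∀ {d x} → to α d ≡ d → Live α x → d ≢ x
      fixed≢ fix l refl = l fix
      liveα : ∀ {x} → Live α x → Live α (to α x)
      liveα l eq = l (injective α eq)
      iso : ∀ d → to α d ≡ d → to σ′ d ≡ d
      iso d fix = trans
        (cong (λ y → transpose e e′ (to σ y))
          (transpose-other (fixed≢ fix (liveα live)) (fixed≢ fix (liveα live′))))
        (trans (cong (transpose e e′) (isolated d fix)) (transpose-other (fixed≢ fix live) (fixed≢ fix live′)))
      sh : ∀ d → ∃[ j ] suc j ≤ k × iter (to (σ′ ∙ α)) (suc j) d ≡ d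
      sh d with short (transpose e e′ d)
      ... | j , j≤k , p = j , j≤k , trans
        (cong (iter (to (σ′ ∙ α)) (suc j)) (sym (transpose-involutive e e′ d)))
        (trans (iter-conj (suc j) (transpose e e′ d))
        (trans (cong (transpose e e′) p) (transpose-involutive e e′ d)))

    -- The colours agree on the two points exchanged by each transposition, so they cannot tell `σ`
    -- from `σ′`; faces correspond under `τ e e′`.
    regluing : ∀ {m} (C : Colouring m σ′ α) → col C e ≡ col C e′ → col C f ≡ col C f′ → Colouring m σ α
    regluing C ce cf = record { col = col C ; onVertex = vertex ; faces = face }
      where
      invariant : ∀ {a b} → col C a ≡ col C b → ∀ x → col C x ≡ col C (transpose a b x)
      invariant = ~transpose (On.isEquivalence (col C) isEquivalence)
      vertex : ∀ d → col C (to σ d) ≡ col C d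
      vertex d = trans (cong (col C) (swap-σ d)) (trans (sym (invariant ce _))
        (trans (onVertex C _) (sym (invariant cf d))))
      face : ∀ {d d′} → Orb (σ ∙ α) ∋ d ~ d′ → ¬ Orb σ ∋ d ~ d′ → col C d ≢ col C d′
      face {d} {d′} r ≁ eq = faces C {transpose e e′ d} {transpose e e′ d′}
        (orb-map {σ ∙ α} {σ′ ∙ α} (transpose e e′) φ-conj r)
        (λ s → ≁ (~trans (~transpose equiv ee′ d) (~trans (σ′⊆σ s) (~sym (~transpose equiv ee′ d′)))))
        (trans (sym (invariant ce d)) (trans eq (invariant ce d′)))
        where open Eqv (Orb σ)

  liveCount : Perm A → ℕ
  liveCount α = length (filter (live? α) enum)

  module Reduction {m} (c₀ : Fin m)
    (simpleCase : ∀ {σ α} → Good σ α → ∀ d₀ → Live α d₀ →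
      (∀ {d d′} → Live α d → Live α d′ → Conn σ α ∋ d ~ d′) →
      (∀ {e e′} → Live α e → Live α e′ → Orb σ ∋ e ~ e′ → Orb σ ∋ to α e ~ to α e′ → e ≡ e′) →
      Colouring m σ α) where

    private
      Split : Perm A → Perm A → Set
      Split σ α = Any (λ d → Any (λ d′ → (Live α d × Live α d′) × ¬ Conn σ α ∋ d ~ d′) enum) enum

      split? : ∀ σ α → Dec (Split σ α)
      split? σ α = any? (λ d → any? (λ d′ →
        (live? α d ×-dec live? α d′) ×-dec ¬? (Eqv.rel? (Conn σ α) d d′)) enum) enum

      Parallel : Perm A → Perm A → A → A → Set
      Parallel σ α e e′ = (Live α e × Live α e′) × (e ≢ e′ × (Orb σ ∋ e ~ e′ × Orb σ ∋ to α e ~ to α e′))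

      parallel? : ∀ σ α → Dec (Any (λ e → Any (Parallel σ α e) enum) enum)
      parallel? σ α = any? (λ e → any? (λ e′ → (live? α e ×-dec live? α e′) ×-dec (¬? (e ≟ e′) ×-dec
        (Eqv.rel? (Orb σ) e e′ ×-dec Eqv.rel? (Orb σ) (to α e) (to α e′)))) enum) enum

      shrink : ∀ {n} (α αᴷ : Perm A) (K : A → Set) → (∀ {x} → Live αᴷ x → K x × Live α x) →
               ∀ {x} → Live α x → ¬ K x → liveCount α ≤ n → liveCount αᴷ < n
      shrink α αᴷ K h l ¬kx = ℕ.≤-trans
        (filter-< (live? αᴷ) (live? α) (proj₂ ∘ h) (∈enum _) l (λ lᴷ → ¬kx (proj₁ (h lᴷ))))

    -- Induction on the number of live darts. A cut leaves that number unchanged; the separation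
    -- makes it drop, since the part containing `e` loses `e′` and the other part loses `e`. A
    -- disconnected map is likewise treated part by part.
    colour : ∀ n {σ α} → Good σ α → liveCount α < n → Colouring m σ α
    colour (suc n) {σ} {α} g (s≤s count≤n) with any? (live? α) enum
    ... | no dead = record
      { col      = λ _ → c₀
      ; onVertex = λ _ → refl
      ; faces    = λ {d} r ≁ → contradiction (subst (Orb σ ∋ d ~_) (fixed r) (Eqv.~refl (Orb σ))) ≁ }
      where
      α-fix : ∀ d → to α d ≡ d
      α-fix d with to α d ≟ d
      ... | yes p = p
      ... | no ¬p = contradiction (lose (∈enum d) ¬p) dead
      fixed : ∀ {d d′} → Orb (σ ∙ α) ∋ d ~ d′ → d ≡ d′
      fixed = orb-least isEquivalence (σ ∙ α)
        (λ d → sym (trans (cong (to σ) (α-fix d)) (Good.isolated g d (α-fix d))))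
    ... | yes any-live with split? σ α
    ...   | yes s with find s
    ...     | d , _ , s′ with find s′
    ...       | d′ , _ , (l , l′) , ≁ =
                G.glue (colour n (G.good-in d) (shrink α G.I.αᴷ (rel d) G.I.live-restrict⇒ l′ ≁ count≤n))
                       (colour n (G.good-out d) (shrink α G.O.αᴷ (¬_ ∘ rel d) G.O.live-restrict⇒ l (λ ¬dd → ¬dd ~refl) count≤n))
      where
      open Eqv (Conn σ α)
      module G = Gluing g {K = rel d} (rel? d) (λ p → ~trans p (conn-stepˡ σ α _)) (λ p → ~trans p (conn-stepʳ σ α _))
    colour (suc n) {σ} {α} g (s≤s count≤n) | yes any-live | no ¬s with parallel? σ α
    ...   | no ¬p with find any-live
    ...     | d₀ , _ , l₀ = simpleCase g d₀ l₀ connected′ simple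
      where
      connected′ : ∀ {d d′} → Live α d → Live α d′ → Conn σ α ∋ d ~ d′
      connected′ {d} {d′} l l′ with Eqv.rel? (Conn σ α) d d′
      ... | yes r = r
      ... | no ¬r = contradiction (lose (∈enum d) (lose (∈enum d′) ((l , l′) , ¬r))) ¬s
      simple : ∀ {e e′} → Live α e → Live α e′ → Orb σ ∋ e ~ e′ → Orb σ ∋ to α e ~ to α e′ → e ≡ e′
      simple {e} {e′} l l′ r r′ with e ≟ e′
      ... | yes p = p
      ... | no ¬e = contradiction (lose (∈enum e) (lose (∈enum e′) ((l , l′) , (¬e , (r , r′))))) ¬p
    colour (suc n) {σ} {α} g (s≤s count≤n) | yes any-live | no ¬s | yes p with find p
    ...   | e , _ , p′ with find p′
    ...     | e′ , _ , (l , l′) , e≢e′ , ee′ , ff′ = X.regluing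
                (G.glue C (rename (proj₁ match) D))
                (trans (G.glue-in C D′ ~refl) (trans (sym (proj₁ (proj₂ match))) (sym (G.glue-out C D′ X.separated))))
                (trans (G.glue-in C D′ f∈) (trans (sym (proj₂ (proj₂ match))) (sym (G.glue-out C D′ f′∉))))
      where
      module X = Cut g e≢e′ l ee′ ff′
      open Eqv (Conn X.σ′ α)
      module G = Gluing X.good′ {K = rel e} (rel? e) (λ p → ~trans p (conn-stepˡ X.σ′ α _)) (λ p → ~trans p (conn-stepʳ X.σ′ α _))
      f∈ : rel e X.f
      f∈ = conn-stepʳ X.σ′ α e
      f′∉ : ¬ rel e X.f′
      f′∉ r = X.separated (~trans r (~sym (conn-stepʳ X.σ′ α e′)))
      C = colour n (G.good-in e) (shrink α G.I.αᴷ (rel e) G.I.live-restrict⇒ l′ X.separated count≤n)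
      D = colour n (G.good-out e) (shrink α G.O.αᴷ (¬_ ∘ rel e) G.O.live-restrict⇒ l (λ ¬ee → ¬ee ~refl) count≤n)
      C-proper : col C e ≢ col C X.f
      C-proper = subst (λ x → col C e ≢ col C x) (G.I.α-in ~refl)
        (proper (G.good-in e) C (l ∘ trans (sym (G.I.α-in ~refl))))
      D-proper : col D e′ ≢ col D X.f′
      D-proper = subst (λ x → col D e′ ≢ col D x) (G.O.α-in X.separated)
        (proper (G.good-out e) D (l′ ∘ trans (sym (G.O.α-in X.separated))))
      -- On each side the two ends of the edge have different colours; hence one permutation of the
      -- colours can match both ends at once.
      match = recolour D-proper C-proper
      D′ = rename (proj₁ match) D

-- Plane graphs as planar maps

any-true⁺ : ∀ {A : Set} {p : A → Bool} {xs x} → x ∈ xs → p x ≡ true → any p xs ≡ true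
any-true⁺ (here refl) px rewrite px = refl
any-true⁺ {p = p} {y ∷ _} (there x∈) px with p y
... | true  = refl
... | false = any-true⁺ x∈ px

any-true⁻ : ∀ {A : Set} {p : A → Bool} {xs} → any p xs ≡ true → ∃[ x ] x ∈ xs × p x ≡ true
any-true⁻ {p = p} {y ∷ ys} eq with p y in py
... | true  = y , here refl , py
... | false with any-true⁻ {p = p} {ys} eq
...   | x , x∈ , px = x , there x∈ , px

all-true⁺ : ∀ {A : Set} {p : A → Bool} {xs} → (∀ {x} → x ∈ xs → p x ≡ true) → all p xs ≡ true
all-true⁺ {xs = []}     h = refl
all-true⁺ {xs = y ∷ ys} h rewrite h (here refl) = all-true⁺ (h ∘ there)

all-true⁻ : ∀ {A : Set} {p : A → Bool} {xs x} → all p xs ≡ true → x ∈ xs → p x ≡ true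
all-true⁻ {p = p} {y ∷ _} eq x∈ with p y in py
all-true⁻ eq (here refl) | true = py
all-true⁻ eq (there x∈)  | true = all-true⁻ eq x∈

∧-true⁻ : ∀ {a b} → a ∧ b ≡ true → a ≡ true × b ≡ true
∧-true⁻ {true} {true} refl = refl , refl

∧-true⁺ : ∀ {a b} → a ≡ true → b ≡ true → a ∧ b ≡ true
∧-true⁺ refl refl = refl

≤ᵇ-true⁺ : ∀ {a b} → a ≤ b → (a ≤ᵇ b) ≡ true
≤ᵇ-true⁺ {a} {b} a≤b with a ≤ᵇ b | ℕ.≤⇒≤ᵇ a≤b
... | true | _ = refl

≤ᵇ-true⁻ : ∀ {a b} → (a ≤ᵇ b) ≡ true → a ≤ b
≤ᵇ-true⁻ {a} {b} eq = ℕ.≤ᵇ⇒≤ a b (subst T (sym eq) tt)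

argmin : ∀ (f : ℕ → ℕ) M → 1 ≤ M → ∃[ m ] m < M × (∀ {i} → i < M → f m ≤ f i)
argmin f (suc zero) _ = 0 , s≤s z≤n , λ { {zero} _ → ℕ.≤-refl ; {suc _} (s≤s ()) }
argmin f (suc (suc M)) _ with argmin f (suc M) (s≤s z≤n)
... | m , m<M , min with ℕ.≤-total (f m) (f (suc M))
...   | inj₁ le = m , ℕ.m<n⇒m<1+n m<M , λ i< → case ℕ.m<1+n⇒m<n∨m≡n i< of λ
          { (inj₁ i<M) → min i<M ; (inj₂ refl) → le }
...   | inj₂ ge = suc M , ℕ.n<1+n (suc M) , λ i< → case ℕ.m<1+n⇒m<n∨m≡n i< of λ
          { (inj₁ i<M) → ℕ.≤-trans ge (min i<M) ; (inj₂ refl) → ℕ.≤-refl }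

pairs : ∀ n → List (Fin n × Fin n)
pairs n = cartesianProduct (allFin n) (allFin n)

∈pairs : ∀ {n} (p : Fin n × Fin n) → p ∈ pairs n
∈pairs (u , v) = ∈-cartesianProduct⁺ (∈-allFin u) (∈-allFin v)

_≟ᵖ_ : ∀ {n} → DecidableEquality (Fin n × Fin n)
_≟ᵖ_ = Product.≡-dec Fin._≟_ Fin._≟_

finitePairs : ∀ n → Finite (Fin n × Fin n)
finitePairs n = record { _≟_ = _≟ᵖ_ ; enum = pairs n ; ∈enum = ∈pairs }

pairs-unique : ∀ n → Unique (pairs n)
pairs-unique n = Unique.cartesianProduct⁺ (Unique.allFin⁺ n) (Unique.allFin⁺ n)

#-allFin : ∀ n → # (≡-eqv (Fin._≟_ {n})) (allFin n) ≡ n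
#-allFin n = trans (#-unique Fin._≟_ (Unique.allFin⁺ n)) (List.length-tabulate id)

code-injective : ∀ {n} (G : Graph n) rot {p q} → code G rot p ≡ code G rot q → p ≡ q
code-injective {n} G rot {u , v} {u′ , v′} eq = cong₂ _,_ (proj₁ both) (proj₂ both)
  where
  toℕ-code : ∀ x y → toℕ (combine x y) ≡ code G rot (x , y)
  toℕ-code x y = trans (Fin.toℕ-combine x y) (cong (_+ toℕ y) (ℕ.*-comm n (toℕ x)))
  both = Fin.combine-injective u v u′ v′
    (Fin.toℕ-injective (trans (toℕ-code u v) (trans eq (sym (toℕ-code u′ v′)))))

-- The elements of A not fixed by α stand for the darts of the rotation system.
record Represents {A : Set} (F : Finite A) {n} (G : Graph n) (rot : Fin n → Fin n → Fin n)
                  (σ α : Perm A) (e : A → Fin n × Fin n) : Set where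
  open Orbits F
  field
    involutive : ∀ d → to α (to α d) ≡ d
    isolated   : ∀ d → to α d ≡ d → to σ d ≡ d
    e-dart     : ∀ {d} → to α d ≢ d → isDart G rot (e d) ≡ true
    e-inj      : ∀ {d d′} → to α d ≢ d → to α d′ ≢ d′ → e d ≡ e d′ → d ≡ d′
    e-surj     : ∀ {u v} → adj G u v ≡ true → ∃[ d ] to α d ≢ d × e d ≡ (u , v)
    e-α        : ∀ {d} → to α d ≢ d → e (to α d) ≡ (proj₂ (e d) , proj₁ (e d))
    e-face     : ∀ {d} → to α d ≢ d → faceStep G rot (e d) ≡ e (to (σ ∙ α) d)
    e-vertex   : ∀ {d d′} → to α d ≢ d → to α d′ ≢ d′ → proj₁ (e d) ≡ proj₁ (e d′) → Orb σ ∋ d ~ d′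

-- Serves both translations: with `e = id`, Euler's formula of a plane graph gives `Tight`; with
-- `e = ends`, `Tight` gives Euler's formula for the graph built from a map.
module Representation {A : Set} (F : Finite A) {n} {G : Graph n} {rot : Fin n → Fin n → Fin n}
                      {σ α : Perm A} {e : A → Fin n × Fin n} (rep : Represents F G rot σ α e) where
  open Finite F
  open Orbits F
  open Genus F
  open Represents rep

  φ : Perm A
  φ = σ ∙ α

  live? : ∀ d → Dec (to α d ≢ d)
  live? d = ¬? (to α d ≟ d)

  α-live : ∀ {d} → to α d ≢ d → to α (to α d) ≢ to α d
  α-live l eq = l (injective α eq)

  σ-live : ∀ {d} → to α d ≢ d → to α (to σ d) ≢ to σ d
  σ-live {d} l eq = l (subst (λ x → to α x ≡ x) (injective σ (isolated (to σ d) eq)) eq)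

  φ-live : ∀ {d} → to α d ≢ d → to α (to φ d) ≢ to φ d
  φ-live = σ-live ∘ α-live

  e-σ : ∀ {d} → to α d ≢ d → proj₁ (e (to σ d)) ≡ proj₁ (e d)
  e-σ {d} l = trans (cong (λ x → proj₁ (e (to σ x))) (sym (involutive d)))
    (trans (sym (cong proj₁ (e-face (α-live l)))) (cong proj₂ (e-α l)))

  e-orbit : ∀ {d d′} → to α d ≢ d → Orb σ ∋ d ~ d′ → proj₁ (e d) ≡ proj₁ (e d′)
  e-orbit {d} l r with orb⇒iter σ r
  ... | i , refl = proj₁ (iter-closed (λ x → proj₁ (e d) ≡ proj₁ (e x) × to α x ≢ x)
          (λ { (p , l′) → trans p (sym (e-σ l′)) , σ-live l′ }) i (refl , l))

  iter-live : ∀ i {d} → to α d ≢ d → to α (iter (to φ) i d) ≢ iter (to φ) i d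
  iter-live = iter-closed (λ d → to α d ≢ d) φ-live

  walk-e : ∀ i {d} → to α d ≢ d → walk G rot i (e d) ≡ e (iter (to φ) i d)
  walk-e zero    l = refl
  walk-e (suc i) l = trans (cong (faceStep G rot) (walk-e i l)) (e-face (iter-live i l))

  -- Live darts embed into the n * n pairs of vertices, so n * n steps go all the way round a face.
  -- This justifies the search bounds in `isFaceRep` and `onFace`.
  face-period : ∀ {d} → to α d ≢ d → ∃[ j ] suc j ≤ n * n × iter (to φ) (suc j) d ≡ d
  face-period {d} l = iter-period (injective φ) d (λ i → pack (e (iter (to φ) i d)))
    (λ i j eq → e-inj (iter-live i l) (iter-live j l) (pack-injective eq))
    where
    pack : Fin n × Fin n → Fin (n * n)
    pack (u , v) = combine u v
    pack-injective : ∀ {p q} → pack p ≡ pack q → p ≡ q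
    pack-injective {u , v} {u′ , v′} eq =
      cong₂ _,_ (proj₁ (Fin.combine-injective u v u′ v′ eq)) (proj₂ (Fin.combine-injective u v u′ v′ eq))

  orb⇒walk : ∀ {d d′} → to α d ≢ d → Orb φ ∋ d ~ d′ → ∃[ i ] i < n * n × walk G rot i (e d) ≡ e d′
  orb⇒walk l r with orb⇒iter φ r | face-period l
  ... | i , eq | j , j≤ , p = i % suc j , ℕ.≤-trans (m%n<n i (suc j)) j≤ ,
        trans (walk-e (i % suc j) l) (cong e (trans (sym (iter-mod (to φ) p i)) eq))

  module Counting (d₀ : A) (l₀ : to α d₀ ≢ d₀)
                  (conn : ∀ {d d′} → to α d ≢ d → to α d′ ≢ d′ → Conn σ α ∋ d ~ d′)
                  (covered : ∀ u → ∃[ d ] to α d ≢ d × proj₁ (e d) ≡ u) where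

    xs js : List A
    xs = filter live? enum
    js = filter (λ d → ¬? (live? d)) enum

    xs-live : ∀ {d} → d ∈ xs → to α d ≢ d
    xs-live d∈ = proj₂ (∈-filter⁻ live? {xs = enum} d∈)

    live-xs : ∀ {d} → to α d ≢ d → d ∈ xs
    live-xs l = ∈-filter⁺ live? (∈enum _) l

    js-dead : ∀ {d} → d ∈ js → to α d ≡ d
    js-dead {d} d∈ with to α d ≟ d
    ... | yes p = p
    ... | no ¬p = contradiction ¬p (proj₂ (∈-filter⁻ (λ d → ¬? (live? d)) {xs = enum} d∈))

    J : ℕ
    J = # (≡-eqv _≟_) js

    Fixes : (A → A → Set) → Set
    Fixes S = ∀ {x y} → S x y → (to α x ≡ x → x ≡ y) × (to α y ≡ y → x ≡ y)

    fixes-equiv : IsEquivalence (λ x y → (to α x ≡ x → x ≡ y) × (to α y ≡ y → x ≡ y))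
    fixes-equiv = record
      { refl  = (λ _ → refl) , (λ _ → refl)
      ; sym   = λ { (p , q) → (λ f → sym (q f)) , (λ f → sym (p f)) }
      ; trans = λ { (p , q) (r , s) →
          (λ f → case p f of λ { refl → r f }) , (λ f → case s f of λ { refl → q f }) } }

    fixes-step : (p : Perm A) → (∀ d → to α d ≡ d → to p d ≡ d) →
                 ∀ x → (to α x ≡ x → x ≡ to p x) × (to α (to p x) ≡ to p x → x ≡ to p x)
    fixes-step p fix x = (λ f → sym (fix x f)) , (λ f → sym (injective p (fix (to p x) f)))

    -- Dead darts are singleton classes and contribute `J` to every count. In `Tight` this gives 3J
    -- on both sides, and it cancels.
    count-live : ∀ (R : Eqv A) → Fixes (Eqv.rel R) → # R enum ≡ # R xs + J
    count-live R fixes = trans (ℕ.≤-antisym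
        (ℕ.≤-trans (#-inj R S {enum} {zs} split into reflect) (ℕ.≤-reflexive (#-⊎ R R xs js)))
        (ℕ.≤-trans (ℕ.≤-reflexive (sym (#-⊎ R R xs js)))
          (#-inj S R {zs} {enum} [ id , id ]′ (λ _ → lose (∈enum _) ~refl) reflect′)))
      (cong (# R xs +_) (ℕ.≤-antisym
        (#-antitone (≡-eqv _≟_) R js (λ { _ _ refl → ~refl }))
        (#-antitone R (≡-eqv _≟_) js (λ x∈ _ r → proj₁ (fixes r) (js-dead x∈)))))
      where
      open Eqv R
      S = R ⊎-eqv R
      zs = map inj₁ xs ++ map inj₂ js
      split : A → A ⊎ A
      split d with live? d
      ... | yes _ = inj₁ d
      ... | no  _ = inj₂ d
      into : ∀ {d} → d ∈ enum → Any (Eqv.rel S (split d)) zs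
      into {d} d∈ with live? d
      ... | yes l = lose (∈-++⁺ˡ (∈-map⁺ inj₁ (live-xs l))) ~refl
      ... | no ¬l = lose (∈-++⁺ʳ (map inj₁ xs) (∈-map⁺ inj₂ (∈-filter⁺ (λ d → ¬? (live? d)) d∈ ¬l))) ~refl
      reflect : ∀ {x y} → x ∈ enum → y ∈ enum → S ∋ split x ~ split y → R ∋ x ~ y
      reflect {x} {y} _ _ r with live? x | live? y
      ... | yes _ | yes _ = r
      ... | no  _ | no  _ = r
      apart : ∀ {x y} → x ∈ xs → y ∈ js → ¬ rel x y
      apart x∈ y∈ r with proj₂ (fixes r) (js-dead y∈)
      ... | refl = xs-live x∈ (js-dead y∈)
      side : ∀ {x} → x ∈ zs → [ _∈ xs , _∈ js ]′ x
      side x∈ with ∈-++⁻ (map inj₁ xs) x∈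
      ... | inj₁ i with ∈-map⁻ inj₁ i
      ...   | _ , y∈ , refl = y∈
      side x∈ | inj₂ i with ∈-map⁻ inj₂ i
      ...   | _ , y∈ , refl = y∈
      reflect′ : ∀ {x y} → x ∈ zs → y ∈ zs → R ∋ [ id , id ]′ x ~ [ id , id ]′ y → S ∋ x ~ y
      reflect′ {inj₁ _} {inj₁ _} _  _  r = r
      reflect′ {inj₂ _} {inj₂ _} _  _  r = r
      reflect′ {inj₁ _} {inj₂ _} x∈ y∈ r = apart (side x∈) (side y∈) r
      reflect′ {inj₂ _} {inj₁ _} x∈ y∈ r = apart (side y∈) (side x∈) (~sym r)

    vertices : # (Orb σ) xs ≡ n
    vertices = trans (ℕ.≤-antisym
      (#-inj (Orb σ) (≡-eqv Fin._≟_) {xs} {allFin n} (proj₁ ∘ e) (λ _ → lose (∈-allFin _) refl)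
        (λ x∈ y∈ → e-vertex (xs-live x∈) (xs-live y∈)))
      (#-inj (≡-eqv Fin._≟_) (Orb σ) {allFin n} {xs} (proj₁ ∘ covered)
        (λ {u} _ → lose (live-xs (proj₁ (proj₂ (covered u)))) (Eqv.~refl (Orb σ)))
        (λ {u} {v} _ _ r → trans (sym (proj₂ (proj₂ (covered u))))
          (trans (e-orbit (proj₁ (proj₂ (covered u))) r) (proj₂ (proj₂ (covered v)))))))
      (#-allFin n)

    components : # (Conn σ α) xs ≡ 1
    components = ℕ.≤-antisym
      (#-inj (Conn σ α) ⊤-eqv {xs} {tt ∷ []} (λ _ → tt) (λ _ → here tt)
        (λ x∈ y∈ _ → conn (xs-live x∈) (xs-live y∈)))
      (#-inj ⊤-eqv (Conn σ α) {tt ∷ []} {xs} (λ _ → d₀)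
        (λ _ → lose (live-xs l₀) (Eqv.~refl (Conn σ α))) (λ _ _ _ → tt))

    dart : Fin n × Fin n → A
    dart p with Bool._≟_ (isDart G rot p) true
    ... | yes a = proj₁ (e-surj a)
    ... | no  _ = d₀

    dart-live : ∀ p → to α (dart p) ≢ dart p
    dart-live p with Bool._≟_ (isDart G rot p) true
    ... | yes a = proj₁ (proj₂ (e-surj a))
    ... | no  _ = l₀

    e-of-dart : ∀ {p} → isDart G rot p ≡ true → e (dart p) ≡ p
    e-of-dart {p} a with Bool._≟_ (isDart G rot p) true
    ... | yes b = proj₂ (proj₂ (e-surj b))
    ... | no ¬b = contradiction a ¬b

    private
      isDart? : ∀ (p : Fin n × Fin n) → Dec (isDart G rot p ≡ true)
      isDart? p = Bool._≟_ (isDart G rot p) true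
      isRep? : ∀ (p : Fin n × Fin n) → Dec ((isDart G rot p ∧ isFaceRep G rot p) ≡ true)
      isRep? p = Bool._≟_ (isDart G rot p ∧ isFaceRep G rot p) true
      ds rs : List (Fin n × Fin n)
      ds = filter isDart? (pairs n)
      rs = filter isRep? (pairs n)

    darts : # (≡-eqv _≟_) xs ≡ dartCount G rot
    darts = trans (ℕ.≤-antisym
      (#-inj (≡-eqv _≟_) (≡-eqv _≟ᵖ_) {xs} {ds} e
        (λ x∈ → lose (∈-filter⁺ isDart? (∈pairs _) (e-dart (xs-live x∈))) refl)
        (λ x∈ y∈ → e-inj (xs-live x∈) (xs-live y∈)))
      (#-inj (≡-eqv _≟ᵖ_) (≡-eqv _≟_) {ds} {xs} dart
        (λ {p} _ → lose (live-xs (dart-live p)) refl)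
        (λ p∈ q∈ eq → trans (sym (e-of-dart (dart∈ p∈))) (trans (cong e eq) (e-of-dart (dart∈ q∈))))))
      (#-unique _≟ᵖ_ (Unique.filter⁺ isDart? (pairs-unique n)))
      where
      dart∈ : ∀ {p} → p ∈ ds → isDart G rot p ≡ true
      dart∈ p∈ = proj₂ (∈-filter⁻ isDart? {xs = pairs n} p∈)

    -- Each live dart is sent to the dart of least code on its face. Conversely, two representatives
    -- of one face bound each other's codes, hence coincide.
    faceReps : # (Orb φ) xs ≡ faceCount' G rot
    faceReps = trans (ℕ.≤-antisym
      (#-inj (Orb φ) (≡-eqv _≟ᵖ_) {xs} {rs} minimal
        (λ x∈ → lose (minimal∈ (xs-live x∈)) refl)
        (λ x∈ y∈ → minimal-reflects (xs-live x∈) (xs-live y∈)))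
      (#-inj (≡-eqv _≟ᵖ_) (Orb φ) {rs} {xs} dart
        (λ {p} _ → lose (live-xs (dart-live p)) (Eqv.~refl (Orb φ)))
        (λ p∈ q∈ r → code-injective G rot (ℕ.≤-antisym
          (rep-≤ p∈ q∈ r) (rep-≤ q∈ p∈ (Eqv.~sym (Orb φ) r))))))
      (#-unique _≟ᵖ_ (Unique.filter⁺ isRep? (pairs-unique n)))
      where
      1≤n² : 1 ≤ n * n
      1≤n² with face-period l₀
      ... | _ , j≤ , _ = ℕ.≤-trans (s≤s z≤n) j≤
      least-on-walk : ∀ {d m} → to α d ≢ d →
        (∀ {i} → i < n * n → code G rot (walk G rot m (e d)) ≤ code G rot (walk G rot i (e d))) →
        ∀ i → code G rot (walk G rot m (e d)) ≤ code G rot (walk G rot i (walk G rot m (e d)))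
      least-on-walk {d} {m} l least i with orb⇒walk l (iter⇒orb φ (i + m))
      ... | i′ , i′< , eq = subst (λ p → code G rot (walk G rot m (e d)) ≤ code G rot p)
            (trans eq (trans (sym (walk-e (i + m) l)) (iter-+ (faceStep G rot) i m (e d))))
            (least i′<)
      best : ∀ d → ∃[ m ] m < n * n × (∀ {i} → i < n * n →
               code G rot (walk G rot m (e d)) ≤ code G rot (walk G rot i (e d)))
      best d = argmin (λ i → code G rot (walk G rot i (e d))) (n * n) 1≤n²
      minimal : A → Fin n × Fin n
      minimal d = walk G rot (proj₁ (best d)) (e d)
      minimal-e : ∀ {d} → to α d ≢ d → minimal d ≡ e (iter (to φ) (proj₁ (best d)) d)
      minimal-e {d} l = walk-e (proj₁ (best d)) l
      minimal∈ : ∀ {d} → to α d ≢ d → minimal d ∈ rs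
      minimal∈ {d} l = ∈-filter⁺ isRep? (∈pairs _) (∧-true⁺
        (subst (λ p → isDart G rot p ≡ true) (sym (minimal-e l)) (e-dart (iter-live m l)))
        (all-true⁺ {xs = upTo (n * n)} λ {i} _ → ≤ᵇ-true⁺ (least-on-walk {d} {m} l (proj₂ (proj₂ (best d))) i)))
        where m = proj₁ (best d)
      minimal-reflects : ∀ {d d′} → to α d ≢ d → to α d′ ≢ d′ → minimal d ≡ minimal d′ → Orb φ ∋ d ~ d′
      minimal-reflects {d} {d′} l l′ eq = Eqv.~trans (Orb φ) (iter⇒orb φ m)
        (subst (λ x → Orb φ ∋ x ~ d′) (sym same) (Eqv.~sym (Orb φ) (iter⇒orb φ m′)))
        where
        m = proj₁ (best d)
        m′ = proj₁ (best d′)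
        same : iter (to φ) m d ≡ iter (to φ) m′ d′
        same = e-inj (iter-live m l) (iter-live m′ l′)
          (trans (sym (minimal-e l)) (trans eq (minimal-e l′)))
      split∈ : ∀ {p} → p ∈ rs → isDart G rot p ≡ true × isFaceRep G rot p ≡ true
      split∈ p∈ = ∧-true⁻ (proj₂ (∈-filter⁻ isRep? {xs = pairs n} p∈))
      rep-≤ : ∀ {p q} → p ∈ rs → q ∈ rs → Orb φ ∋ dart p ~ dart q → code G rot p ≤ code G rot q
      rep-≤ {p} {q} p∈ q∈ r with orb⇒walk (dart-live p) r
      ... | i , i< , eq = subst (λ w → code G rot p ≤ code G rot w)
            (trans (cong (walk G rot i) (sym (e-of-dart (proj₁ (split∈ p∈))))) (trans eq (e-of-dart (proj₁ (split∈ q∈)))))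
            (≤ᵇ-true⁻ (all-true⁻ {xs = upTo (n * n)} (proj₂ (split∈ p∈)) (∈-upTo⁺ i<)))

    -- Exactly one dart of each edge runs from the smaller end to the larger, as there are no loops.
    -- Two copies of the set of edges are matched with the darts by sending one copy to these darts
    -- and the other to their reversals.
    edges : 2 * # (Orb α) xs ≡ # (≡-eqv _≟_) xs
    edges = trans (cong (# (Orb α) xs +_) (ℕ.+-identityʳ _)) (ℕ.≤-antisym
        (ℕ.≤-trans (ℕ.≤-reflexive (sym (#-⊎ (Orb α) (Orb α) xs xs)))
          (#-inj S (≡-eqv _≟_) {zs} {xs} unfold unfold-into unfold-reflects))
        (ℕ.≤-trans (#-inj (≡-eqv _≟_) S {xs} {zs} fold fold-into fold-reflects)
          (ℕ.≤-reflexive (#-⊎ (Orb α) (Orb α) xs xs))))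
      where
      S = Orb α ⊎-eqv Orb α
      zs = map inj₁ xs ++ map inj₂ xs
      up : A → Set
      up d = toℕ (proj₁ (e d)) < toℕ (proj₂ (e d))
      up? : ∀ d → Dec (up d)
      up? d = toℕ (proj₁ (e d)) ℕ.<? toℕ (proj₂ (e d))
      α-up : ∀ {d} → to α d ≢ d → ¬ up d → up (to α d)
      α-up {d} l ¬up = subst (λ p → toℕ (proj₁ p) < toℕ (proj₂ p)) (sym (e-α l))
        (ℕ.≤∧≢⇒< (ℕ.≮⇒≥ ¬up) (λ eq → contradiction
          (trans (sym (e-dart l)) (trans (cong (adj G (proj₁ (e d))) (Fin.toℕ-injective eq)) (adj-irrefl G _))) λ ()))
      α-down : ∀ {d} → to α d ≢ d → up d → ¬ up (to α d)
      α-down {d} l u u′ = ℕ.<-asym u (subst (λ p → toℕ (proj₁ p) < toℕ (proj₂ p)) (e-α l) u′)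
      orient : A → A
      orient d with up? d
      ... | yes _ = d
      ... | no  _ = to α d
      orient-up : ∀ {d} → to α d ≢ d → up (orient d)
      orient-up {d} l with up? d
      ... | yes u = u
      ... | no ¬u = α-up l ¬u
      orient-live : ∀ {d} → to α d ≢ d → to α (orient d) ≢ orient d
      orient-live {d} l with up? d
      ... | yes _ = l
      ... | no  _ = α-live l
      orient-~ : ∀ d → Orb α ∋ d ~ orient d
      orient-~ d with up? d
      ... | yes _ = Eqv.~refl (Orb α)
      ... | no  _ = orb-step α d
      orb-α : ∀ {x y} → Orb α ∋ x ~ y → x ≡ y ⊎ to α x ≡ y
      orb-α = orb-least {S = λ x y → x ≡ y ⊎ to α x ≡ y} (record
        { refl  = inj₁ refl
        ; sym   = λ { (inj₁ refl) → inj₁ refl ; (inj₂ refl) → inj₂ (involutive _) }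
        ; trans = λ { (inj₁ refl) q → q ; (inj₂ refl) (inj₁ refl) → inj₂ refl
                    ; (inj₂ refl) (inj₂ refl) → inj₁ (sym (involutive _)) } }) α (λ _ → inj₂ refl)
      side : ∀ {x} → x ∈ zs → to α ([ id , id ]′ x) ≢ [ id , id ]′ x
      side x∈ with ∈-++⁻ (map inj₁ xs) x∈
      ... | inj₁ i with ∈-map⁻ inj₁ i
      ...   | _ , y∈ , refl = xs-live y∈
      side x∈ | inj₂ i with ∈-map⁻ inj₂ i
      ...   | _ , y∈ , refl = xs-live y∈
      unfold : A ⊎ A → A
      unfold = [ orient , to α ∘ orient ]′
      unfold-into : ∀ {x} → x ∈ zs → Any (unfold x ≡_) xs
      unfold-into {inj₁ _} x∈ = lose (live-xs (orient-live (side x∈))) refl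
      unfold-into {inj₂ _} x∈ = lose (live-xs (α-live (orient-live (side x∈)))) refl
      same : ∀ {x y} → orient x ≡ orient y → Orb α ∋ x ~ y
      same {x} {y} eq = ~trans (orient-~ x) (~trans (subst (rel (orient x)) eq ~refl) (~sym (orient-~ y)))
        where open Eqv (Orb α)
      clash : ∀ {x y} → to α x ≢ x → to α y ≢ y → orient x ≢ to α (orient y)
      clash l l′ eq = α-down (orient-live l′) (orient-up l′) (subst up eq (orient-up l))
      unfold-reflects : ∀ {x y} → x ∈ zs → y ∈ zs → unfold x ≡ unfold y → S ∋ x ~ y
      unfold-reflects {inj₁ _} {inj₁ _} _  _  eq = same eq
      unfold-reflects {inj₂ _} {inj₂ _} _  _  eq = same (injective α eq)
      unfold-reflects {inj₁ _} {inj₂ _} x∈ y∈ eq = clash (side x∈) (side y∈) eq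
      unfold-reflects {inj₂ _} {inj₁ _} x∈ y∈ eq = clash (side y∈) (side x∈) (sym eq)
      fold : A → A ⊎ A
      fold d with up? d
      ... | yes _ = inj₁ d
      ... | no  _ = inj₂ d
      fold-into : ∀ {d} → d ∈ xs → Any (Eqv.rel S (fold d)) zs
      fold-into {d} d∈ with up? d
      ... | yes _ = lose (∈-++⁺ˡ (∈-map⁺ inj₁ d∈)) (Eqv.~refl (Orb α))
      ... | no  _ = lose (∈-++⁺ʳ (map inj₁ xs) (∈-map⁺ inj₂ d∈)) (Eqv.~refl (Orb α))
      fold-reflects : ∀ {x y} → x ∈ xs → y ∈ xs → S ∋ fold x ~ fold y → x ≡ y
      fold-reflects {x} {y} x∈ y∈ r with up? x | up? y
      ... | yes u | yes u′ = case orb-α r of λ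
            { (inj₁ p) → p ; (inj₂ refl) → contradiction u′ (α-down (xs-live x∈) u) }
      ... | no ¬u | no ¬u′ = case orb-α r of λ
            { (inj₁ p) → p ; (inj₂ refl) → contradiction (α-up (xs-live x∈) ¬u) ¬u′ }

    faceCount≡ : faceCount G rot ≡ # (Orb φ) xs
    faceCount≡ with dartCount G rot in eq
    ... | suc _ = trans (ℕ.+-identityʳ _) (sym faceReps)
    ... | zero  = contradiction (trans darts eq) (λ none → ℕ.<-irrefl (sym none) positive)
      where
      positive : 1 ≤ # (≡-eqv _≟_) xs
      positive = #-inj ⊤-eqv (≡-eqv _≟_) {tt ∷ []} {xs} (λ _ → d₀)
        (λ _ → lose (live-xs l₀) refl) (λ _ _ _ → tt)

    private
      V = # (Orb σ) xs
      E = # (Orb α) xs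
      Φ = # (Orb φ) xs

      tight-count : (z σ + z α + z φ ≡ (V + J) + (E + J) + (Φ + J)) ×
                    (N + 2 * c σ α ≡ (2 * E + J) + 2 * (1 + J))
      tight-count =
        cong₂ _+_ (cong₂ _+_
          (count-live (Orb σ) (orb-least fixes-equiv σ (fixes-step σ isolated)))
          (count-live (Orb α) (orb-least fixes-equiv α (fixes-step α (λ _ → id)))))
          (count-live (Orb φ) (orb-least fixes-equiv φ (fixes-step φ
            (λ d f → trans (cong (to σ) f) (isolated d f))))) ,
        cong₂ (λ u v → u + 2 * v)
          (trans (count-live (≡-eqv _≟_) (λ { refl → (λ _ → refl) , (λ _ → refl) })) (cong (_+ J) (sym edges)))
          (trans (count-live (Conn σ α) (conn-least fixes-equiv σ α (fixes-step σ isolated) (fixes-step α (λ _ → id))))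
            (cong (_+ J) components))

      euler-count : (2 * n + 2 * faceCount G rot ≡ 2 * V + 2 * Φ) × (dartCount G rot + 4 ≡ 2 * E + 4)
      euler-count = cong₂ (λ u v → 2 * u + 2 * v) (sym vertices) faceCount≡ ,
        cong (_+ 4) (trans (sym darts) (sym edges))

      lhs : ∀ v e f j → 2 * ((v + j) + (e + j) + (f + j)) ≡ (2 * v + 2 * f) + (2 * e + 6 * j)
      lhs = solve-∀

      rhs : ∀ e j → 2 * ((2 * e + j) + 2 * (1 + j)) ≡ (2 * e + 4) + (2 * e + 6 * j)
      rhs = solve-∀

    euler⇒tight : 2 * n + 2 * faceCount G rot ≡ dartCount G rot + 4 → Tight σ α
    euler⇒tight eu = trans (proj₁ tight-count) (trans (ℕ.*-cancelˡ-≡ _ _ 2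
      (trans (lhs V E Φ J) (trans (cong (_+ (2 * E + 6 * J))
        (trans (sym (proj₁ euler-count)) (trans eu (proj₂ euler-count)))) (sym (rhs E J)))))
      (sym (proj₂ tight-count)))

    tight⇒euler : Tight σ α → 2 * n + 2 * faceCount G rot ≡ dartCount G rot + 4
    tight⇒euler t = trans (proj₁ euler-count) (trans (ℕ.+-cancelʳ-≡ (2 * E + 6 * J) _ _
      (trans (sym (lhs V E Φ J)) (trans (cong (2 *_)
        (trans (sym (proj₁ tight-count)) (trans t (proj₂ tight-count)))) (rhs E J))))
      (sym (proj₂ euler-count)))

==-true⁺ : ∀ {n} {u v : Fin n} → u ≡ v → (u == v) ≡ true
==-true⁺ {u = u} refl with u Fin.≟ u
... | yes _ = refl
... | no ¬p = contradiction refl ¬p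

==-true⁻ : ∀ {n} {u v : Fin n} → (u == v) ≡ true → u ≡ v
==-true⁻ {u = u} {v} eq with u Fin.≟ v
... | yes p = p

onFace⁺ : ∀ {n} (G : Graph n) rot p i {w} → i < n * n → proj₁ (walk G rot i p) ≡ w → onFace G rot p w ≡ true
onFace⁺ G rot p i i< eq = any-true⁺ {x = i} (∈-upTo⁺ i<) (==-true⁺ eq)

onFace⁻ : ∀ {n} (G : Graph n) rot p {w} → onFace G rot p w ≡ true → ∃[ i ] proj₁ (walk G rot i p) ≡ w
onFace⁻ {n} G rot p on with any-true⁻ {xs = upTo (n * n)} on
... | i , _ , eq = i , ==-true⁻ eq

bool-ext : ∀ {a b} → (a ≡ true → b ≡ true) → (b ≡ true → a ≡ true) → a ≡ b
bool-ext {true}  {b}     f _ = sym (f refl)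
bool-ext {false} {false} _ _ = refl
bool-ext {false} {true}  _ g = g refl

Reach-trans : ∀ {n} {G : Graph n} {u v w} → Reach G u v → Reach G v w → Reach G u w
Reach-trans here       r = r
Reach-trans (step a p) r = step a (Reach-trans p r)

Reach-sym : ∀ {n} {G : Graph n} {u v} → Reach G u v → Reach G v u
Reach-sym here = here
Reach-sym {G = G} (step {u} {w} a p) = Reach-trans (Reach-sym p) (step (trans (adj-sym G w u) a) here)

Reach-isEquivalence : ∀ {n} (G : Graph n) → IsEquivalence (Reach G)
Reach-isEquivalence G = record { refl = here ; sym = Reach-sym ; trans = Reach-trans }

-- The permutations of a plane graph

module DartPerms {n} (H : PlaneGraph n) where
  private G = graph H
  open Orbits (finitePairs n) public

  dart? : ∀ (u v : Fin n) → Dec (adj G u v ≡ true)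
  dart? u v = Bool._≟_ (adj G u v) true

  next : Fin n × Fin n → Fin n × Fin n
  next (u , v) with dart? u v
  ... | yes _ = u , rot H u v
  ... | no  _ = u , v

  flip : Fin n × Fin n → Fin n × Fin n
  flip (u , v) with dart? u v
  ... | yes _ = v , u
  ... | no  _ = u , v

  next-dart : ∀ {u v} → adj G u v ≡ true → next (u , v) ≡ (u , rot H u v)
  next-dart {u} {v} a with dart? u v
  ... | yes _ = refl
  ... | no ¬a = contradiction a ¬a

  flip-dart : ∀ {u v} → adj G u v ≡ true → flip (u , v) ≡ (v , u)
  flip-dart {u} {v} a with dart? u v
  ... | yes _ = refl
  ... | no ¬a = contradiction a ¬a

  next-other : ∀ {u v} → adj G u v ≢ true → next (u , v) ≡ (u , v)
  next-other {u} {v} ¬a with dart? u v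
  ... | yes a = contradiction a ¬a
  ... | no  _ = refl

  next-proj₁ : ∀ d → proj₁ (next d) ≡ proj₁ d
  next-proj₁ (u , v) with dart? u v
  ... | yes _ = refl
  ... | no  _ = refl

  adj-flip : ∀ {u v} → adj G u v ≡ true → adj G v u ≡ true
  adj-flip {u} {v} = trans (adj-sym G v u)

  -- With `w` the common image, `v` and `v′` are the iterates `j` and `j′` of `w`, so `suc j` and
  -- `suc j′` are both periods of `w`. Adding the other's period to each exponent gives the same
  -- total.
  rot-injective : ∀ {u v v′} → adj G u v ≡ true → adj G u v′ ≡ true → rot H u v ≡ rot H u v′ → v ≡ v′
  rot-injective {u} {v} {v′} a a′ eq with rot-cycle H u (rot H u v) v (rot-adj H u v a) a
                                        | rot-cycle H u (rot H u v) v′ (rot-adj H u v a) a′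
  ... | j , p | j′ , p′ = begin
    v                                   ≡⟨ p ⟨
    iter ρ j w                          ≡⟨ cong (iter ρ j) (trans (cong ρ p′) (sym eq)) ⟨
    iter ρ j (iter ρ (suc j′) w)        ≡⟨ iter-+ ρ j (suc j′) w ⟨
    iter ρ (j + suc j′) w               ≡⟨ cong (λ i → iter ρ i w) (arith j j′) ⟩
    iter ρ (j′ + suc j) w               ≡⟨ iter-+ ρ j′ (suc j) w ⟩
    iter ρ j′ (iter ρ (suc j) w)        ≡⟨ cong (iter ρ j′) (cong ρ p) ⟩
    iter ρ j′ w                         ≡⟨ p′ ⟩
    v′                                  ∎
    where
    open ≡-Reasoning
    ρ = rot H u
    w = rot H u v
    arith : ∀ i j → i + suc j ≡ j + suc i
    arith = solve-∀

  next-injective : ∀ {d d′} → next d ≡ next d′ → d ≡ d′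
  next-injective {u , v} {u′ , v′} eq with dart? u v | dart? u′ v′
  ... | no  _ | no  _  = eq
  ... | yes a | no ¬a′ = contradiction (subst (λ d → isDart G (rot H) d ≡ true) eq (rot-adj H u v a)) ¬a′
  ... | no ¬a | yes a′ = contradiction (subst (λ d → isDart G (rot H) d ≡ true) (sym eq) (rot-adj H u′ v′ a′)) ¬a
  ... | yes a | yes a′ with Product.,-injective eq
  ...   | refl , r = cong (u ,_) (rot-injective a a′ r)

  flip-involutive : ∀ d → flip (flip d) ≡ d
  flip-involutive (u , v) with dart? u v in eq
  ... | yes a = flip-dart (adj-flip a)
  ... | no ¬a rewrite eq = refl

  σ₀ α₀ : Perm (Fin n × Fin n)
  σ₀ = fromInjective next next-injective
  α₀ = record { to = flip ; from = flip ; to-from = flip-involutive ; from-to = flip-involutive }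

  live⇒adj : ∀ {d} → flip d ≢ d → isDart G (rot H) d ≡ true
  live⇒adj {u , v} l with dart? u v
  ... | yes a = a
  ... | no  _ = contradiction refl l

  adj⇒≢ : ∀ {u v} → adj G u v ≡ true → u ≢ v
  adj⇒≢ {u} a refl = contradiction (trans (sym a) (adj-irrefl G u)) λ ()

  adj⇒live : ∀ {u v} → adj G u v ≡ true → flip (u , v) ≢ (u , v)
  adj⇒live {u} {v} a eq = adj⇒≢ a (sym (cong proj₁ (trans (sym (flip-dart a)) eq)))

  iter-next : ∀ i {u v} → adj G u v ≡ true →
              iter next i (u , v) ≡ (u , iter (rot H u) i v) × adj G u (iter (rot H u) i v) ≡ true
  iter-next zero    a = refl , a
  iter-next (suc i) a with iter-next i a
  ... | p , a′ = trans (cong next p) (next-dart a′) , rot-adj H _ _ a′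

  sameVertex : ∀ {u v v′} → adj G u v ≡ true → adj G u v′ ≡ true → Orb σ₀ ∋ (u , v) ~ (u , v′)
  sameVertex {u} {v} {v′} a a′ with rot-cycle H u v v′ a a′
  ... | i , p = subst (Orb σ₀ ∋ (u , v) ~_)
    (trans (proj₁ (iter-next i a)) (cong (u ,_) p)) (iter⇒orb σ₀ i)

  represents : Represents (finitePairs n) G (rot H) σ₀ α₀ id
  represents = record
    { involutive = flip-involutive
    ; isolated   = λ { (u , v) eq → next-other (λ a → adj⇒live a eq) }
    ; e-dart     = λ {d} → live⇒adj {d}
    ; e-inj      = λ _ _ → id
    ; e-surj     = λ a → _ , adj⇒live a , refl
    ; e-α        = λ l → flip-dart (live⇒adj l)
    ; e-face     = λ l → sym (trans (cong next (flip-dart (live⇒adj l))) (next-dart (adj-flip (live⇒adj l))))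
    ; e-vertex   = λ { {u , _} l l′ refl → sameVertex (live⇒adj l) (live⇒adj l′) } }

  open Genus (finitePairs n)

  tight₀ : ∀ {u₀ v₀} → adj G u₀ v₀ ≡ true → Tight σ₀ α₀
  tight₀ {u₀} {v₀} a₀ = euler⇒tight (euler H)
    where
    open Eqv (Conn σ₀ α₀)
    along : ∀ {u u′ v v′} → Reach G u u′ → adj G u v ≡ true → adj G u′ v′ ≡ true → rel (u , v) (u′ , v′)
    along here                   a a′ = orb⊆connˡ σ₀ α₀ (sameVertex a a′)
    along (step {u} {w} b reach) a a′ =
      ~trans (orb⊆connˡ σ₀ α₀ (sameVertex a b))
      (~trans (subst (rel (u , w)) (flip-dart b) (conn-stepʳ σ₀ α₀ (u , w))) (along reach (adj-flip b) a′))
    covered : ∀ u → ∃[ d ] flip d ≢ d × proj₁ d ≡ u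
    covered u with connected H u u₀
    ... | here     = (u , v₀) , adj⇒live a₀ , refl
    ... | step b _ = _ , adj⇒live b , refl
    open Representation (finitePairs n) represents
    joined : ∀ {d d′} → flip d ≢ d → flip d′ ≢ d′ → rel d d′
    joined {u , _} {u′ , _} l l′ = along (connected H u u′) (live⇒adj l) (live⇒adj l′)
    open Counting (u₀ , v₀) (adj⇒live a₀) joined covered

-- From simple connected maps back to plane graphs

module SimpleMap {A : Set} (F : Finite A) {k : ℕ} {σ α : Perm A} (g : Maps.Good F k σ α)
  (d₀ : A) (l₀ : to α d₀ ≢ d₀)
  (conn : ∀ {d d′} → to α d ≢ d → to α d′ ≢ d′ → Orbits.Conn F σ α ∋ d ~ d′)
  (simple : ∀ {d d′} → to α d ≢ d → to α d′ ≢ d′ → Orbits.Orb F σ ∋ d ~ d′ →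
            Orbits.Orb F σ ∋ to α d ~ to α d′ → d ≡ d′) where
  open Finite F
  open Orbits F
  open Genus F
  open Maps.Good g
  open Eqv (Orb σ)

  live? : ∀ d → Dec (to α d ≢ d)
  live? d = ¬? (to α d ≟ d)

  α-live : ∀ {d} → to α d ≢ d → to α (to α d) ≢ to α d
  α-live l eq = l (injective α eq)

  σ-live : ∀ {d} → to α d ≢ d → to α (to σ d) ≢ to σ d
  σ-live {d} l eq = l (subst (λ x → to α x ≡ x) (injective σ (isolated (to σ d) eq)) eq)

  xs : List A
  xs = filter live? enum

  n : ℕ
  n = # (Orb σ) xs

  vertexRep : Fin n → A
  vertexRep = lookup (reps (Orb σ) xs)

  vertexRep-live : ∀ i → to α (vertexRep i) ≢ vertexRep i
  vertexRep-live i = proj₂ (∈-filter⁻ live? {xs = enum}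
    (reps-⊆ (Orb σ) xs (∈-lookup {xs = reps (Orb σ) xs} i)))

  represented : ∀ {d} → to α d ≢ d → Any (rel d) (reps (Orb σ) xs)
  represented l = reps-complete (Orb σ) xs (∈-filter⁺ live? (∈enum _) l)

  vt : A → Fin n
  vt d with any? (rel? d) (reps (Orb σ) xs)
  ... | yes a = index a
  -- A default for dead darts, which lie at no vertex of the graph.
  ... | no  _ = index (represented l₀)

  vt-rep : ∀ {d} → to α d ≢ d → rel d (vertexRep (vt d))
  vt-rep {d} l with any? (rel? d) (reps (Orb σ) xs)
  ... | yes a = Any.lookup-index a
  ... | no ¬a = contradiction (represented l) ¬a

  vt⇒~ : ∀ {d d′} → to α d ≢ d → to α d′ ≢ d′ → vt d ≡ vt d′ → rel d d′
  vt⇒~ {d} l l′ eq = ~trans (subst (λ i → rel d (vertexRep i)) eq (vt-rep l)) (~sym (vt-rep l′))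

  ~⇒vt : ∀ {d d′} → to α d ≢ d → to α d′ ≢ d′ → rel d d′ → vt d ≡ vt d′
  ~⇒vt l l′ r = reps-distinct (Orb σ) xs (~trans (~sym (vt-rep l)) (~trans r (vt-rep l′)))

  vt-of-rep : ∀ i → vt (vertexRep i) ≡ i
  vt-of-rep i = reps-distinct (Orb σ) xs (~sym (vt-rep (vertexRep-live i)))

  vt-σ : ∀ d → vt (to σ d) ≡ vt d
  vt-σ d with to α d ≟ d
  ... | yes f = cong vt (isolated d f)
  ... | no  l = sym (~⇒vt l (σ-live l) (orb-step σ d))

  ends : A → Fin n × Fin n
  ends d = vt d , vt (to α d)

  Edge : Fin n × Fin n → Set
  Edge p = Any (λ d → to α d ≢ d × ends d ≡ p) enum

  edge? : ∀ p → Dec (Edge p)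
  edge? p = any? (λ d → live? d ×-dec (ends d ≟ᵖ p)) enum

  edge : ∀ {d} → to α d ≢ d → Edge (ends d)
  edge l = lose (∈enum _) (l , refl)

  adjacent : Fin n → Fin n → Bool
  adjacent u v = isYes (edge? (u , v))

  adjacent⁺ : ∀ {u v} → Edge (u , v) → adjacent u v ≡ true
  adjacent⁺ {u} {v} a with edge? (u , v)
  ... | yes _ = refl
  ... | no ¬a = contradiction a ¬a

  adjacent⁻ : ∀ {u v} → adjacent u v ≡ true → ∃[ d ] to α d ≢ d × ends d ≡ (u , v)
  adjacent⁻ {u} {v} eq with edge? (u , v)
  ... | yes a = Any.satisfied a

  ends-α : ∀ d → ends (to α d) ≡ (vt (to α d) , vt d)
  ends-α d = cong (λ x → vt (to α d) , vt x) (involutive d)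

  adjacent-flip : ∀ {u v} → adjacent u v ≡ true → adjacent v u ≡ true
  adjacent-flip eq with adjacent⁻ eq
  ... | d , l , refl = adjacent⁺ (subst Edge (ends-α d) (edge (α-live l)))

  G : Graph n
  G = record
    { adj    = adjacent
    ; sym    = λ u v → bool-ext adjacent-flip adjacent-flip
    ; irrefl = irr }
    where
    irr : ∀ u → adjacent u u ≡ false
    irr u with adjacent u u in eq
    ... | false = refl
    ... | true with adjacent⁻ eq
    ...   | d , l , p = contradiction
            (vt⇒~ l (α-live l) (trans (cong proj₁ p) (sym (cong proj₂ p)))) (loopless d l)

  rotation : Fin n → Fin n → Fin n
  rotation u v with edge? (u , v)
  ... | yes a = vt (to α (to σ (proj₁ (Any.satisfied a))))
  ... | no  _ = v

  -- Here the absence of parallel edges enters: it makes `rotation`, which picks some dart with the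
  -- given ends, well defined.
  ends-injective : ∀ {d d′} → to α d ≢ d → to α d′ ≢ d′ → ends d ≡ ends d′ → d ≡ d′
  ends-injective l l′ eq = simple l l′ (vt⇒~ l l′ (cong proj₁ eq)) (vt⇒~ (α-live l) (α-live l′) (cong proj₂ eq))

  rotation-ends : ∀ {d} → to α d ≢ d → rotation (vt d) (vt (to α d)) ≡ vt (to α (to σ d))
  rotation-ends {d} l with edge? (ends d)
  ... | no ¬a = contradiction (edge l) ¬a
  ... | yes a with Any.satisfied a
  ...   | d′ , l′ , eq = cong (λ x → vt (to α (to σ x))) (ends-injective l′ l eq)

  ends-σ : ∀ {d} → to α d ≢ d → ends (to σ d) ≡ (vt d , rotation (vt d) (vt (to α d)))
  ends-σ {d} l = cong₂ _,_ (vt-σ d) (sym (rotation-ends l))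

  iter-rotation : ∀ i {d} → to α d ≢ d →
                  iter (rotation (vt d)) i (vt (to α d)) ≡ vt (to α (iter (to σ) i d)) ×
                  to α (iter (to σ) i d) ≢ iter (to σ) i d × vt (iter (to σ) i d) ≡ vt d
  iter-rotation zero    l = refl , l , refl
  iter-rotation (suc i) {d} l with iter-rotation i l
  ... | p , l′ , v = trans (cong (rotation (vt d)) p)
      (trans (cong (λ u → rotation u (vt (to α (iter (to σ) i d)))) (sym v)) (rotation-ends l′)) ,
      σ-live l′ , trans (vt-σ _) v

  represents : Represents F G rotation σ α ends
  represents = record
    { involutive = involutive
    ; isolated   = isolated
    ; e-dart     = λ l → adjacent⁺ (edge l)
    ; e-inj      = ends-injective
    ; e-surj     = adjacent⁻
    ; e-α        = λ {d} _ → ends-α d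
    ; e-face     = λ {d} l → sym (trans (ends-σ (α-live l))
                     (cong₂ (λ x y → x , rotation x y) refl (cong vt (involutive d))))
    ; e-vertex   = vt⇒~ }

  open Representation F represents using (face-period; orb⇒walk; walk-e; iter-live)
  open Representation.Counting F represents d₀ l₀ conn
    (λ u → vertexRep u , vertexRep-live u , vt-of-rep u) using (tight⇒euler)

  H : PlaneGraph n
  H = record
    { graph     = G
    ; rot       = rotation
    ; rot-adj   = rot-adj′
    ; rot-cycle = rot-cycle′
    ; connected = λ u v → subst₂ (Reach G) (vt-of-rep u) (vt-of-rep v)
        (reach (conn (vertexRep-live u) (vertexRep-live v)))
    ; euler     = tight⇒euler tight }
    where
    rot-adj′ : ∀ u v → adjacent u v ≡ true → adjacent u (rotation u v) ≡ true
    rot-adj′ u v eq with adjacent⁻ eq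
    ... | d , l , refl = adjacent⁺ (subst Edge (ends-σ l) (edge (σ-live l)))
    rot-cycle′ : ∀ u v w → adjacent u v ≡ true → adjacent u w ≡ true → ∃[ i ] iter (rotation u) i v ≡ w
    rot-cycle′ u v w a b with adjacent⁻ a | adjacent⁻ b
    ... | d , l , refl | d′ , l′ , p with orb⇒iter σ (vt⇒~ l l′ (sym (cong proj₁ p)))
    ...   | i , q = i , trans (proj₁ (iter-rotation i l)) (trans (cong (vt ∘ to α) q) (cong proj₂ p))
    reach : ∀ {d d′} → Conn σ α ∋ d ~ d′ → Reach G (vt d) (vt d′)
    reach = conn-least {S = λ x y → Reach G (vt x) (vt y)} (On.isEquivalence vt (Reach-isEquivalence G)) σ α
      (λ d → subst (Reach G (vt d)) (sym (vt-σ d)) here) along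
      where
      along : ∀ d → Reach G (vt d) (vt (to α d))
      along d with to α d ≟ d
      ... | yes f = subst (λ x → Reach G (vt d) (vt x)) (sym f) here
      ... | no  l = step (adjacent⁺ (edge l)) here

  -- `faceSize` counts distinct vertices, and all of them occur within one period of the face walk.
  faces-short : MaxFaceSizeAtMost H k
  faces-short u v eq with adjacent⁻ eq
  ... | d , l , refl with short d
  ...   | j , j≤k , p = begin
    length ws                            ≡⟨ #-unique Fin._≟_ (Unique.filter⁺ on? (Unique.allFin⁺ n)) ⟨
    # (≡-eqv Fin._≟_) ws                 ≤⟨ #-inj (≡-eqv Fin._≟_) (≡-eqv Fin._≟_) id listed (λ _ _ → id) ⟩
    # (≡-eqv Fin._≟_) (map at (upTo (suc j))) ≤⟨ #≤length (≡-eqv Fin._≟_) (map at (upTo (suc j))) ⟩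
    length (map at (upTo (suc j)))       ≡⟨ trans (List.length-map at (upTo (suc j))) (List.length-upTo (suc j)) ⟩
    suc j                                ≤⟨ j≤k ⟩
    k                                    ∎
    where
    open ℕ.≤-Reasoning
    on? : ∀ (w : Fin n) → Dec (onFace G rotation (ends d) w ≡ true)
    on? w = Bool._≟_ (onFace G rotation (ends d) w) true
    ws : List (Fin n)
    ws = filter on? (allFin n)
    at : ℕ → Fin n
    at i = vt (iter (to (σ ∙ α)) i d)
    listed : ∀ {w} → w ∈ ws → Any (w ≡_) (map at (upTo (suc j)))
    listed w∈ with onFace⁻ G rotation (ends d) (proj₂ (∈-filter⁻ on? {xs = allFin n} w∈))
    ... | i , q = lose (∈-map⁺ at (∈-upTo⁺ (m%n<n i (suc j))))
          (trans (sym q) (trans (cong proj₁ (walk-e i l)) (cong vt (iter-mod (to (σ ∙ α)) p i))))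

  colouring : ∀ {m} → CyclicColourable H m → Maps.Colouring F k m σ α
  colouring (c , cyclic) = record
    { col      = c ∘ vt
    ; onVertex = λ d → cong c (vt-σ d)
    ; faces    = face }
    where
    face : ∀ {d d′} → Orb (σ ∙ α) ∋ d ~ d′ → ¬ rel d d′ → c (vt d) ≢ c (vt d′)
    face {d} {d′} r ≁ with to α d ≟ d | orb⇒iter (σ ∙ α) r
    ... | yes f | i , eq = contradiction (subst (rel d)
            (trans (sym (iter-closed (_≡ d) (λ { refl → trans (cong (to σ) f) (isolated d f) }) i refl)) eq) ~refl) ≁
    ... | no  l | i , eq = cyclic (vt d) (vt (to α d)) (adjacent⁺ (edge l)) (vt d) (vt d′)
            on-d on-d′ (≁ ∘ vt⇒~ l (subst (λ x → to α x ≢ x) eq (iter-live i l)))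
      where
      on-d : onFace G rotation (ends d) (vt d) ≡ true
      on-d = onFace⁺ G rotation (ends d) 0 (ℕ.≤-trans (s≤s z≤n) (proj₁ (proj₂ (face-period l)))) refl
      on-d′ : onFace G rotation (ends d) (vt d′) ≡ true
      on-d′ = let i , i< , w = orb⇒walk l r in onFace⁺ G rotation (ends d) i i< (cong proj₁ w)

#-equiv : ∀ {A B : Set} (R : Eqv A) (S : Eqv B) {xs ys} → (∀ x → x ∈ xs) → (∀ y → y ∈ ys) →
          (pr : A → B) (sec : B → A) →
          (∀ {x y} → R ∋ x ~ y → S ∋ pr x ~ pr y) → (∀ {x y} → S ∋ x ~ y → R ∋ sec x ~ sec y) →
          (∀ x → R ∋ x ~ sec (pr x)) → (∀ y → S ∋ y ~ pr (sec y)) → # R xs ≡ # S ys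
#-equiv R S {xs} {ys} ∈xs ∈ys pr sec pr-cong sec-cong retract section = ℕ.≤-antisym
  (#-inj R S {xs} {ys} pr (λ _ → lose (∈ys _) (Eqv.~refl S))
    (λ {x} {y} _ _ r → Eqv.~trans R (retract x) (Eqv.~trans R (sec-cong r) (Eqv.~sym R (retract y)))))
  (#-inj S R {ys} {xs} sec (λ _ → lose (∈xs _) (Eqv.~refl R))
    (λ {x} {y} _ _ r → Eqv.~trans S (section x) (Eqv.~trans S (pr-cong r) (Eqv.~sym S (section y)))))

finite-⊎ : ∀ {A B : Set} → Finite A → Finite B → Finite (A ⊎ B)
finite-⊎ F G = record
  { _≟_   = Sum.≡-dec F._≟_ G._≟_
  ; enum  = map inj₁ F.enum ++ map inj₂ G.enum
  ; ∈enum = λ { (inj₁ x) → ∈-++⁺ˡ (∈-map⁺ inj₁ (F.∈enum x))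
              ; (inj₂ y) → ∈-++⁺ʳ (map inj₁ F.enum) (∈-map⁺ inj₂ (G.∈enum y)) } }
  where
  module F = Finite F
  module G = Finite G

CyclicBound : ℕ → ℕ → Set
CyclicBound k m = ∀ {n} (H : PlaneGraph n) → MaxFaceSizeAtMost H k → CyclicColourable H m

-- A planar hypermap (vertices = cycles of p, hyperedges = cycles of q) becomes a planar map: every
-- hyperedge becomes a face, and the faces of the hypermap, the cycles of g = p ∙ q, become new
-- vertices joined to their corners.  x⁺ and x⁻ are the two darts of the polygon side from x to q x;
-- xˢ and xᶻ are those of a spoke, at the vertex of x and at the new vertex.
module Inflation {E : Set} (F : Finite E) (p q : Perm E) where
  open Finite F
  open Orbits F
  open Genus F

  Darts : Set
  Darts = (E ⊎ E) ⊎ (E ⊎ E)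

  pattern _⁺ x = inj₁ (inj₁ x)
  pattern _⁻ x = inj₁ (inj₂ x)
  pattern _ˢ x = inj₂ (inj₁ x)
  pattern _ᶻ x = inj₂ (inj₂ x)

  F′ : Finite Darts
  F′ = finite-⊎ (finite-⊎ F F) (finite-⊎ F F)

  module O′ = Orbits F′
  module G′ = Genus F′

  g : Perm E
  g = p ∙ q

  α σ : Perm Darts
  α = record { to = flip ; from = flip ; to-from = flip² ; from-to = flip² }
    where
    flip : Darts → Darts
    flip (x ⁺) = x ⁻
    flip (x ⁻) = x ⁺
    flip (x ˢ) = x ᶻ
    flip (x ᶻ) = x ˢ
    flip² : ∀ d → flip (flip d) ≡ d
    flip² (x ⁺) = refl
    flip² (x ⁻) = refl
    flip² (x ˢ) = refl
    flip² (x ᶻ) = refl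
  -- Around an old vertex the order is x⁺, xˢ, (g⁻¹ x)⁻ and then (p⁻¹ x)⁺, because q (g⁻¹ x) = p⁻¹
  -- x; around a new vertex the spokes follow `g`.
  σ = record
    { to      = λ { (x ⁺) → x ˢ ; (x ˢ) → from g x ⁻ ; (x ⁻) → to q x ⁺ ; (x ᶻ) → to g x ᶻ }
    ; from    = λ { (x ˢ) → x ⁺ ; (x ⁻) → to g x ˢ ; (x ⁺) → from q x ⁻ ; (x ᶻ) → from g x ᶻ }
    ; to-from = λ { (x ⁺) → cong _⁺ (to-from q x) ; (x ˢ) → refl
                  ; (x ⁻) → cong _⁻ (from-to g x) ; (x ᶻ) → cong _ᶻ (to-from g x) }
    ; from-to = λ { (x ⁺) → refl ; (x ˢ) → cong _ˢ (to-from g x)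
                  ; (x ⁻) → cong _⁻ (from-to q x) ; (x ᶻ) → cong _ᶻ (from-to g x) } }

  private
    module σ~ = Eqv (O′.Orb σ)
    module φ~ = Eqv (O′.Orb (σ ∙ α))
    module α~ = Eqv (O′.Orb α)
    module κ~ = Eqv (O′.Conn σ α)
    module p~ = Eqv (Orb p)

  g⁻¹-step : ∀ R → (∀ x → R ∋ x ~ to g x) → ∀ x → R ∋ x ~ from g x
  g⁻¹-step R h x = Eqv.~sym R (subst (R ∋ from g x ~_) (to-from g x) (h (from g x)))

  VertexSetoid : Eqv (E ⊎ E)
  VertexSetoid = Orb p ⊎-eqv Orb g

  vertexOf : Darts → E ⊎ E
  vertexOf (x ⁺) = inj₁ x
  vertexOf (x ˢ) = inj₁ x
  vertexOf (x ⁻) = inj₁ (to g x)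
  vertexOf (x ᶻ) = inj₂ x

  vertexOf-cong : ∀ {d d′} → O′.Orb σ ∋ d ~ d′ → VertexSetoid ∋ vertexOf d ~ vertexOf d′
  vertexOf-cong = O′.orb-least (On.isEquivalence vertexOf (Eqv.equiv VertexSetoid)) σ
    λ { (x ⁺) → p~.~refl
      ; (x ˢ) → subst (p~.rel x) (sym (to-from g x)) p~.~refl
      ; (x ⁻) → p~.~sym (orb-step p (to q x))
      ; (x ᶻ) → orb-step g x }

  ⁺-p : ∀ x → O′.Orb σ ∋ x ⁺ ~ to p x ⁺
  ⁺-p x = σ~.~sym (σ~.~trans (O′.orb-step σ (to p x ⁺)) (σ~.~trans (O′.orb-step σ (to p x ˢ))
    (subst (λ y → O′.Orb σ ∋ from g (to p x) ⁻ ~ y ⁺)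
      (trans (to-from q _) (from-to p x)) (O′.orb-step σ (from g (to p x) ⁻)))))

  ⁺-cong : ∀ {x y} → Orb p ∋ x ~ y → O′.Orb σ ∋ x ⁺ ~ y ⁺
  ⁺-cong = orb-least (On.isEquivalence _⁺ σ~.equiv) p ⁺-p

  ⁺-face : ∀ {x y} → Orb q ∋ x ~ y → O′.Orb (σ ∙ α) ∋ x ⁺ ~ y ⁺
  ⁺-face = orb-least (On.isEquivalence _⁺ φ~.equiv) q (λ x → O′.orb-step (σ ∙ α) (x ⁺))

  private
    ∈E⊎E : ∀ y → y ∈ Finite.enum (finite-⊎ F F)
    ∈E⊎E = Finite.∈enum (finite-⊎ F F)

    _≡⊎≡_ : Eqv (E ⊎ E)
    _≡⊎≡_ = ≡-eqv _≟_ ⊎-eqv ≡-eqv _≟_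

    z-σ : O′.z σ ≡ z p + z g
    z-σ = trans (#-equiv (O′.Orb σ) VertexSetoid (Finite.∈enum F′) ∈E⊎E vertexOf sec vertexOf-cong
        (λ { {inj₁ _} {inj₁ _} → ⁺-cong
           ; {inj₂ _} {inj₂ _} → orb-least (On.isEquivalence _ᶻ σ~.equiv) g (λ x → O′.orb-step σ (x ᶻ)) })
        (λ { (x ⁺) → σ~.~refl
           ; (x ˢ) → σ~.~sym (O′.orb-step σ (x ⁺))
           ; (x ⁻) → σ~.~trans (O′.orb-step σ (x ⁻)) (⁺-p (to q x))
           ; (x ᶻ) → σ~.~refl })
        (λ { (inj₁ _) → Eqv.~refl (Orb p) ; (inj₂ _) → Eqv.~refl (Orb g) }))
      (#-⊎ (Orb p) (Orb g) enum enum)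
      where
      sec : E ⊎ E → Darts
      sec (inj₁ x) = x ⁺
      sec (inj₂ x) = x ᶻ

    z-α : O′.z α ≡ N + N
    z-α = trans (#-equiv (O′.Orb α) _≡⊎≡_ (Finite.∈enum F′) ∈E⊎E pr sec
        (O′.orb-least (On.isEquivalence pr (Eqv.equiv _≡⊎≡_)) α
          (λ { (_ ⁺) → refl ; (_ ⁻) → refl ; (_ ˢ) → refl ; (_ ᶻ) → refl }))
        (λ { {inj₁ _} {inj₁ _} refl → α~.~refl ; {inj₂ _} {inj₂ _} refl → α~.~refl })
        (λ { (x ⁺) → α~.~refl ; (x ⁻) → O′.orb-step α (x ⁻)
           ; (x ˢ) → α~.~refl ; (x ᶻ) → O′.orb-step α (x ᶻ) })
        (λ { (inj₁ _) → refl ; (inj₂ _) → refl }))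
      (#-⊎ (≡-eqv _≟_) (≡-eqv _≟_) enum enum)
      where
      pr : Darts → E ⊎ E
      pr (x ⁺) = inj₁ x
      pr (x ⁻) = inj₁ x
      pr (x ˢ) = inj₂ x
      pr (x ᶻ) = inj₂ x
      sec : E ⊎ E → Darts
      sec (inj₁ x) = x ⁺
      sec (inj₂ x) = x ˢ

    z-φ : O′.z (σ ∙ α) ≡ z q + N
    z-φ = trans (#-equiv (O′.Orb (σ ∙ α)) S (Finite.∈enum F′) ∈E⊎E pr sec
        (O′.orb-least (On.isEquivalence pr (Eqv.equiv S)) (σ ∙ α)
          (λ { (x ⁺) → orb-step q x ; (x ⁻) → refl ; (x ˢ) → sym (from-to g x) ; (x ᶻ) → refl }))
        (λ { {inj₁ _} {inj₁ _} → ⁺-face ; {inj₂ _} {inj₂ _} refl → φ~.~refl })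
        (λ { (x ⁺) → φ~.~refl ; (x ⁻) → φ~.~refl
           ; (x ˢ) → φ~.~sym (O′.orb-step (σ ∙ α) (x ⁻)) ; (x ᶻ) → O′.orb-step (σ ∙ α) (x ᶻ) })
        (λ { (inj₁ _) → Eqv.~refl (Orb q) ; (inj₂ _) → refl }))
      (#-⊎ (Orb q) (≡-eqv _≟_) enum enum)
      where
      S : Eqv (E ⊎ E)
      S = Orb q ⊎-eqv ≡-eqv _≟_
      pr : Darts → E ⊎ E
      pr (x ⁺) = inj₁ x
      pr (x ⁻) = inj₂ x
      pr (x ˢ) = inj₂ x
      pr (x ᶻ) = inj₂ (from g x)
      sec : E ⊎ E → Darts
      sec (inj₁ x) = x ⁺
      sec (inj₂ x) = x ⁻

    N′ : O′.N ≡ (N + N) + (N + N)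
    N′ = trans (#-equiv (≡-eqv (Finite._≟_ F′)) S (Finite.∈enum F′) (Finite.∈enum F′) id id
        (λ { {d} refl → Eqv.~refl S {d} }) S⇒≡ (λ _ → refl) (λ d → Eqv.~refl S {d}))
      (trans (#-⊎ _≡⊎≡_ _≡⊎≡_ enum² enum²) (cong₂ _+_ N² N²))
      where
      S : Eqv Darts
      S = _≡⊎≡_ ⊎-eqv _≡⊎≡_
      enum² = map inj₁ enum ++ map inj₂ enum
      N² = #-⊎ (≡-eqv _≟_) (≡-eqv _≟_) enum enum
      S⇒≡ : ∀ {d d′} → S ∋ d ~ d′ → d ≡ d′
      S⇒≡ {_ ⁺} {_ ⁺} refl = refl
      S⇒≡ {_ ⁻} {_ ⁻} refl = refl
      S⇒≡ {_ ˢ} {_ ˢ} refl = refl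
      S⇒≡ {_ ᶻ} {_ ᶻ} refl = refl

    c′ : O′.c σ α ≡ c p q
    c′ = #-equiv (O′.Conn σ α) (Conn p q) (Finite.∈enum F′) ∈enum pr _⁺
      (O′.conn-least (On.isEquivalence pr (Eqv.equiv (Conn p q))) σ α
        (λ { (x ⁺) → ~refl ; (x ˢ) → g⁻¹-step (Conn p q) g-step x
           ; (x ⁻) → conn-stepʳ p q x ; (x ᶻ) → g-step x })
        (λ { (x ⁺) → ~refl ; (x ⁻) → ~refl ; (x ˢ) → ~refl ; (x ᶻ) → ~refl }))
      (conn-least (On.isEquivalence _⁺ κ~.equiv) p q
        (λ x → O′.orb⊆connˡ σ α (⁺-p x))
        (λ x → κ~.~trans (O′.conn-stepʳ σ α (x ⁺)) (O′.conn-stepˡ σ α (x ⁻))))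
      (λ { (x ⁺) → κ~.~refl ; (x ⁻) → O′.conn-stepʳ σ α (x ⁻)
         ; (x ˢ) → κ~.~sym (O′.conn-stepˡ σ α (x ⁺))
         ; (x ᶻ) → κ~.~trans (O′.conn-stepʳ σ α (x ᶻ)) (κ~.~sym (O′.conn-stepˡ σ α (x ⁺))) })
      (λ _ → ~refl)
      where
      open Eqv (Conn p q)
      pr : Darts → E
      pr (x ⁺) = x
      pr (x ⁻) = x
      pr (x ˢ) = x
      pr (x ᶻ) = x
      g-step : ∀ x → rel x (to g x)
      g-step x = ~trans (conn-stepʳ p q x) (conn-stepˡ p q (to q x))

  -- The inflated map has z p + z g vertices, 2N edges, z q + N faces and 4N darts, and as many
  -- components as before; both sides of the equality grow by 3N.
  inflate-tight : Tight p q → G′.Tight σ α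
  inflate-tight t = begin
    O′.z σ + O′.z α + O′.z (σ ∙ α)          ≡⟨ cong₂ _+_ (cong₂ _+_ z-σ z-α) z-φ ⟩
    (z p + z g) + (N + N) + (z q + N)       ≡⟨ arith₁ (z p) (z q) (z g) N ⟩
    (z p + z q + z g) + (N + N + N)         ≡⟨ cong (_+ (N + N + N)) t ⟩
    (N + 2 * c p q) + (N + N + N)           ≡⟨ arith₂ N (c p q) ⟩
    ((N + N) + (N + N)) + 2 * c p q         ≡⟨ cong₂ (λ u v → u + 2 * v) N′ c′ ⟨
    O′.N + 2 * O′.c σ α                     ∎
    where
    open ≡-Reasoning
    arith₁ : ∀ a b d n → (a + d) + (n + n) + (b + n) ≡ (a + b + d) + (n + n + n)
    arith₁ = solve-∀
    arith₂ : ∀ n m → (n + 2 * m) + (n + n + n) ≡ ((n + n) + (n + n)) + 2 * m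
    arith₂ = solve-∀

-- The colours are read off the darts x⁺, whose faces are the hyperedges. Points fixed by `q` are
-- first removed from the inflated map, where their polygon sides are loops.
hypermap-colouring : ∀ {k m} → 3 ≤ k → Fin m → CyclicBound k m →
  ∀ {E : Set} (F : Finite E) (p q : Perm E) → let open Orbits F ; open Genus F in
  Tight p q →
  (∀ x → to q x ≡ x → to p x ≡ x) →
  (∀ x → to q x ≢ x → ¬ Orb p ∋ x ~ to q x) →
  (∀ x → ∃[ j ] suc j ≤ k × iter (to q) (suc j) x ≡ x) →
  Σ[ col ∈ (E → Fin m) ]
    (∀ {x y} → to q x ≢ x → to q y ≢ y → Orb p ∋ x ~ y → col x ≡ col y) ×
    (∀ {x y} → to q x ≢ x → Orb q ∋ x ~ y → ¬ Orb p ∋ x ~ y → col x ≢ col y)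
hypermap-colouring {k} {m} 3≤k c₀ bound {E} F p q tight isolated loopless short =
  (λ x → col C (x ⁺)) ,
  (λ {x} {y} lx ly r → onOrbit C (G′.isolateAll-⊇ off σ (in⇒∉off {x ⁺} lx) (in⇒∉off {y ⁺} ly) (⁺-cong r))) ,
  (λ {x} {y} lx r ≁ → faces C (orb-in {x ⁺} lx (⁺-face r)) (≁ ∘ vertexOf-cong ∘ G′.isolateAll-⊆ off σ))
  where
  open Orbits F
  open Genus F
  open Inflation F p q
  open Maps F′ k
  open Colouring

  base : Darts → E
  base (x ⁺) = x
  base (x ⁻) = x
  base (x ˢ) = x
  base (x ᶻ) = x

  K : Darts → Set
  K d = to q (base d) ≢ base d

  g-fixed : ∀ {x} → to q x ≡ x → to g x ≡ x
  g-fixed {x} eq = trans (cong (to p) eq) (isolated x eq)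

  K-σ : ∀ {d} → K d → K (to σ d)
  K-σ {x ⁺} l    = l
  K-σ {x ⁻} l eq = l (injective q eq)
  K-σ {x ˢ} l eq = l (subst (λ y → to q y ≡ y) (trans (sym (g-fixed eq)) (to-from g x)) eq)
  K-σ {x ᶻ} l eq = l (subst (λ y → to q y ≡ y) (injective g (g-fixed eq)) eq)

  K-α : ∀ {d} → K d → K (to α d)
  K-α {x ⁺} l = l
  K-α {x ⁻} l = l
  K-α {x ˢ} l = l
  K-α {x ᶻ} l = l

  open Restriction σ α (λ d → ¬? (Finite._≟_ F (to q (base d)) (base d))) (λ {d} → K-σ {d}) (λ {d} → K-α {d})

  iter-⁺ : ∀ i x → iter (to (σ ∙ α)) i (x ⁺) ≡ iter (to q) i x ⁺
  iter-⁺ zero    x = refl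
  iter-⁺ (suc i) x = cong (to (σ ∙ α)) (iter-⁺ i x)

  good : Good σᴷ αᴷ
  good = restrict-good (ℕ.≤-trans (s≤s z≤n) 3≤k) (inflate-tight tight) (from-to α)
    (λ { (_ ⁺) () ; (_ ⁻) () ; (_ ˢ) () ; (_ ᶻ) () })
    (λ { (x ⁺) l _ r → no-loop l (vertexOf-cong r)
       ; (x ⁻) l _ r → no-loop l (Eqv.~sym (Orb p) (vertexOf-cong r))
       ; (x ˢ) l _ r → vertexOf-cong r
       ; (x ᶻ) l _ r → vertexOf-cong r })
    λ { (x ⁺) → let j , j≤k , eq = short x in j , j≤k , trans (iter-⁺ (suc j) x) (cong _⁺ eq)
      -- The remaining faces are the triangles x⁻, xˢ, (g x)ᶻ; this is the use of 3 ≤ `k`.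
      ; (x ⁻) → 2 , 3≤k , cong _⁻ (from-to g x)
      ; (x ˢ) → 2 , 3≤k , cong _ˢ (from-to g x)
      ; (x ᶻ) → 2 , 3≤k , cong _ᶻ (to-from g x) }
    where
    no-loop : ∀ {x} → to q x ≢ x → ¬ Orb p ∋ x ~ to g x
    no-loop {x} l r = loopless x l (Eqv.~trans (Orb p) r (Eqv.~sym (Orb p) (orb-step p (to q x))))

  C : Colouring m σᴷ αᴷ
  C = Cutting.Reduction.colour F′ k c₀ simpleCase (suc (Cutting.liveCount F′ k αᴷ)) good (ℕ.n<1+n _)
    where
    simpleCase : ∀ {σ α} → Good σ α → ∀ d₀ → Live α d₀ →
      (∀ {d d′} → Live α d → Live α d′ → O′.Conn σ α ∋ d ~ d′) →
      (∀ {e e′} → Live α e → Live α e′ → O′.Orb σ ∋ e ~ e′ → O′.Orb σ ∋ to α e ~ to α e′ → e ≡ e′) →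
      Colouring m σ α
    simpleCase g d₀ l₀ conn simple = S.colouring (bound S.H S.faces-short)
      where module S = SimpleMap F′ g d₀ l₀ conn simple

-- From a planar map and a vertex class C independent in the set B of usable edges: the hypermap with
-- the vertices of C, and a hyperedge for the B-neighbours in C of each vertex outside C.
record Extraction {A : Set} (F : Finite A) (σ α : Perm A) (C B : A → Set) : Set where
  open Orbits F
  open Genus F
  field
    s h           : Perm A
    tight         : Tight s h
    isolated      : ∀ d → to h d ≡ d → to s d ≡ d
    live-C        : ∀ {d} → to h d ≢ d → C d
    live-B        : ∀ {d} → to h d ≢ d → B d
    vertex        : ∀ {d d′} → to h d ≢ d → to h d′ ≢ d′ → Orb σ ∋ d ~ d′ → Orb s ∋ d ~ d′
    vertex⁻       : ∀ {d d′} → Orb s ∋ d ~ d′ → Orb σ ∋ d ~ d′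
    hyperedge     : ∀ {d d′} → C d → C d′ → B d → B d′ → Orb σ ∋ to α d ~ to α d′ → Orb h ∋ d ~ d′
    hyperedge⁻    : ∀ {d d′} → to h d ≢ d → to h d′ ≢ d′ → Orb h ∋ d ~ d′ → Orb σ ∋ to α d ~ to α d′

module Extract {A : Set} (F : Finite A) (σ α : Perm A) {C B : A → Set}
  (C? : ∀ d → Dec (C d)) (B? : ∀ d → Dec (B d))
  (C-σ : ∀ {d} → C d → C (to σ d)) (C-σ⁻ : ∀ {d} → C (to σ d) → C d)
  (α-B : ∀ {d} → B d → B (to α d)) (α² : ∀ d → to α (to α d) ≡ d)
  (B-C : ∀ {d} → B d → C d → ¬ C (to α d)) (B-¬C : ∀ {d} → B d → ¬ C d → C (to α d))
  (tight₀ : Genus.Tight F σ α) where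
  open Finite F
  open Orbits F
  open Genus F

  offB offC : List A
  offB = filter (λ d → ¬? (B? d)) enum
  offC = filter (λ d → ¬? (C? d)) enum

  ∉offB : ∀ {d} → B d → d ∉ offB
  ∉offB b d∈ = proj₂ (∈-filter⁻ (λ d → ¬? (B? d)) {xs = enum} d∈) b

  ∉offC : ∀ {d} → C d → d ∉ offC
  ∉offC c d∈ = proj₂ (∈-filter⁻ (λ d → ¬? (C? d)) {xs = enum} d∈) c

  ∈offC : ∀ {d} → ¬ C d → d ∈ offC
  ∈offC ¬c = ∈-filter⁺ (λ d → ¬? (C? d)) (∈enum _) ¬c

  -- The last factor `s⁻` undoes `σ` on arrival in C and does nothing elsewhere. So a usable dart of
  -- C is taken by `h` across its edge and one turn further at the outer vertex, a usable outer dart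
  -- is taken across into C, and an unusable outer dart just turns. A cycle of `h` thus winds around
  -- an outer vertex and visits the darts coming from its neighbours in C; `h′` keeps only those.
  αᴮ φ s⁻ s h h′ : Perm A
  αᴮ = isolateAll offB α
  φ  = σ ∙ αᴮ
  s⁻ = isolateAll offC (σ ⁻¹)
  s  = s⁻ ⁻¹
  h  = s⁻ ∙ φ
  h′ = isolateAll offC h

  fixed : List A
  fixed = filter (λ d → to h′ d ≟ d) enum

  -- Points fixed by `h′` lie in no hyperedge with two points; they are taken out of the vertices as
  -- well, as `isolated` demands.
  s′ : Perm A
  s′ = isolateAll fixed s

  -- Splitting the cycles of σ⁻¹ with φ held fixed turns the cycles of σ outside C into hyperedges.
  tight : Tight s′ h′
  tight = tight-swap h′ s′ (tight-isolateAll fixed h′ s (tight-swap s h′ (tight-isolateAll offC s h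
    (tight-rotate s⁻ φ (tight-swap φ s⁻ (tight-isolateAll offC φ (σ ⁻¹) (tight-swap (σ ⁻¹) φ
    (tight-rotate σ αᴮ (tight-isolateAll offB σ α tight₀)))))))))

  αᴮ-B : ∀ {d} → B d → to αᴮ d ≡ to α d
  αᴮ-B b = isolateAll-keeps offB α (∉offB b) (∉offB (α-B b))

  αᴮ-off : ∀ {d} → ¬ B d → to αᴮ d ≡ d
  αᴮ-off ¬b = isolateAll-fixes α (∈-filter⁺ (λ d → ¬? (B? d)) (∈enum _) ¬b)

  s⁻-C : ∀ {d} → C d → to s⁻ (to σ d) ≡ d
  s⁻-C {d} cd = trans (isolateAll-keeps offC (σ ⁻¹) (∉offC (C-σ cd))
    (subst (_∉ offC) (sym (from-to σ d)) (∉offC cd))) (from-to σ d)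

  s⁻-off : ∀ {d} → ¬ C d → to s⁻ (to σ d) ≡ to σ d
  s⁻-off ¬c = isolateAll-fixes (σ ⁻¹) (∈offC (¬c ∘ C-σ⁻))

  h-C-B : ∀ {d} → C d → B d → to h d ≡ to σ (to α d)
  h-C-B cd b = trans (cong (to s⁻ ∘ to σ) (αᴮ-B b)) (s⁻-off (B-C b cd))

  h-C-off : ∀ {d} → C d → ¬ B d → to h d ≡ d
  h-C-off cd ¬b = trans (cong (to s⁻ ∘ to σ) (αᴮ-off ¬b)) (s⁻-C cd)

  h-W-B : ∀ {d} → ¬ C d → B d → to h d ≡ to α d
  h-W-B ¬c b = trans (cong (to s⁻ ∘ to σ) (αᴮ-B b)) (s⁻-C (B-¬C b ¬c))

  h-W-off : ∀ {d} → ¬ C d → ¬ B d → to h d ≡ to σ d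
  h-W-off ¬c ¬b = trans (cong (to s⁻ ∘ to σ) (αᴮ-off ¬b)) (s⁻-off ¬c)

  around : ∀ {d} → ¬ C d → Orb h ∋ d ~ to σ d
  around {d} ¬c with B? d
  ... | no ¬b = subst (Orb h ∋ d ~_) (h-W-off ¬c ¬b) (orb-step h d)
  ... | yes b = Eqv.~trans (Orb h) (subst (Orb h ∋ d ~_) (h-W-B ¬c b) (orb-step h d))
                  (subst (Orb h ∋ to α d ~_)
                    (trans (h-C-B (B-¬C b ¬c) (α-B b)) (cong (to σ) (α² d))) (orb-step h (to α d)))

  around* : ∀ {d d′} → ¬ C d → Orb σ ∋ d ~ d′ → Orb h ∋ d ~ d′
  around* {d} ¬c r with orb⇒iter σ r
  ... | i , refl = proj₁ (iter-closed (λ x → Orb h ∋ d ~ x × ¬ C x)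
          (λ { (r , ¬cx) → Eqv.~trans (Orb h) r (around ¬cx) , ¬cx ∘ C-σ⁻ }) i (Eqv.~refl (Orb h) , ¬c))

  sameHyperedge : ∀ {d d′} → C d → C d′ → B d → B d′ → Orb σ ∋ to α d ~ to α d′ → Orb h′ ∋ d ~ d′
  sameHyperedge c c′ b b′ r = isolateAll-⊇ offC h (∉offC c) (∉offC c′)
    (~trans (~sym (spoke c b)) (~trans (around* (B-C b c) r) (spoke c′ b′)))
    where
    open Eqv (Orb h)
    spoke : ∀ {d} → C d → B d → rel (to α d) d
    spoke {d} c b = subst (rel (to α d)) (trans (h-W-B (B-C b c) (α-B b)) (α² d)) (orb-step h (to α d))

  -- Assigns to a dart one at the outer vertex around which its `h`-cycle winds. The vertex of
  -- `hub d` is invariant under `h`, which yields the converse of `sameHyperedge`.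
  hub : A → A
  hub d with C? d | B? d
  ... | yes _ | yes _ = to α d
  ... | _     | _     = d

  hub-C-B : ∀ {d} → C d → B d → hub d ≡ to α d
  hub-C-B {d} c b with C? d | B? d
  ... | yes _ | yes _ = refl
  ... | no ¬c | _     = contradiction c ¬c
  ... | yes _ | no ¬b = contradiction b ¬b

  hub-W : ∀ {d} → ¬ C d → hub d ≡ d
  hub-W {d} ¬c with C? d | B? d
  ... | no  _ | _ = refl
  ... | yes c | _ = contradiction c ¬c

  hub-step : ∀ d → Orb σ ∋ hub d ~ hub (to h d)
  hub-step d = case C? d , B? d of λ
    { (yes c , yes b) → subst₂ rel (sym (hub-C-B c b))
        (sym (trans (cong hub (h-C-B c b)) (hub-W (B-C b c ∘ C-σ⁻)))) (orb-step σ (to α d))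
    ; (yes c , no ¬b) → subst (λ x → rel (hub d) (hub x)) (sym (h-C-off c ¬b)) ~refl
    ; (no ¬c , yes b) → subst₂ rel (sym (hub-W ¬c)) (sym (trans (cong hub (h-W-B ¬c b))
        (trans (hub-C-B (B-¬C b ¬c) (α-B b)) (α² d)))) ~refl
    ; (no ¬c , no ¬b) → subst₂ rel (sym (hub-W ¬c))
        (sym (trans (cong hub (h-W-off ¬c ¬b)) (hub-W (¬c ∘ C-σ⁻)))) (orb-step σ d) }
    where open Eqv (Orb σ)

  live-C : ∀ {d} → to h′ d ≢ d → C d
  live-C {d} l with C? d
  ... | yes c = c
  ... | no ¬c = contradiction (isolateAll-fixes h (∈offC ¬c)) l

  live-B : ∀ {d} → to h′ d ≢ d → B d
  live-B {d} l with B? d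
  ... | yes b = b
  ... | no ¬b = contradiction (isolateAll-fixed offC h (h-C-off (live-C l) ¬b)) l

  ∉fixed : ∀ {d} → to h′ d ≢ d → d ∉ fixed
  ∉fixed l d∈ = l (proj₂ (∈-filter⁻ (λ d → to h′ d ≟ d) {xs = enum} d∈))

  extraction : Extraction F σ α C B
  extraction = record
    { s          = s′
    ; h          = h′
    ; tight      = tight
    ; isolated   = λ d eq → isolateAll-fixes s (∈-filter⁺ (λ d → to h′ d ≟ d) (∈enum d) eq)
    ; live-C     = live-C
    ; live-B     = live-B
    ; vertex     = λ l l′ r → isolateAll-⊇ fixed s (∉fixed l) (∉fixed l′) (orb-inverse s⁻
        (isolateAll-⊇ offC (σ ⁻¹) (∉offC (live-C l)) (∉offC (live-C l′)) (orb-inverse σ r)))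
    ; vertex⁻    = λ r → orb-inverse (σ ⁻¹)
        (isolateAll-⊆ offC (σ ⁻¹) (orb-inverse s (isolateAll-⊆ fixed s r)))
    ; hyperedge  = sameHyperedge
    ; hyperedge⁻ = λ {d} {d′} l l′ r → subst₂ (Eqv.rel (Orb σ)) (hub-C-B (live-C l) (live-B l)) (hub-C-B (live-C l′) (live-B l′))
        (orb-least (On.isEquivalence hub (Eqv.equiv (Orb σ))) h hub-step (isolateAll-⊆ offC h r)) }

-- Colouring a single class

module ColourClass {n} (H : PlaneGraph n) (G : Graph n)
  (G⊆H : ∀ u v → adj G u v ≡ true → adj (graph H) u v ≡ true)
  (inC : Fin n → Bool)
  (independent : ∀ {u v} → adj G u v ≡ true → inC u ≡ true → inC v ≢ true)
  {k m : ℕ} (frugal : ∀ w → countV (λ v → adj G w v ∧ inC v) ≤ k)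
  (3≤k : 3 ≤ k) (c₀ : Fin m) (bound : CyclicBound k m) where

  open DartPerms H
  open Genus (finitePairs n)

  D : Set
  D = Fin n × Fin n

  C : D → Set
  C d = inC (proj₁ d) ≡ true

  C? : ∀ d → Dec (C d)
  C? d = Bool._≟_ (inC (proj₁ d)) true

  -- The edges of `G` that meet the class; by independence each has exactly one end in it. All other
  -- edges of `H` are deleted from the embedding.
  B : D → Set
  B (u , v) = adj G u v ≡ true × (inC u ≡ true ⊎ inC v ≡ true)

  B? : ∀ d → Dec (B d)
  B? (u , v) = Bool._≟_ (adj G u v) true ×-dec (Bool._≟_ (inC u) true ⊎-dec Bool._≟_ (inC v) true)

  flip-B : ∀ {u v} → B (u , v) → flip (u , v) ≡ (v , u)
  flip-B {u} {v} b = flip-dart (G⊆H u v (proj₁ b))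

  extract : ∀ {u₀ v₀} → adj (graph H) u₀ v₀ ≡ true → Extraction (finitePairs n) σ₀ α₀ C B
  extract a₀ = Extract.extraction (finitePairs n) σ₀ α₀ C? B?
    (λ {d} → subst (λ u → inC u ≡ true) (sym (next-proj₁ d)))
    (λ {d} → subst (λ u → inC u ≡ true) (next-proj₁ d))
    (λ {d} b → subst B (sym (flip-B b)) (B-swap b))
    flip-involutive
    (λ {d} b c → subst (λ e → ¬ C e) (sym (flip-B b)) (independent (proj₁ b) c))
    (λ {d} b ¬c → subst C (sym (flip-B b)) ([ (λ c → contradiction c ¬c) , id ]′ (proj₂ b)))
    (tight₀ a₀)
    where
    B-swap : ∀ {u v} → B (u , v) → B (v , u)
    B-swap {u} {v} (a , p) = trans (adj-sym G v u) a , [ inj₂ , inj₁ ]′ p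

  module FromExtraction (X : Extraction (finitePairs n) σ₀ α₀ C B) where
    open Extraction X

    Live : D → Set
    Live d = to h d ≢ d

    live-next : ∀ {d} → Live d → Live (to h d)
    live-next l eq = l (injective h eq)

    tail : ∀ {d d′} → Orb σ₀ ∋ d ~ d′ → proj₁ d ≡ proj₁ d′
    tail = orb-least (On.isEquivalence proj₁ isEquivalence) σ₀ (sym ∘ next-proj₁)

    sameTail : ∀ {d d′} → Live d → Live d′ → proj₁ d ≡ proj₁ d′ → Orb s ∋ d ~ d′
    sameTail {u , v} {u′ , v′} l l′ refl =
      vertex l l′ (sameVertex (G⊆H u v (proj₁ (live-B l))) (G⊆H u v′ (proj₁ (live-B l′))))

    sameHead : ∀ {d d′} → Live d → Live d′ → Orb h ∋ d ~ d′ → proj₂ d ≡ proj₂ d′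
    sameHead l l′ r = trans (sym (cong proj₁ (flip-B (live-B l))))
      (trans (tail (hyperedge⁻ l l′ r)) (cong proj₁ (flip-B (live-B l′))))

    -- The darts of a hyperedge share their head; if they also share their tail they coincide, `H`
    -- being simple.
    loopless : ∀ d → Live d → ¬ Orb s ∋ d ~ to h d
    loopless d l r = l (sym (cong₂ _,_ (tail (vertex⁻ r)) (sameHead l (live-next l) (orb-step h d))))

    -- The darts of a hyperedge have a common head `w`, and their tails are distinct neighbours of
    -- `w` in the class. Frugality leaves at most `k` of them.
    short : ∀ d → ∃[ j ] suc j ≤ k × iter (to h) (suc j) d ≡ d
    short d with to h d ≟ᵖ d
    ... | yes eq = 0 , ℕ.≤-trans (s≤s z≤n) 3≤k , eq
    ... | no l = let j , j≤ , eq = iter-period (injective h) d (λ i → index (member i)) distinct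
                 in j , ℕ.≤-trans j≤ (frugal w) , eq
      where
      w = proj₂ d
      good? : ∀ v → Dec ((adj G w v ∧ inC v) ≡ true)
      good? v = Bool._≟_ (adj G w v ∧ inC v) true
      live-iter : ∀ i → Live (iter (to h) i d)
      live-iter i = iter-closed Live live-next i l
      head-iter : ∀ i → proj₂ (iter (to h) i d) ≡ w
      head-iter i = sym (sameHead l (live-iter i) (iter⇒orb h i))
      member : ∀ i → proj₁ (iter (to h) i d) ∈ filter good? (allFin n)
      member i = ∈-filter⁺ good? (∈-allFin _) (∧-true⁺
        (trans (adj-sym G w _) (subst (λ x → adj G (proj₁ (iter (to h) i d)) x ≡ true) (head-iter i) (proj₁ (live-B (live-iter i)))))
        (live-C (live-iter i)))
      distinct : ∀ i j → index (member i) ≡ index (member j) → iter (to h) i d ≡ iter (to h) j d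
      distinct i j eq = cong₂ _,_
        (trans (Any.lookup-index (member i)) (trans (cong (lookup (filter good? (allFin n))) eq) (sym (Any.lookup-index (member j)))))
        (trans (head-iter i) (sym (head-iter j)))

    dartColouring = hypermap-colouring 3≤k c₀ bound (finitePairs n) s h tight isolated loopless short

    module FromDartColouring (dartCol : D → Fin m)
      (same : ∀ {x y} → Live x → Live y → Orb s ∋ x ~ y → dartCol x ≡ dartCol y)
      (distinct : ∀ {x y} → Live x → Orb h ∋ x ~ y → ¬ Orb s ∋ x ~ y → dartCol x ≢ dartCol y) where

      live? : ∀ u v → Dec (Live (u , v))
      live? u v = ¬? (to h (u , v) ≟ᵖ (u , v))

      classCol : Fin n → Fin m
      classCol u with any? (live? u) (allFin n)
      ... | yes a = dartCol (u , proj₁ (Any.satisfied a))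
      -- A vertex without a live dart shares no hyperedge with another vertex, so any colour will
      -- do.
      ... | no  _ = c₀

      classCol-live : ∀ {u v} → Live (u , v) → classCol u ≡ dartCol (u , v)
      classCol-live {u} {v} l with any? (live? u) (allFin n)
      ... | no ¬a = contradiction (lose (∈-allFin v) l) ¬a
      ... | yes a with Any.satisfied a
      ...   | w , l′ = same l′ l (sameTail l′ l refl)

      classCol-distinct : ∀ {u u′ w} → inC u ≡ true → inC u′ ≡ true → u ≢ u′ →
                          adj G w u ≡ true → adj G w u′ ≡ true → classCol u ≢ classCol u′
      classCol-distinct {u} {u′} {w} cu cu′ u≢u′ a a′ eq =
        distinct l r (u≢u′ ∘ tail ∘ vertex⁻)
          (trans (sym (classCol-live l)) (trans eq (classCol-live l′)))
        where
        out : ∀ {v} → inC v ≡ true → adj G w v ≡ true → B (v , w)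
        out {v} cv b = trans (adj-sym G v w) b , inj₁ cv
        r : Orb h ∋ (u , w) ~ (u′ , w)
        r = hyperedge cu cu′ (out cu a) (out cu′ a′) (subst₂ (Eqv.rel (Orb σ₀))
          (sym (flip-B (out cu a))) (sym (flip-B (out cu′ a′)))
          (sameVertex (G⊆H w u a) (G⊆H w u′ a′)))
        moves : ∀ {x y} → Orb h ∋ x ~ y → proj₁ x ≢ proj₁ y → Live x
        moves {x} r ≢ fix with orb⇒iter h r
        ... | i , refl = ≢ (cong proj₁ (sym (iter-closed (_≡ x) (λ { refl → fix }) i refl)))
        l = moves r u≢u′
        l′ = moves (Eqv.~sym (Orb h) r) (u≢u′ ∘ sym)

  classColouring : Σ[ col ∈ (Fin n → Fin m) ] (∀ {u u′ w} → inC u ≡ true → inC u′ ≡ true → u ≢ u′ →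
                   adj G w u ≡ true → adj G w u′ ≡ true → col u ≢ col u′)
  classColouring with any? (λ p → Bool._≟_ (isDart (graph H) (rot H) p) true) (pairs n)
  -- Without an edge in `H` there is none in `G`, and no two vertices have a common neighbour;
  -- `tight₀` starts from a dart.
  ... | no ¬d = (λ _ → c₀) , λ {u} {_} {w} _ _ _ a _ → contradiction (lose (∈pairs (w , u)) (G⊆H w u a)) ¬d
  ... | yes d = fromExtraction (extract (proj₂ (Any.satisfied d)))
    where
    fromExtraction : Extraction (finitePairs n) σ₀ α₀ C B →
      Σ[ col ∈ (Fin n → Fin m) ] (∀ {u u′ w} → inC u ≡ true → inC u′ ≡ true → u ≢ u′ →
      adj G w u ≡ true → adj G w u′ ≡ true → col u ≢ col u′)
    fromExtraction X = let col , same , distinct = dartColouring in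
      FromDartColouring.classCol col same distinct , FromDartColouring.classCol-distinct col same distinct
      where open FromExtraction X

-- Frugal colourings and the square

square-adj⁻ : ∀ {n} (G : Graph n) {u v} → adj (square G) u v ≡ true →
              u ≢ v × (adj G u v ≡ true ⊎ ∃[ w ] adj G u w ≡ true × adj G w v ≡ true)
square-adj⁻ {n} G {u} {v} eq with u Fin.≟ v | adj G u v in a
... | no u≢v | true  = u≢v , inj₁ refl
... | no u≢v | false with any-true⁻ {xs = allFin n} eq
...   | w , _ , p = u≢v , inj₂ (w , ∧-true⁻ p)

square-adj⁺ : ∀ {n} (G : Graph n) {u v} → u ≢ v →
              adj G u v ≡ true ⊎ ∃[ w ] adj G u w ≡ true × adj G w v ≡ true → adj (square G) u v ≡ true
square-adj⁺ {n} G {u} {v} u≢v p with u Fin.≟ v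
... | yes u≡v = contradiction u≡v u≢v
... | no _ with p
...   | inj₁ a rewrite a = refl
...   | inj₂ (w , a , b) rewrite any-true⁺ {p = λ w → adj G u w ∧ adj G w v} (∈-allFin w) (∧-true⁺ a b) =
        Bool.∨-zeroʳ (adj G u v)

adj⇒≢ : ∀ {n} (G : Graph n) {u v} → adj G u v ≡ true → u ≢ v
adj⇒≢ G {u} a refl = contradiction (trans (sym a) (adj-irrefl G u)) λ ()

length≤1 : ∀ {A : Set} {xs : List A} → Unique xs → (∀ {x y} → x ∈ xs → y ∈ xs → x ≡ y) → length xs ≤ 1
length≤1 {xs = []}         _ _ = z≤n
length≤1 {xs = _ ∷ []}     _ _ = s≤s z≤n
length≤1 {xs = _ ∷ _ ∷ _} ((x≢y ∷ _) ∷ _) eq = contradiction (eq (here refl) (there (here refl))) x≢y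

two∈ : ∀ {A : Set} {xs : List A} {x y} → x ∈ xs → y ∈ xs → x ≢ y → 2 ≤ length xs
two∈ {xs = _ ∷ _ ∷ _} _           _           _   = s≤s (s≤s z≤n)
two∈ {xs = _ ∷ []}    (here refl) (here refl) x≢y = contradiction refl x≢y

square⇒frugal : ∀ {n m} (G : Graph n) → Colourable (square G) m → FrugalColourable 1 G m
square⇒frugal {n} G (c , proper) = c ,
  (λ u v a → proper u v (square-adj⁺ G (adj⇒≢ G a) (inj₁ a))) ,
  λ u a → length≤1 (Unique.filter⁺ (on? u a) (Unique.allFin⁺ n)) (agree u a)
  where
  on? : ∀ u a v → Dec ((adj G u v ∧ (c v == a)) ≡ true)
  on? u a v = Bool._≟_ (adj G u v ∧ (c v == a)) true
  agree : ∀ u a {v w} → v ∈ filter (on? u a) (allFin n) → w ∈ filter (on? u a) (allFin n) → v ≡ w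
  agree u a {v} {w} v∈ w∈ with v Fin.≟ w
  ... | yes p = p
  ... | no v≢w with ∧-true⁻ (proj₂ (∈-filter⁻ (on? u a) {xs = allFin n} v∈))
                  | ∧-true⁻ (proj₂ (∈-filter⁻ (on? u a) {xs = allFin n} w∈))
  ...   | uv , cv | uw , cw = contradiction (trans (==-true⁻ cv) (sym (==-true⁻ cw)))
          (proper v w (square-adj⁺ G v≢w (inj₂ (u , trans (adj-sym G v u) uv , uw))))

frugal⇒square : ∀ {n m} (G : Graph n) → FrugalColourable 1 G m → Colourable (square G) m
frugal⇒square {n} G (c , proper , few) = c , proper²
  where
  proper² : Proper (square G) c
  proper² u v e ceq with square-adj⁻ G e
  ... | _   , inj₁ a = proper u v a ceq
  ... | u≢v , inj₂ (w , uw , wv) = ℕ.<⇒≱ (two∈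
        (seen u (trans (adj-sym G w u) uw) refl) (seen v wv (sym ceq)) u≢v) (few w (c u))
    where
    on? : ∀ v → Dec ((adj G w v ∧ (c v == c u)) ≡ true)
    on? v = Bool._≟_ (adj G w v ∧ (c v == c u)) true
    seen : ∀ v → adj G w v ≡ true → c v ≡ c u → v ∈ filter on? (allFin n)
    seen v a eq = ∈-filter⁺ on? (∈-allFin v) (∧-true⁺ a (==-true⁺ eq))

-- Makes the least number of colours computable, by enumerating the m ^ n maps.
colourable? : ∀ {n} (G : Graph n) m → Dec (Colourable G m)
colourable? {n} G m = map′
  (λ { (i , p) → finToFun i , p })
  (λ { (c , p) → funToFin c , λ u v a eq → p u v a
         (trans (sym (Fin.finToFun-funToFin c u)) (trans eq (Fin.finToFun-funToFin c v))) })
  (Fin.any? {n = m ^ n} λ i → Fin.all? λ u → Fin.all? λ v →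
    Bool._≟_ (adj G u v) true →-dec ¬? (finToFun {m} {n} i u Fin.≟ finToFun {m} {n} i v))

chromatic≤ : ∀ {n b} (G : Graph n) → Colourable (square G) b →
             Σ[ χ ∈ ℕ ] IsChromaticNumber (square G) χ × IsFrugalChromaticNumber 1 G χ × χ ≤ b
chromatic≤ G colouring with least (colourable? (square G)) colouring
... | χ , col , below = χ , (col , λ m m<χ → below m<χ) ,
      (square⇒frugal G col , λ m m<χ → below m<χ ∘ frugal⇒square G) ,
      ℕ.≮⇒≥ (λ b<χ → below b<χ colouring)

-- Product colouring. Adjacent vertices differ in `f`; vertices with a common neighbour either
-- differ in `f` or lie in one class, where the second coordinate separates them.
square-colouring : ∀ {k m t} → 3 ≤ k → Fin m → CyclicBound k m →
  ∀ {n} (G : Graph n) → Planar G → FrugalColourable k G t → Colourable (square G) (t * m)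
square-colouring _ _ _ G (inj₁ refl) _ = (λ ()) , λ ()
square-colouring {k} {m} {t} 3≤k c₀ bound {n} G (inj₂ (H , G⊆H)) (f , proper , few) = col , proper²
  where
  classCol : ∀ a → Σ[ col ∈ (Fin n → Fin m) ] (∀ {u v w} → (f u == a) ≡ true → (f v == a) ≡ true → u ≢ v →
             adj G w u ≡ true → adj G w v ≡ true → col u ≢ col v)
  classCol a = ColourClass.classColouring H G G⊆H (λ v → f v == a)
    (λ {u} {v} e p q → proper u v e (trans (==-true⁻ p) (sym (==-true⁻ q)))) (λ w → few w a) 3≤k c₀ bound
  col : Fin n → Fin (t * m)
  col v = combine (f v) (proj₁ (classCol (f v)) v)
  proper² : Proper (square G) col
  proper² u v e eq with square-adj⁻ G e | Fin.combine-injective (f u) _ (f v) _ eq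
  ... | _   , inj₁ a             | fu≡fv , _ = proper u v a fu≡fv
  ... | u≢v , inj₂ (w , uw , wv) | fu≡fv , ceq =
        proj₂ (classCol (f u)) {w = w} (==-true⁺ refl) (==-true⁺ (sym fu≡fv)) u≢v
          (trans (adj-sym G w u) uw) wv
          (trans ceq (cong (λ a → proj₁ (classCol a) v) (sym fu≡fv)))

-- Maximum degree and the numerical bound

∈⇒≤max : ∀ {xs x} → x ∈ xs → x ≤ foldr _⊔_ 0 xs
∈⇒≤max {y ∷ ys} (here refl) = ℕ.m≤m⊔n y _
∈⇒≤max {y ∷ ys} (there x∈)  = ℕ.≤-trans (∈⇒≤max x∈) (ℕ.m≤n⊔m y _)

edge⇒maxDegree : ∀ {n} (G : Graph n) {u v} → adj G u v ≡ true → 1 ≤ maxDegree G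
edge⇒maxDegree {n} G {u} {v} a = ℕ.≤-trans
  (nonempty (∈-filter⁺ (λ v → Bool._≟_ (adj G u v) true) (∈-allFin v) a))
  (∈⇒≤max (∈-map⁺ (degree G) (∈-allFin u)))
  where
  nonempty : ∀ {A : Set} {xs : List A} {x} → x ∈ xs → 1 ≤ length xs
  nonempty {xs = _ ∷ _} _ = s≤s z≤n

edgeless-square : ∀ {n} (G : Graph n) → maxDegree G ≡ 0 → Colourable (square G) 1
edgeless-square G Δ≡0 = (λ _ → zero) , λ u v e _ → case square-adj⁻ G e of λ
  { (_ , inj₁ a)           → no-edge a
  ; (_ , inj₂ (_ , a , _)) → no-edge a }
  where
  no-edge : ∀ {u v} → adj G u v ≢ true
  no-edge a = ℕ.<-irrefl (sym Δ≡0) (edge⇒maxDegree G a)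

-- With k = 2j and Δ = δ + 1:  ⌊δ/k⌋ · 3j ≤ 3δ/2 < ⌊3Δ/2⌋, the gap paying for the final −1.
colours≤ : ∀ j .{{_ : NonZero (j * 2)}} δ →
           (δ / (j * 2) + 3) * (3 * j) ≤ (3 * suc δ) / 2 + 9 * j ∸ 1
colours≤ j δ = begin
  (q + 3) * (3 * j)              ≡⟨ arith₁ q j ⟩
  suc (q * (3 * j)) + 9 * j ∸ 1  ≤⟨ ℕ.∸-monoˡ-≤ 1 (ℕ.+-monoˡ-≤ (9 * j) half) ⟩
  (3 * suc δ) / 2 + 9 * j ∸ 1    ∎
  where
  open ℕ.≤-Reasoning
  q = δ / (j * 2)
  arith₁ : ∀ q j → (q + 3) * (3 * j) ≡ q * (3 * j) + 9 * j
  arith₁ = solve-∀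
  arith₂ : ∀ q j → suc (q * (3 * j)) * 2 ≡ 3 * (q * (j * 2)) + 2
  arith₂ = solve-∀
  arith₃ : ∀ δ → 3 * δ + 3 ≡ 3 * suc δ
  arith₃ = solve-∀
  double : suc (q * (3 * j)) * 2 ≤ 3 * suc δ
  double = begin
    suc (q * (3 * j)) * 2    ≡⟨ arith₂ q j ⟩
    3 * (q * (j * 2)) + 2    ≤⟨ ℕ.+-mono-≤ (ℕ.*-monoʳ-≤ 3 (m/n*n≤m δ (j * 2))) (ℕ.n≤1+n 2) ⟩
    3 * δ + 3                ≡⟨ arith₃ δ ⟩
    3 * suc δ                ∎
  half : suc (q * (3 * j)) ≤ (3 * suc δ) / 2
  half = begin
    suc (q * (3 * j))          ≡⟨ m*n/n≡m (suc (q * (3 * j))) 2 ⟨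
    suc (q * (3 * j)) * 2 / 2  ≤⟨ /-monoˡ-≤ 2 double ⟩
    (3 * suc δ) / 2            ∎

-- An upper bound on the frugal chromatic number is expressed by a frugal colouring with that many
-- colours available. As `k` is even, 3k/2 is `3 * (k / 2)`.
theorem14 : (k : ℕ) .{{_ : NonZero k}} → 4 ≤ k → 2 ∣ k →
    (∀ {n} (H : PlaneGraph n) → MaxFaceSizeAtMost H k →
    CyclicColourable H (3 * (k / 2))) →
    ∀ {n} (G : Graph n) → Planar G →
    FrugalColourable k G ((maxDegree G ∸ 1) / k + 3) →
    Σ ℕ λ χ → IsChromaticNumber (square G) χ ×
    IsFrugalChromaticNumber 1 G χ ×
    χ ≤ (3 * maxDegree G) / 2 + 9 * (k / 2) ∸ 1
theorem14 k 4≤k (divides j refl) bound G planar frugal =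
  let χ , isχ , isχ₁ , χ≤ = chromatic≤ G (proj₂ (proj₂ colouring))
  in χ , isχ , isχ₁ , ℕ.≤-trans χ≤ (proj₁ (proj₂ colouring))
  where
  k/2≡j : j * 2 / 2 ≡ j
  k/2≡j = m*n/n≡m j 2
  2≤k/2 : 2 ≤ j * 2 / 2
  2≤k/2 = /-monoˡ-≤ 2 4≤k
  Budget : ℕ → ℕ
  Budget Δ = (3 * Δ) / 2 + 9 * (j * 2 / 2) ∸ 1
  colouring : ∃ λ b → b ≤ Budget (maxDegree G) × Colourable (square G) b
  colouring = go (maxDegree G) refl
    where
    go : ∀ Δ → maxDegree G ≡ Δ → ∃ λ b → b ≤ Budget (maxDegree G) × Colourable (square G) b
    -- For Δ = 0 truncated subtraction would still give three classes and 9k/2 colours, one more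
    -- than the bound. But then there are no edges, and one colour is enough.
    go zero Δ≡0 = 1 , subst (λ Δ → 1 ≤ Budget Δ) (sym Δ≡0)
        (ℕ.≤-trans (s≤s z≤n) (ℕ.∸-monoˡ-≤ 1 (ℕ.*-monoʳ-≤ 9 2≤k/2))) ,
      edgeless-square G Δ≡0
    go (suc δ) Δ≡1+δ = ((maxDegree G ∸ 1) / (j * 2) + 3) * (3 * (j * 2 / 2)) ,
      subst (λ Δ → ((Δ ∸ 1) / (j * 2) + 3) * (3 * (j * 2 / 2)) ≤ Budget Δ) (sym Δ≡1+δ)
        (subst (λ h → (δ / (j * 2) + 3) * (3 * h) ≤ (3 * suc δ) / 2 + 9 * h ∸ 1) (sym k/2≡j) (colours≤ j δ)) ,
      square-colouring (ℕ.≤-trans (ℕ.n≤1+n 3) 4≤k)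
        (fromℕ< (ℕ.≤-trans (s≤s z≤n) (ℕ.*-monoʳ-≤ 3 2≤k/2))) bound G planar frugal
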